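{- Let $\gamma(t)=1+\gamma_1t+\gamma_2t^2$ be a polynomial with integer coefficients $\gamma_1,\gamma_2$, and assume that every root of $\gamma(t)-t$ is real and negative. Then $h(t)=(1+t)^4\gamma\!\left(\frac{t}{(1+t)^2}\right)$ is the h-polynomial of a flag simplicial complex triangulating the $3$-sphere.
   Context: Simplicial complexes contain the empty face; $\#\sigma$ denotes the number of vertices of $\sigma$. Flag: every set of pairwise adjacent vertices is a face. f-polynomial $f_X(t)=\sum_{\sigma\in X}t^{\#\sigma}$. For $X$ triangulating $S^3$, the h-polynomial $h_X$ is defined by $(1+t)^4h_X(\frac1{1+t})=t^4f_X(\frac1t)$. -}

module Defs where

open import Algebra.Bundles.Raw using (RawMonoid; RawRing)
open import Algebra.Definitions.RawMonoid using (sum)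
open import Data.Fin using (Fin)
open import Data.Fin.Subset using (Subset; inside; outside; ⁅_⁆; _∈_; _⊆_; _∪_; ∣_∣) renaming (⊥ to ∅)
open import Data.Integer using (ℤ)
open import Data.List using (List; []; _∷_; _++_; map; filter; foldr)
open import Data.Nat as ℕ using (ℕ; zero; suc)
import Data.Nat.Properties as ℕₚ
open import Data.Product using (Σ; Σ-syntax; ∃; _×_; _,_; proj₁; proj₂)
open import Data.Rational as ℚ using (ℚ; 0ℚ; 1ℚ; ½)
import Data.Rational.Properties as ℚₚ
open import Data.Rational.Solver using (module +-*-Solver)
open import Data.Vec using ([]; _∷_)
open import Data.Vec.Functional using (Vector)
open import Function.Bundles using (Inverse)
open import Level using (0ℓ)
open import Relation.Binary.Bundles using (Setoid)
open import Relation.Binary.PropositionalEquality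
  using (_≡_; _≢_; refl; sym; trans; cong; subst)
open import Relation.Nullary using (¬_)
open import Relation.Unary using (Pred; Decidable)

import Algebra.Definitions.RawSemiring (RawRing.rawSemiring ℚ.+-*-rawRing) as ℚ^
open ℚ^ public using (_^_)

private
  abstract
    half+half : ∀ ε → ½ ℚ.* ε ℚ.+ ½ ℚ.* ε ≡ ε
    half+half ε = trans (sym (ℚₚ.*-distribʳ-+ ε ½ ½)) (ℚₚ.*-identityˡ ε)

    0<half : ∀ {ε} → 0ℚ ℚ.< ε → 0ℚ ℚ.< ½ ℚ.* ε
    0<half {ε} 0<ε = subst (ℚ._< ½ ℚ.* ε) (ℚₚ.*-zeroʳ ½) (ℚₚ.*-monoʳ-<-pos ½ 0<ε)

    swap-∣-∣ : ∀ a b → ℚ.∣ a ℚ.- b ∣ ≡ ℚ.∣ b ℚ.- a ∣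
    swap-∣-∣ a b = trans (cong ℚ.∣_∣ lem) (ℚₚ.∣-p∣≡∣p∣ (b ℚ.- a))
      where
      open +-*-Solver
      lem : a ℚ.- b ≡ ℚ.- (b ℚ.- a)
      lem = solve 2 (λ x y → x :- y := :- (y :- x)) refl a b

    split-∣-∣ : ∀ {p q r ε} → p ≡ q ℚ.+ r → ℚ.∣ q ∣ ℚ.< ½ ℚ.* ε → ℚ.∣ r ∣ ℚ.< ½ ℚ.* ε → ℚ.∣ p ∣ ℚ.< ε
    split-∣-∣ {p} {q} {r} {ε} refl u v =
      ℚₚ.≤-<-trans (ℚₚ.∣p+q∣≤∣p∣+∣q∣ q r) (subst (ℚ.∣ q ∣ ℚ.+ ℚ.∣ r ∣ ℚ.<_) (half+half ε) (ℚₚ.+-mono-< u v))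

    sum-∣-∣ : ∀ a b a′ b′ {ε} → ℚ.∣ a ℚ.- a′ ∣ ℚ.< ½ ℚ.* ε → ℚ.∣ b ℚ.- b′ ∣ ℚ.< ½ ℚ.* ε →
              ℚ.∣ (a ℚ.+ b) ℚ.- (a′ ℚ.+ b′) ∣ ℚ.< ε
    sum-∣-∣ a b a′ b′ = split-∣-∣ (solve 4 (λ a b c d → (a :+ b) :- (c :+ d) := (a :- c) :+ (b :- d)) refl a b a′ b′)
      where open +-*-Solver

    triangle-∣-∣ : ∀ a b c {ε} → ℚ.∣ a ℚ.- b ∣ ℚ.< ½ ℚ.* ε → ℚ.∣ b ℚ.- c ∣ ℚ.< ½ ℚ.* ε → ℚ.∣ a ℚ.- c ∣ ℚ.< ε
    triangle-∣-∣ a b c = split-∣-∣ (solve 3 (λ a b c → a :- c := (a :- b) :+ (b :- c)) refl a b c)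
      where open +-*-Solver

    neg-∣-∣ : ∀ a b → ℚ.∣ (ℚ.- a) ℚ.- (ℚ.- b) ∣ ≡ ℚ.∣ a ℚ.- b ∣
    neg-∣-∣ a b = trans (cong ℚ.∣_∣ (solve 2 (λ a b → (:- a) :- (:- b) := b :- a) refl a b)) (swap-∣-∣ b a)
      where open +-*-Solver

    self-∣-∣ : ∀ a → ℚ.∣ a ℚ.- a ∣ ≡ 0ℚ
    self-∣-∣ a = cong ℚ.∣_∣ (ℚₚ.+-inverseʳ a)

    bound-∣-∣ : ∀ a b → ℚ.∣ a ℚ.- b ∣ ℚ.< 1ℚ → ℚ.∣ a ∣ ℚ.≤ ℚ.∣ b ∣ ℚ.+ 1ℚ
    bound-∣-∣ a b h = ℚₚ.≤-trans
      (subst (λ z → ℚ.∣ z ∣ ℚ.≤ ℚ.∣ b ∣ ℚ.+ ℚ.∣ a ℚ.- b ∣)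
             (solve 2 (λ a b → b :+ (a :- b) := a) refl a b)
             (ℚₚ.∣p+q∣≤∣p∣+∣q∣ b (a ℚ.- b)))
      (ℚₚ.+-monoʳ-≤ ℚ.∣ b ∣ (ℚₚ.<⇒≤ h))
      where open +-*-Solver

    0<∣∣+1 : ∀ a → 0ℚ ℚ.< ℚ.∣ a ∣ ℚ.+ 1ℚ
    0<∣∣+1 a = subst (ℚ._< ℚ.∣ a ∣ ℚ.+ 1ℚ) (ℚₚ.+-identityˡ 0ℚ)
                 (ℚₚ.+-mono-≤-< (ℚₚ.0≤∣p∣ a) (ℚₚ.positive⁻¹ 1ℚ))

    shrink : ∀ A ε → 0ℚ ℚ.< A → 0ℚ ℚ.< ε → ∃ λ δ → 0ℚ ℚ.< δ × A ℚ.* δ ≡ ε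
    shrink A ε 0<A 0<ε = 1/A ℚ.* ε , 0<δ , eq
      where
      instance
        A-pos : ℚ.Positive A
        A-pos = ℚ.positive 0<A
        A-nz : ℚ.NonZero A
        A-nz = ℚₚ.pos⇒nonZero A
      1/A : ℚ
      1/A = ℚ.1/ A
      instance
        1/A-pos : ℚ.Positive 1/A
        1/A-pos = ℚₚ.1/pos⇒pos A
      0<δ : 0ℚ ℚ.< 1/A ℚ.* ε
      0<δ = subst (ℚ._< 1/A ℚ.* ε) (ℚₚ.*-zeroʳ 1/A) (ℚₚ.*-monoʳ-<-pos 1/A 0<ε)
      eq : A ℚ.* (1/A ℚ.* ε) ≡ ε
      eq = trans (sym (ℚₚ.*-assoc A 1/A ε)) (trans (cong (ℚ._* ε) (ℚₚ.*-inverseʳ A)) (ℚₚ.*-identityˡ ε))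

    prod-< : ∀ {A δ ε} p q → 0ℚ ℚ.< A → ℚ.∣ p ∣ ℚ.≤ A → ℚ.∣ q ∣ ℚ.< δ → A ℚ.* δ ≡ ε → ℚ.∣ p ℚ.* q ∣ ℚ.< ε
    prod-< {A} {δ} p q 0<A u v refl = subst (ℚ._< A ℚ.* δ) (sym (ℚₚ.∣p*q∣≡∣p∣*∣q∣ p q))
      (ℚₚ.≤-<-trans (ℚₚ.*-monoʳ-≤-nonNeg ℚ.∣ q ∣ {{ℚₚ.∣-∣-nonNeg q}} u)
                    (ℚₚ.*-monoʳ-<-pos A {{ℚ.positive 0<A}} v))

    mul-∣-∣ : ∀ a b a′ b′ {ε} → ℚ.∣ a ℚ.* (b ℚ.- b′) ∣ ℚ.< ½ ℚ.* ε → ℚ.∣ b′ ℚ.* (a ℚ.- a′) ∣ ℚ.< ½ ℚ.* ε →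
              ℚ.∣ (a ℚ.* b) ℚ.- (a′ ℚ.* b′) ∣ ℚ.< ε
    mul-∣-∣ a b a′ b′ =
      split-∣-∣ (solve 4 (λ a b c d → (a :* b) :- (c :* d) := (a :* (b :- d)) :+ (d :* (a :- c))) refl a b a′ b′)
      where open +-*-Solver

Cauchy : (ℕ → ℚ) → Set
Cauchy x = ∀ ε → 0ℚ ℚ.< ε → ∃ λ N → ∀ m n → N ℕ.≤ m → N ℕ.≤ n → ℚ.∣ x m ℚ.- x n ∣ ℚ.< ε

-- Real numbers are Cauchy sequences up to the setoid equality _≈_ below.
record ℝ : Set where
  constructor mkℝ
  field
    seq    : ℕ → ℚ
    cauchy : Cauchy seq

open ℝ public

infix  4 _≈_ _<_ _≤_
infixl 6 _+_
infixl 7 _*_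
infix  8 -_

_≈_ : ℝ → ℝ → Set
x ≈ y = ∀ ε → 0ℚ ℚ.< ε → ∃ λ N → ∀ n → N ℕ.≤ n → ℚ.∣ seq x n ℚ.- seq y n ∣ ℚ.< ε

_<_ : ℝ → ℝ → Set
x < y = Σ[ ε ∈ ℚ ] 0ℚ ℚ.< ε × ∃ λ N → ∀ n → N ℕ.≤ n → seq x n ℚ.+ ε ℚ.< seq y n

_≤_ : ℝ → ℝ → Set
x ≤ y = ¬ (y < x)

private
  abstract
    const-cauchy : ∀ q → Cauchy (λ _ → q)
    const-cauchy q ε 0<ε = 0 , λ _ _ _ _ → subst (ℚ._< ε) (sym (self-∣-∣ q)) 0<ε

    +-cauchy : ∀ {x y} → Cauchy x → Cauchy y → Cauchy (λ n → x n ℚ.+ y n)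
    +-cauchy {x} {y} cx cy ε 0<ε with cx (½ ℚ.* ε) (0<half 0<ε) | cy (½ ℚ.* ε) (0<half 0<ε)
    ... | M , p | N , q = M ℕ.⊔ N , λ m n u v → sum-∣-∣ (x m) (y m) (x n) (y n)
      (p m n (ℕₚ.m⊔n≤o⇒m≤o M N u) (ℕₚ.m⊔n≤o⇒m≤o M N v))
      (q m n (ℕₚ.m⊔n≤o⇒n≤o M N u) (ℕₚ.m⊔n≤o⇒n≤o M N v))

    neg-cauchy : ∀ {x} → Cauchy x → Cauchy (λ n → ℚ.- x n)
    neg-cauchy {x} cx ε 0<ε with cx ε 0<ε
    ... | N , p = N , λ m n u v → subst (ℚ._< ε) (sym (neg-∣-∣ (x m) (x n))) (p m n u v)

    *-cauchy : ∀ {x y} → Cauchy x → Cauchy y → Cauchy (λ n → x n ℚ.* y n)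
    *-cauchy {x} {y} cx cy ε 0<ε
      with cx 1ℚ (ℚₚ.positive⁻¹ 1ℚ) | cy 1ℚ (ℚₚ.positive⁻¹ 1ℚ)
    ... | K , bx | L , by
      with shrink (ℚ.∣ x K ∣ ℚ.+ 1ℚ) (½ ℚ.* ε) (0<∣∣+1 (x K)) (0<half 0<ε)
         | shrink (ℚ.∣ y L ∣ ℚ.+ 1ℚ) (½ ℚ.* ε) (0<∣∣+1 (y L)) (0<half 0<ε)
    ... | δ , 0<δ , eδ | η , 0<η , eη with cy δ 0<δ | cx η 0<η
    ... | M , p | N , q = (K ℕ.⊔ L) ℕ.⊔ (M ℕ.⊔ N) , λ m n u v → mul-∣-∣ (x m) (y m) (x n) (y n)
      (prod-< (x m) (y m ℚ.- y n) (0<∣∣+1 (x K)) (bound-∣-∣ (x m) (x K) (bx m K (K≤ u) ℕₚ.≤-refl)) (p m n (M≤ u) (M≤ v)) eδ)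
      (prod-< (y n) (x m ℚ.- x n) (0<∣∣+1 (y L)) (bound-∣-∣ (y n) (y L) (by n L (L≤ v) ℕₚ.≤-refl)) (q m n (N≤ u) (N≤ v)) eη)
      where
      K≤ : ∀ {o} → (K ℕ.⊔ L) ℕ.⊔ (M ℕ.⊔ N) ℕ.≤ o → K ℕ.≤ o
      K≤ h = ℕₚ.m⊔n≤o⇒m≤o K L (ℕₚ.m⊔n≤o⇒m≤o (K ℕ.⊔ L) (M ℕ.⊔ N) h)
      L≤ : ∀ {o} → (K ℕ.⊔ L) ℕ.⊔ (M ℕ.⊔ N) ℕ.≤ o → L ℕ.≤ o
      L≤ h = ℕₚ.m⊔n≤o⇒n≤o K L (ℕₚ.m⊔n≤o⇒m≤o (K ℕ.⊔ L) (M ℕ.⊔ N) h)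
      M≤ : ∀ {o} → (K ℕ.⊔ L) ℕ.⊔ (M ℕ.⊔ N) ℕ.≤ o → M ℕ.≤ o
      M≤ h = ℕₚ.m⊔n≤o⇒m≤o M N (ℕₚ.m⊔n≤o⇒n≤o (K ℕ.⊔ L) (M ℕ.⊔ N) h)
      N≤ : ∀ {o} → (K ℕ.⊔ L) ℕ.⊔ (M ℕ.⊔ N) ℕ.≤ o → N ℕ.≤ o
      N≤ h = ℕₚ.m⊔n≤o⇒n≤o M N (ℕₚ.m⊔n≤o⇒n≤o (K ℕ.⊔ L) (M ℕ.⊔ N) h)

  abstract
    ≈-refl : ∀ {x} → x ≈ x
    ≈-refl {x} ε 0<ε = 0 , λ n _ → subst (ℚ._< ε) (sym (self-∣-∣ (seq x n))) 0<ε

    ≈-sym : ∀ {x y} → x ≈ y → y ≈ x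
    ≈-sym {x} {y} h ε 0<ε with h ε 0<ε
    ... | N , p = N , λ n u → subst (ℚ._< ε) (swap-∣-∣ (seq x n) (seq y n)) (p n u)

    ≈-trans : ∀ {x y z} → x ≈ y → y ≈ z → x ≈ z
    ≈-trans {x} {y} {z} h k ε 0<ε with h (½ ℚ.* ε) (0<half 0<ε) | k (½ ℚ.* ε) (0<half 0<ε)
    ... | M , p | N , q = M ℕ.⊔ N , λ n u → triangle-∣-∣ (seq x n) (seq y n) (seq z n)
      (p n (ℕₚ.m⊔n≤o⇒m≤o M N u)) (q n (ℕₚ.m⊔n≤o⇒n≤o M N u))

fromℚ : ℚ → ℝ
fromℚ q = mkℝ (λ _ → q) (const-cauchy q)

fromℤ : ℤ → ℝ
fromℤ i = fromℚ (i ℚ./ 1)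

0ℝ 1ℝ : ℝ
0ℝ = fromℚ 0ℚ
1ℝ = fromℚ 1ℚ

_+_ : ℝ → ℝ → ℝ
x + y = mkℝ (λ n → seq x n ℚ.+ seq y n) (+-cauchy {seq x} {seq y} (cauchy x) (cauchy y))

_*_ : ℝ → ℝ → ℝ
x * y = mkℝ (λ n → seq x n ℚ.* seq y n) (*-cauchy {seq x} {seq y} (cauchy x) (cauchy y))

-_ : ℝ → ℝ
- x = mkℝ (λ n → ℚ.- seq x n) (neg-cauchy {seq x} (cauchy x))

ℝ-setoid : Setoid 0ℓ 0ℓ
ℝ-setoid = record
  { Carrier = ℝ
  ; _≈_ = _≈_
  ; isEquivalence = record
    { refl = λ {x} → ≈-refl {x}
    ; sym = λ {x} {y} → ≈-sym {x} {y}
    ; trans = λ {x} {y} {z} → ≈-trans {x} {y} {z}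
    }
  }

+-rawMonoid : RawMonoid 0ℓ 0ℓ
+-rawMonoid = record { Carrier = ℝ ; _≈_ = _≈_ ; _∙_ = _+_ ; ε = 0ℝ }

Σℝ : ∀ {n} → Vector ℝ n → ℝ
Σℝ = sum +-rawMonoid

record ℂ : Set where
  constructor _+i_
  field
    re im : ℝ

open ℂ public

ℂ-rawRing : RawRing 0ℓ 0ℓ
ℂ-rawRing = record
  { Carrier = ℂ
  ; _≈_ = λ z w → re z ≈ re w × im z ≈ im w
  ; _+_ = λ z w → (re z + re w) +i (im z + im w)
  ; _*_ = λ z w → (re z * re w + - (im z * im w)) +i (re z * im w + im z * re w)
  ; -_ = λ z → (- re z) +i (- im z)
  ; 0# = 0ℝ +i 0ℝ
  ; 1# = 1ℝ +i 0ℝ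
  }

ℤ→ℂ : ℤ → ℂ
ℤ→ℂ i = fromℤ i +i 0ℝ

-- Coefficients, constant term first.
Polynomial : Set
Polynomial = List ℤ

eval : ∀ {c ℓ} (R : RawRing c ℓ) → (ℤ → RawRing.Carrier R) → Polynomial → RawRing.Carrier R → RawRing.Carrier R
eval R ι p x = foldr (λ a y → ι a R.+ x R.* y) R.0# p
  where module R = RawRing R

evalℚ : Polynomial → ℚ → ℚ
evalℚ = eval ℚ.+-*-rawRing (λ i → i ℚ./ 1)

evalℂ : Polynomial → ℂ → ℂ
evalℂ = eval ℂ-rawRing ℤ→ℂ

IsRootOf[_-t] : Polynomial → ℂ → Set
IsRootOf[ p -t] z = (evalℂ p z C.+ C.- z) C.≈ C.0#
  where module C = RawRing ℂ-rawRing

-- h(t) = (1+t)⁴ p(t/(1+t)²). An identity of rational functions is stated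
-- as equality of values wherever the denominators do not vanish; since ℚ is
-- infinite, this determines the polynomial h.
Is[1+t]⁴p[t/[1+t]²] : (h p : Polynomial) → Set
Is[1+t]⁴p[t/[1+t]²] h p = ∀ (t : ℚ) .{{_ : ℚ.NonZero ((1ℚ ℚ.+ t) ^ 2)}} →
  evalℚ h t ≡ (1ℚ ℚ.+ t) ^ 4 ℚ.* evalℚ p (t ℚ.÷ ((1ℚ ℚ.+ t) ^ 2))

-- Finite complexes whose vertices are exactly the elements of Fin n; a
-- triangulation of a compact space is necessarily finite.
record SimplicialComplex (n : ℕ) : Set₁ where
  field
    Face        : Pred (Subset n) 0ℓ
    face?       : Decidable Face
    empty-face  : Face ∅
    vertex-face : ∀ v → Face ⁅ v ⁆
    down-closed : ∀ {σ τ} → σ ⊆ τ → Face τ → Face σ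

allSubsets : ∀ n → List (Subset n)
allSubsets zero    = [] ∷ []
allSubsets (suc n) = map (outside ∷_) (allSubsets n) ++ map (inside ∷_) (allSubsets n)

module _ {n : ℕ} (X : SimplicialComplex n) where
  open SimplicialComplex X

  Adjacent : Fin n → Fin n → Set
  Adjacent u v = u ≢ v × Face (⁅ u ⁆ ∪ ⁅ v ⁆)

  Flag : Set
  Flag = ∀ σ → (∀ u v → u ∈ σ → v ∈ σ → u ≢ v → Adjacent u v) → Face σ

  faces : List (Subset n)
  faces = filter face? (allSubsets n)

  fPolynomial : ℚ → ℚ
  fPolynomial t = foldr ℚ._+_ 0ℚ (map (λ σ → t ^ ∣ σ ∣) faces)

  -- (1+t)⁴ h(1/(1+t)) = t⁴ f(1/t); the exponent 4 is that of complexes of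
  -- dimension 3.
  IsHPolynomial : Polynomial → Set
  IsHPolynomial h = ∀ (t : ℚ) .{{_ : ℚ.NonZero t}} .{{_ : ℚ.NonZero (1ℚ ℚ.+ t)}} →
    (1ℚ ℚ.+ t) ^ 4 ℚ.* evalℚ h (ℚ.1/ (1ℚ ℚ.+ t)) ≡ t ^ 4 ℚ.* fPolynomial (ℚ.1/ t)

  -- Barycentric coordinates. The last conjunct says that the support
  -- { v | x v > 0 } is a face; constructively this set need not be given by
  -- a Subset, so the condition is imposed on all Subsets contained in it.
  InRealization : Pred (Vector ℝ n) 0ℓ
  InRealization x = (∀ v → 0ℝ ≤ x v) × Σℝ x ≈ 1ℝ × (∀ τ → (∀ v → v ∈ τ → 0ℝ < x v) → Face τ)

Subspace : ∀ {n} → Pred (Vector ℝ n) 0ℓ → Setoid 0ℓ 0ℓ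
Subspace {n} P = record
  { Carrier = Σ (Vector ℝ n) P
  ; _≈_ = λ x y → ∀ i → proj₁ x i ≈ proj₁ y i
  ; isEquivalence = record
    { refl = λ {x} i → R.refl {proj₁ x i}
    ; sym = λ {x} {y} h i → R.sym {proj₁ x i} {proj₁ y i} (h i)
    ; trans = λ {x} {y} {z} h k i → R.trans {proj₁ x i} {proj₁ y i} {proj₁ z i} (h i) (k i)
    }
  }
  where module R = Setoid ℝ-setoid

-- Distance less than ε in the maximum metric, which induces the Euclidean
-- topology.
Within : ∀ {n} → ℝ → Vector ℝ n → Vector ℝ n → Set
Within ε x y = ∀ i → x i < y i + ε × y i < x i + ε

Continuous : ∀ {m n} {P : Pred (Vector ℝ m) 0ℓ} {Q : Pred (Vector ℝ n) 0ℓ} →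
             (Σ (Vector ℝ m) P → Σ (Vector ℝ n) Q) → Set
Continuous {P = P} f = ∀ x ε → 0ℝ < ε → Σ[ δ ∈ ℝ ] 0ℝ < δ ×
  (∀ y → Within δ (proj₁ x) (proj₁ y) → Within ε (proj₁ (f x)) (proj₁ (f y)))

record Homeomorphism {m n} (P : Pred (Vector ℝ m) 0ℓ) (Q : Pred (Vector ℝ n) 0ℓ) : Set where
  field
    bijection : Inverse (Subspace P) (Subspace Q)
  open Inverse bijection public
  field
    to-continuous   : Continuous {P = P} {Q = Q} to
    from-continuous : Continuous {P = Q} {Q = P} from

Sphere : (d : ℕ) → Pred (Vector ℝ (suc d)) 0ℓ
Sphere d x = Σℝ (λ i → x i * x i) ≈ 1ℝ

TriangulatesS³ : ∀ {n} → SimplicialComplex n → Set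
TriangulatesS³ X = Homeomorphism (InRealization X) (Sphere 3)

{-# OPTIONS --safe #-}

-- With a = γ₁ − 1, the polynomial γ(t) − t = 1 + a t + γ₂ t² has only negative
-- real roots only if a ≥ 0 and 0 ≤ γ₂ ≤ a²/4: otherwise one of the explicit complex
-- numbers (−a ± √(a² − 4γ₂))/2γ₂, or −1/a when γ₂ = 0, violates the hypothesis.
--
-- Subdividing an edge of a flag 3-sphere whose link is a (4 + k)-gon yields a flag
-- 3-sphere and increases (γ₁ , γ₂) by (1 , k). Start from the boundary of the
-- cross-polytope with a facet abcd. Subdividing cd lengthens the link of ab by one,
-- and vice versa, so q subdivisions of cd followed by p subdivisions of ab give
-- (q + p , q p). Subdividing bc adds (1 , 0) and makes the link of cd a quadrilateral
-- again. Now r subdivisions of ab add (r , q r) and turn the link of cd into a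
-- (4 + r)-gon, whence a last subdivision of cd adds (1 , r). Taking p + r = ⌊a/2⌋ and
-- γ₂ = q ⌊a/2⌋ + r, more subdivisions of bc make up for the rest of γ₁.
--
-- All complexes are clique complexes of graphs, and the homeomorphisms are
-- explicit: for a subdivision (x_u , x_v) ↦ (x_u − m , x_v − m , 2 m) with
-- m = min(x_u , x_v), and for the cross-polytope the difference of the square roots
-- of antipodal coordinates.
module Submission where

open import Defs
open import Algebra.Bundles using (CommutativeMonoid)
import Algebra.Properties.CommutativeMonoid.Sum as CommutativeMonoidSum
open import Data.Bool as Bool using (Bool; true; false; _∧_; _∨_; not; if_then_else_)
open import Data.Bool.ListAction using (all)
open import Data.Bool.Properties using (∧-comm; ∧-assoc; ∧-zeroʳ; ∧-identityʳ; ∨-comm; ∨-identityʳ; ∨-zeroʳ)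
open import Data.Fin using (Fin; zero; suc; combine; quotient; remainder)
open import Data.Fin.Patterns using (0F; 1F; 2F; 3F)
import Data.Fin.Properties as Fin
open import Data.Fin.Subset using (Subset; inside; outside; ⁅_⁆; _∈_; _∪_; ∣_∣)
open import Data.Fin.Subset.Properties using (x∈⁅y⁆⇒x≡y; x∈⁅x⁆; ∉⊥; _∈?_; x∈p∪q⁺; x∈p∪q⁻)
open import Data.Integer as ℤ using (ℤ; +_; -[1+_])
import Data.Integer.Properties as ℤ
open import Data.List using (List; []; _∷_; _++_; map; filter; foldr)
open import Data.List.Properties using (filter-++; filter-none)
open import Data.List.Relation.Binary.Permutation.Propositional as ↭ using (_↭_; prep; swap)
open import Data.List.Relation.Binary.Permutation.Propositional.Properties using (↭-reverse; ++-comm)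
import Data.List.Relation.Unary.All as All
open import Data.Nat as ℕ using (ℕ; zero; suc; ⌊_/2⌋; ⌈_/2⌉)
import Data.Nat.Properties as ℕ
import Data.Nat.Tactic.RingSolver as ℕ-Solver
open import Data.Product using (∃; ∃₂; Σ; Σ-syntax; _×_; _,_; proj₁; proj₂)
open import Data.Rational as ℚ using (ℚ; 0ℚ; 1ℚ; ½)
import Data.Rational.Properties as ℚ
import Data.Rational.Unnormalised as ℚᵘ
import Data.Rational.Unnormalised.Properties as ℚᵘ
open import Data.Sum using (_⊎_; inj₁; inj₂)
open import Data.Vec as Vec using (here; there)
open import Data.Vec.Functional as Vector using (Vector)
open import Function using (_∘_; _⇔_; mk⇔; Equivalence)
open import Function.Construct.Composition using (inverse; _⇔-∘_)
open import Level using (0ℓ)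
open import Relation.Binary.Bundles using (Setoid)
open import Relation.Binary.PropositionalEquality as ≡ using (_≡_; _≢_; refl; sym; cong; cong₂; subst; subst₂)
import Relation.Binary.Reasoning.Setoid as SetoidReasoning
open import Relation.Nullary using (¬_; yes; no; does; contradiction)
open import Relation.Nullary.Decidable using (_→-dec_; dec-true; dec-false; dec⇒maybe; ¬?)
open import Relation.Unary using (Pred; Decidable)
open import Tactic.RingSolver using (solve; solve-∀)
open import Tactic.RingSolver.Core.AlmostCommutativeRing using (AlmostCommutativeRing; fromCommutativeRing)

-- Rational arithmetic

ℚ-ring : AlmostCommutativeRing 0ℓ 0ℓ
ℚ-ring = fromCommutativeRing ℚ.+-*-commutativeRing λ q → dec⇒maybe (0ℚ ℚ.≟ q)

-- Linear inequalities are derived from known ones by a ring identity between the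
-- differences of their sides.
module _ {a b x y : ℚ} where
  private
    x+[a-x]≡a : x ℚ.+ (a ℚ.- x) ≡ a
    x+[a-x]≡a = solve (a ∷ x ∷ []) ℚ-ring

    y+[a-x]≡b : b ℚ.- a ≡ y ℚ.- x → y ℚ.+ (a ℚ.- x) ≡ b
    y+[a-x]≡b b-a≡y-x = begin
      y ℚ.+ (a ℚ.- x) ≡⟨ solve (a ∷ x ∷ y ∷ []) ℚ-ring ⟩
      (y ℚ.- x) ℚ.+ a ≡⟨ cong (ℚ._+ a) b-a≡y-x ⟨
      (b ℚ.- a) ℚ.+ a ≡⟨ solve (a ∷ b ∷ []) ℚ-ring ⟩
      b               ∎
      where open ≡.≡-Reasoning

  <-resp-difference : x ℚ.< y → b ℚ.- a ≡ y ℚ.- x → a ℚ.< b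
  <-resp-difference x<y b-a≡y-x = subst₂ ℚ._<_ x+[a-x]≡a (y+[a-x]≡b b-a≡y-x) (ℚ.+-monoˡ-< (a ℚ.- x) x<y)

  ≤-resp-difference : x ℚ.≤ y → b ℚ.- a ≡ y ℚ.- x → a ℚ.≤ b
  ≤-resp-difference x≤y b-a≡y-x = subst₂ ℚ._≤_ x+[a-x]≡a (y+[a-x]≡b b-a≡y-x) (ℚ.+-monoˡ-≤ (a ℚ.- x) x≤y)

0<1 : 0ℚ ℚ.< 1ℚ
0<1 = ℚ.positive⁻¹ 1ℚ

0<p*q : ∀ {p q} → 0ℚ ℚ.< p → 0ℚ ℚ.< q → 0ℚ ℚ.< p ℚ.* q
0<p*q {p} {q} 0<p 0<q =
  ℚ.positive⁻¹ (p ℚ.* q) {{ℚ.pos*pos⇒pos p {{ℚ.positive 0<p}} q {{ℚ.positive 0<q}}}}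

0≤p*q : ∀ {p q} → 0ℚ ℚ.≤ p → 0ℚ ℚ.≤ q → 0ℚ ℚ.≤ p ℚ.* q
0≤p*q {p} {q} 0≤p 0≤q =
  ℚ.nonNegative⁻¹ (p ℚ.* q) {{ℚ.nonNeg*nonNeg⇒nonNeg p {{ℚ.nonNegative 0≤p}} q {{ℚ.nonNegative 0≤q}}}}

0<½*p : ∀ {p} → 0ℚ ℚ.< p → 0ℚ ℚ.< ½ ℚ.* p
0<½*p = 0<p*q (ℚ.positive⁻¹ ½)

½+½ : ∀ p → ½ ℚ.* p ℚ.+ ½ ℚ.* p ≡ p
½+½ = solve-∀ ℚ-ring

p<p+q : ∀ {p q} → 0ℚ ℚ.< q → p ℚ.< p ℚ.+ q
p<p+q {p} {q} 0<q = <-resp-difference 0<q (solve (p ∷ q ∷ []) ℚ-ring)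

½*p<p : ∀ {p} → 0ℚ ℚ.< p → ½ ℚ.* p ℚ.< p
½*p<p {p} 0<p = subst (½ ℚ.* p ℚ.<_) (½+½ p) (p<p+q (0<½*p 0<p))

p≤∣p∣ : ∀ p → p ℚ.≤ ℚ.∣ p ∣
p≤∣p∣ p with ℚ.≤-total 0ℚ p
... | inj₁ 0≤p = ℚ.≤-reflexive (sym (ℚ.0≤p⇒∣p∣≡p 0≤p))
... | inj₂ p≤0 = ℚ.≤-trans p≤0 (ℚ.0≤∣p∣ p)

neg-involutive : ∀ p → ℚ.- (ℚ.- p) ≡ p
neg-involutive = solve-∀ ℚ-ring

-p*-p≡p*p : ∀ p → ℚ.- p ℚ.* ℚ.- p ≡ p ℚ.* p
-p*-p≡p*p = solve-∀ ℚ-ring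

0≤p*p : ∀ p → 0ℚ ℚ.≤ p ℚ.* p
0≤p*p p with ℚ.≤-total 0ℚ p
... | inj₁ 0≤p = 0≤p*q 0≤p 0≤p
... | inj₂ p≤0 = subst (0ℚ ℚ.≤_) (-p*-p≡p*p p) (0≤p*q (ℚ.neg-antimono-≤ p≤0) (ℚ.neg-antimono-≤ p≤0))

∣p∣*∣p∣≡p*p : ∀ p → ℚ.∣ p ∣ ℚ.* ℚ.∣ p ∣ ≡ p ℚ.* p
∣p∣*∣p∣≡p*p p = ≡.trans (sym (ℚ.∣p*q∣≡∣p∣*∣q∣ p p)) (ℚ.0≤p⇒∣p∣≡p (0≤p*p p))

square-mono-≤ : ∀ {p q} → 0ℚ ℚ.≤ p → p ℚ.≤ q → p ℚ.* p ℚ.≤ q ℚ.* q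
square-mono-≤ {p} {q} 0≤p p≤q = ℚ.≤-trans
  (ℚ.*-monoˡ-≤-nonNeg p {{ℚ.nonNegative 0≤p}} p≤q)
  (ℚ.*-monoʳ-≤-nonNeg q {{ℚ.nonNegative (ℚ.≤-trans 0≤p p≤q)}} p≤q)

square-mono-< : ∀ {p q} → 0ℚ ℚ.≤ p → p ℚ.< q → p ℚ.* p ℚ.< q ℚ.* q
square-mono-< {p} {q} 0≤p p<q = ℚ.≤-<-trans
  (ℚ.*-monoˡ-≤-nonNeg p {{ℚ.nonNegative 0≤p}} (ℚ.<⇒≤ p<q))
  (ℚ.*-monoˡ-<-pos q {{ℚ.positive (ℚ.≤-<-trans 0≤p p<q)}} p<q)

square-cancel-< : ∀ {p q} → 0ℚ ℚ.≤ q → p ℚ.* p ℚ.< q ℚ.* q → p ℚ.< q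
square-cancel-< {p} {q} 0≤q p²<q² with p ℚ.<? q
... | yes p<q = p<q
... | no  p≮q = contradiction (ℚ.<-≤-trans p²<q² (square-mono-≤ 0≤q (ℚ.≮⇒≥ p≮q))) (ℚ.<-irrefl refl)

+-distribʳ-⊓ : ∀ r p q → p ℚ.⊓ q ℚ.+ r ≡ (p ℚ.+ r) ℚ.⊓ (q ℚ.+ r)
+-distribʳ-⊓ r = ℚ.mono-≤-distrib-⊓ (ℚ.+-monoˡ-≤ r)

⊓-mono-< : ∀ {p q r s} → p ℚ.< r → q ℚ.< s → p ℚ.⊓ q ℚ.< r ℚ.⊓ s
⊓-mono-< {p} {q} {r} {s} p<r q<s with ℚ.⊓-sel r s
... | inj₁ r⊓s≡r = subst (p ℚ.⊓ q ℚ.<_) (sym r⊓s≡r) (ℚ.≤-<-trans (ℚ.p⊓q≤p p q) p<r)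
... | inj₂ r⊓s≡s = subst (p ℚ.⊓ q ℚ.<_) (sym r⊓s≡s) (ℚ.≤-<-trans (ℚ.p⊓q≤q p q) q<s)

0<p⊓q : ∀ {p q} → 0ℚ ℚ.< p → 0ℚ ℚ.< q → 0ℚ ℚ.< p ℚ.⊓ q
0<p⊓q 0<p 0<q = ⊓-mono-< {0ℚ} {0ℚ} 0<p 0<q

divide : ∀ {p} q → 0ℚ ℚ.< p → ∃ λ r → p ℚ.* r ≡ q × (0ℚ ℚ.< q → 0ℚ ℚ.< r)
divide {p} q 0<p = ℚ.1/ p ℚ.* q , p*[1/p*q]≡q , 0<p*q (ℚ.positive⁻¹ (ℚ.1/ p) {{ℚ.1/pos⇒pos p}})
  where
  instance
    p-positive : ℚ.Positive p
    p-positive = ℚ.positive 0<p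
    p-nonZero : ℚ.NonZero p
    p-nonZero = ℚ.pos⇒nonZero p
  p*[1/p*q]≡q : p ℚ.* (ℚ.1/ p ℚ.* q) ≡ q
  p*[1/p*q]≡q = begin
    p ℚ.* (ℚ.1/ p ℚ.* q) ≡⟨ ℚ.*-assoc p (ℚ.1/ p) q ⟨
    p ℚ.* ℚ.1/ p ℚ.* q   ≡⟨ cong (ℚ._* q) (ℚ.*-inverseʳ p) ⟩
    1ℚ ℚ.* q             ≡⟨ ℚ.*-identityˡ q ⟩
    q                    ∎
    where open ≡.≡-Reasoning

-- The embedding of ℤ used by evalℚ and evalℂ.
ι : ℤ → ℚ
ι i = i ℚ./ 1

toℚᵘ-ι : ∀ i → ℚ.toℚᵘ (ι i) ℚᵘ.≃ ℚᵘ.mkℚᵘ i 0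
toℚᵘ-ι i = ℚ.toℚᵘ-fromℚᵘ (ℚᵘ.mkℚᵘ i 0)

ι-homo-+ : ∀ i j → ι (i ℤ.+ j) ≡ ι i ℚ.+ ι j
ι-homo-+ i j = ℚ.toℚᵘ-injective (begin
  ℚ.toℚᵘ (ι (i ℤ.+ j))                  ≈⟨ toℚᵘ-ι (i ℤ.+ j) ⟩
  ℚᵘ.mkℚᵘ (i ℤ.+ j) 0                   ≈⟨ ℚᵘ.*≡* (cong (ℤ._* + 1)
                                                 (cong₂ ℤ._+_ (ℤ.*-identityʳ i) (ℤ.*-identityʳ j))) ⟨
  ℚᵘ.mkℚᵘ i 0 ℚᵘ.+ ℚᵘ.mkℚᵘ j 0          ≈⟨ ℚᵘ.+-cong (toℚᵘ-ι i) (toℚᵘ-ι j) ⟨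
  ℚ.toℚᵘ (ι i) ℚᵘ.+ ℚ.toℚᵘ (ι j)        ≈⟨ ℚ.toℚᵘ-homo-+ (ι i) (ι j) ⟨
  ℚ.toℚᵘ (ι i ℚ.+ ι j)                  ∎)
  where open SetoidReasoning ℚᵘ.≃-setoid

ι-homo-* : ∀ i j → ι (i ℤ.* j) ≡ ι i ℚ.* ι j
ι-homo-* i j = ℚ.toℚᵘ-injective (begin
  ℚ.toℚᵘ (ι (i ℤ.* j))                  ≈⟨ toℚᵘ-ι (i ℤ.* j) ⟩
  ℚᵘ.mkℚᵘ i 0 ℚᵘ.* ℚᵘ.mkℚᵘ j 0          ≈⟨ ℚᵘ.*-cong (toℚᵘ-ι i) (toℚᵘ-ι j) ⟨
  ℚ.toℚᵘ (ι i) ℚᵘ.* ℚ.toℚᵘ (ι j)        ≈⟨ ℚ.toℚᵘ-homo-* (ι i) (ι j) ⟨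
  ℚ.toℚᵘ (ι i ℚ.* ι j)                  ∎)
  where open SetoidReasoning ℚᵘ.≃-setoid

ι-mono-< : ∀ {i j} → i ℤ.< j → ι i ℚ.< ι j
ι-mono-< {i} {j} i<j = ℚ.toℚᵘ-cancel-< (ℚᵘ.<-respˡ-≃ (ℚᵘ.≃-sym (toℚᵘ-ι i)) (ℚᵘ.<-respʳ-≃ (ℚᵘ.≃-sym (toℚᵘ-ι j))
  (ℚᵘ.*<* (ℤ.*-monoʳ-<-pos (+ 1) i<j))))

ι-mono-≤ : ∀ {i j} → i ℤ.≤ j → ι i ℚ.≤ ι j
ι-mono-≤ {i} {j} i≤j = ℚ.toℚᵘ-cancel-≤ (ℚᵘ.≤-respˡ-≃ (ℚᵘ.≃-sym (toℚᵘ-ι i)) (ℚᵘ.≤-respʳ-≃ (ℚᵘ.≃-sym (toℚᵘ-ι j))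
  (ℚᵘ.*≤* (ℤ.*-monoʳ-≤-nonNeg (+ 1) i≤j))))

ι-cancel-≤ : ∀ {i j} → ι i ℚ.≤ ι j → i ℤ.≤ j
ι-cancel-≤ ιi≤ιj = ℤ.≮⇒≥ λ j<i → ℚ.<-irrefl refl (ℚ.≤-<-trans ιi≤ιj (ι-mono-< j<i))

fromℕ : ℕ → ℚ
fromℕ n = ι (+ n)

fromℕ-suc : ∀ n → fromℕ (suc n) ≡ 1ℚ ℚ.+ fromℕ n
fromℕ-suc n = ι-homo-+ (+ 1) (+ n)

fromℕ-homo-* : ∀ m n → fromℕ (m ℕ.* n) ≡ fromℕ m ℚ.* fromℕ n
fromℕ-homo-* m n = ≡.trans (cong ι (ℤ.pos-* m n)) (ι-homo-* (+ m) (+ n))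

fromℕ-mono-≤ : ∀ {m n} → m ℕ.≤ n → fromℕ m ℚ.≤ fromℕ n
fromℕ-mono-≤ m≤n = ι-mono-≤ (ℤ.+≤+ m≤n)

archimedean : ∀ p → ∃ λ n → p ℚ.< fromℕ n
archimedean (ℚ.mkℚ i d-1 _) = suc ℤ.∣ i ∣ ,
  ℚ.toℚᵘ-cancel-< (ℚᵘ.<-respʳ-≃ (ℚᵘ.≃-sym (toℚᵘ-ι (+ suc ℤ.∣ i ∣))) (ℚᵘ.*<* (begin-strict
    i ℤ.* + 1                   ≡⟨ ℤ.*-identityʳ i ⟩
    i                           ≤⟨ i≤+∣i∣ i ⟩
    + ℤ.∣ i ∣                   <⟨ ℤ.+<+ (ℕ.n<1+n ℤ.∣ i ∣) ⟩
    + suc ℤ.∣ i ∣               ≤⟨ ℤ.+≤+ (ℕ.m≤m*n (suc ℤ.∣ i ∣) (suc d-1)) ⟩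
    + (suc ℤ.∣ i ∣ ℕ.* suc d-1) ≡⟨ ℤ.pos-* (suc ℤ.∣ i ∣) (suc d-1) ⟩
    + suc ℤ.∣ i ∣ ℤ.* + suc d-1 ∎)))
  where
  open ℤ.≤-Reasoning
  i≤+∣i∣ : ∀ i → i ℤ.≤ + ℤ.∣ i ∣
  i≤+∣i∣ (+ n)    = ℤ.≤-refl
  i≤+∣i∣ -[1+ n ] = ℤ.-≤+

-- Clique complexes and clique polynomials

∧-true⁻ : ∀ {a b} → a ∧ b ≡ true → a ≡ true × b ≡ true
∧-true⁻ {true} b≡true = refl , b≡true

∧-falseʳ : ∀ a {b} → b ≡ false → a ∧ b ≡ false
∧-falseʳ a refl = ∧-zeroʳ a

true≢false : ∀ {b} → b ≡ true → b ≢ false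
true≢false refl ()

record Graph (n : ℕ) : Set where
  field
    adj    : Fin n → Fin n → Bool
    symm   : ∀ i j → adj i j ≡ adj j i
    irrefl : ∀ i → adj i i ≡ false

  adjacent⇒≢ : ∀ {i j} → adj i j ≡ true → i ≢ j
  adjacent⇒≢ {i} ij refl = true≢false ij (irrefl i)

  adj-sym : ∀ {i j} → adj i j ≡ true → adj j i ≡ true
  adj-sym {i} {j} = ≡.trans (symm j i)

open Graph

IsClique : ∀ {n} → Graph n → Subset n → Set
IsClique G σ = ∀ i j → i ∈ σ → j ∈ σ → i ≢ j → adj G i j ≡ true

isClique? : ∀ {n} (G : Graph n) → Decidable (IsClique G)
isClique? G σ = Fin.all? λ i → Fin.all? λ j →
  (i ∈? σ) →-dec ((j ∈? σ) →-dec (¬? (i Fin.≟ j) →-dec (adj G i j Bool.≟ true)))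

cliqueComplex : ∀ {n} → Graph n → SimplicialComplex n
cliqueComplex G = record
  { Face        = IsClique G
  ; face?       = isClique? G
  ; empty-face  = λ i j i∈∅ → contradiction i∈∅ ∉⊥
  ; vertex-face = λ v i j i∈v j∈v i≢j →
      contradiction (≡.trans (x∈⁅y⁆⇒x≡y v i∈v) (sym (x∈⁅y⁆⇒x≡y v j∈v))) i≢j
  ; down-closed = λ σ⊆τ clique i j i∈σ j∈σ → clique i j (σ⊆τ i∈σ) (σ⊆τ j∈σ)
  }

cliqueComplex-flag : ∀ {n} (G : Graph n) → Flag (cliqueComplex G)
cliqueComplex-flag G σ pairwise i j i∈σ j∈σ i≢j =
  proj₂ (pairwise i j i∈σ j∈σ i≢j) i j (x∈p∪q⁺ (inj₁ (x∈⁅x⁆ i))) (x∈p∪q⁺ (inj₂ (x∈⁅x⁆ j))) i≢j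

VertexSet : ℕ → Set
VertexSet n = Fin n → Bool

_==_ : ∀ {n} → Fin n → Fin n → Bool
i == j = does (i Fin.≟ j)

==-refl : ∀ {n} (i : Fin n) → (i == i) ≡ true
==-refl i = dec-true (i Fin.≟ i) refl

≢⇒==-false : ∀ {n} {i j : Fin n} → i ≢ j → (i == j) ≡ false
≢⇒==-false {i = i} {j} = dec-false (i Fin.≟ j)

==-sym : ∀ {n} (i j : Fin n) → (i == j) ≡ (j == i)
==-sym i j with i Fin.≟ j
... | yes refl = sym (==-refl i)
... | no  i≢j  = sym (≢⇒==-false (i≢j ∘ sym))

everything : ∀ {n} → VertexSet n
everything _ = true

infixl 7 _∩_ _∖_

_∩_ : ∀ {n} → VertexSet n → VertexSet n → VertexSet n
(S ∩ R) i = S i ∧ R i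

_∖_ : ∀ {n} → VertexSet n → Fin n → VertexSet n
(S ∖ u) i = S i ∧ not (i == u)

∖-self : ∀ {n} (S : VertexSet n) u → (S ∖ u) u ≡ false
∖-self S u rewrite ==-refl u = ∧-zeroʳ (S u)

∖-other : ∀ {n} (S : VertexSet n) {u i} → i ≢ u → (S ∖ u) i ≡ S i
∖-other S {i = i} i≢u rewrite ≢⇒==-false i≢u = ∧-identityʳ (S i)

tail : ∀ {n} → Graph (suc n) → Graph n
tail G = record
  { adj    = λ i j → adj G (suc i) (suc j)
  ; symm   = λ i j → symm G (suc i) (suc j)
  ; irrefl = λ i → irrefl G (suc i)
  }

module _ (t : ℚ) where

  -- The f-polynomial of the clique complex of the subgraph induced on S.
  cliquePoly : ∀ {n} → Graph n → VertexSet n → ℚ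
  cliquePoly {zero}  G S = 1ℚ
  cliquePoly {suc n} G S = cliquePoly (tail G) (S ∘ suc) ℚ.+
    (if S zero then t ℚ.* cliquePoly (tail G) ((S ∩ adj G zero) ∘ suc) else 0ℚ)

  cliquePoly-cong : ∀ {n} {G H : Graph n} {S R : VertexSet n} → (∀ i → S i ≡ R i) →
                    (∀ i j → S i ≡ true → S j ≡ true → adj G i j ≡ adj H i j) → cliquePoly G S ≡ cliquePoly H R
  cliquePoly-cong {zero} _ _ = refl
  cliquePoly-cong {suc n} {G} {H} {S} {R} S≗R G≗H with S zero in S0 | R zero in R0
  ... | true  | false = contradiction (≡.trans (S≗R zero) R0) (true≢false S0)
  ... | false | true  = contradiction (≡.trans (sym (S≗R zero)) S0) (true≢false R0)
  ... | false | false = cong (ℚ._+ 0ℚ) (cliquePoly-cong (S≗R ∘ suc) (λ i j → G≗H (suc i) (suc j)))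
  ... | true  | true  = cong₂ (λ p q → p ℚ.+ t ℚ.* q)
    (cliquePoly-cong (S≗R ∘ suc) (λ i j → G≗H (suc i) (suc j)))
    (cliquePoly-cong link-of-zero (λ i j Si Sj → G≗H (suc i) (suc j) (proj₁ (∧-true⁻ Si)) (proj₁ (∧-true⁻ Sj))))
    where
    link-of-zero : ∀ i → S (suc i) ∧ adj G zero (suc i) ≡ R (suc i) ∧ adj H zero (suc i)
    link-of-zero i rewrite sym (S≗R (suc i)) with S (suc i) in Si
    ... | true  = G≗H zero (suc i) S0 Si
    ... | false = refl

  cliquePoly-ext : ∀ {n} (G : Graph n) {S R : VertexSet n} → (∀ i → S i ≡ R i) → cliquePoly G S ≡ cliquePoly G R
  cliquePoly-ext G S≗R = cliquePoly-cong S≗R (λ _ _ _ _ → refl)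

  private
    if-cong : ∀ b {p q} → p ≡ q → (if b then p else 0ℚ) ≡ (if b then q else 0ℚ)
    if-cong b = cong (if b then_else 0ℚ)

    exchange : ∀ s₀ sᵤ e t a b c d →
      (a ℚ.+ (if sᵤ then t ℚ.* b else 0ℚ)) ℚ.+ (if s₀ then t ℚ.* (c ℚ.+ (if sᵤ ∧ e then t ℚ.* d else 0ℚ)) else 0ℚ) ≡
      (a ℚ.+ (if s₀ then t ℚ.* c else 0ℚ)) ℚ.+ (if sᵤ then t ℚ.* (b ℚ.+ (if s₀ ∧ e then t ℚ.* d else 0ℚ)) else 0ℚ)
    exchange false false _     = λ _ _ _ _ _ → refl
    exchange false true  _     = λ t a b _ _ → only-u t a b
      where
      only-u : ∀ t a b → (a ℚ.+ t ℚ.* b) ℚ.+ 0ℚ ≡ (a ℚ.+ 0ℚ) ℚ.+ t ℚ.* (b ℚ.+ 0ℚ)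
      only-u = solve-∀ ℚ-ring
    exchange true  false e     = λ t a b c d → sym (exchange false true e t a c b d)
    exchange true  true  false = λ t a b c _ → non-adjacent t a b c
      where
      non-adjacent : ∀ t a b c → (a ℚ.+ t ℚ.* b) ℚ.+ t ℚ.* (c ℚ.+ 0ℚ) ≡ (a ℚ.+ t ℚ.* c) ℚ.+ t ℚ.* (b ℚ.+ 0ℚ)
      non-adjacent = solve-∀ ℚ-ring
    exchange true  true  true  = adjacent
      where
      adjacent : ∀ t a b c d → (a ℚ.+ t ℚ.* b) ℚ.+ t ℚ.* (c ℚ.+ t ℚ.* d) ≡ (a ℚ.+ t ℚ.* c) ℚ.+ t ℚ.* (b ℚ.+ t ℚ.* d)
      adjacent = solve-∀ ℚ-ring

    cliquePoly-delete-if : ∀ {n} (G : Graph n) S u →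
      cliquePoly G S ≡ cliquePoly G (S ∖ u) ℚ.+ (if S u then t ℚ.* cliquePoly G (S ∩ adj G u) else 0ℚ)
    cliquePoly-delete-if G S zero =
      cong₂ ℚ._+_ (sym without-zero) (if-cong (S zero) (cong (t ℚ.*_) (sym link-of-zero)))
      where
      without-zero : cliquePoly G (S ∖ zero) ≡ cliquePoly (tail G) (S ∘ suc)
      without-zero rewrite ∧-zeroʳ (S zero) =
        ≡.trans (ℚ.+-identityʳ _) (cliquePoly-ext (tail G) (λ i → ∧-identityʳ (S (suc i))))
      link-of-zero : cliquePoly G (S ∩ adj G zero) ≡ cliquePoly (tail G) ((S ∩ adj G zero) ∘ suc)
      link-of-zero rewrite irrefl G zero | ∧-zeroʳ (S zero) = ℚ.+-identityʳ _
    cliquePoly-delete-if {suc n} G S (suc u) = begin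
      cliquePoly G S
        ≡⟨ cong₂ ℚ._+_ (cliquePoly-delete-if G⁺ S⁺ u)
             (if-cong (S zero) (cong (t ℚ.*_) (cliquePoly-delete-if G⁺ (S⁺ ∩ N₀) u))) ⟩
      (a ℚ.+ (if S⁺ u then t ℚ.* b else 0ℚ)) ℚ.+
        (if S zero then t ℚ.* (c ℚ.+ (if S⁺ u ∧ N₀ u then t ℚ.* d else 0ℚ)) else 0ℚ)
        ≡⟨ exchange (S zero) (S⁺ u) (N₀ u) t a b c d ⟩
      (a ℚ.+ (if S zero then t ℚ.* c else 0ℚ)) ℚ.+
        (if S⁺ u then t ℚ.* (b ℚ.+ (if S zero ∧ N₀ u then t ℚ.* d else 0ℚ)) else 0ℚ)
        ≡⟨ cong₂ (λ p q → p ℚ.+ (if S⁺ u then t ℚ.* q else 0ℚ)) (sym without-u) (sym link-of-u) ⟩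
      cliquePoly G (S ∖ suc u) ℚ.+ (if S⁺ u then t ℚ.* cliquePoly G (S ∩ adj G (suc u)) else 0ℚ) ∎
      where
      open ≡.≡-Reasoning
      G⁺ : Graph n
      G⁺ = tail G
      S⁺ N₀ : VertexSet n
      S⁺ = S ∘ suc
      N₀ = adj G zero ∘ suc
      a b c d : ℚ
      a = cliquePoly G⁺ (S⁺ ∖ u)
      b = cliquePoly G⁺ (S⁺ ∩ adj G⁺ u)
      c = cliquePoly G⁺ (S⁺ ∩ N₀ ∖ u)
      d = cliquePoly G⁺ (S⁺ ∩ N₀ ∩ adj G⁺ u)
      ∧-swap : ∀ x y z → (x ∧ y) ∧ z ≡ (x ∧ z) ∧ y
      ∧-swap x y z = ≡.trans (∧-assoc x y z) (≡.trans (cong (x ∧_) (∧-comm y z)) (sym (∧-assoc x z y)))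
      without-u : cliquePoly G (S ∖ suc u) ≡ a ℚ.+ (if S zero then t ℚ.* c else 0ℚ)
      without-u rewrite ∧-identityʳ (S zero) =
        cong (a ℚ.+_) (if-cong (S zero) (cong (t ℚ.*_) (cliquePoly-ext G⁺ (λ i → ∧-swap (S⁺ i) _ (N₀ i)))))
      link-of-u : cliquePoly G (S ∩ adj G (suc u)) ≡ b ℚ.+ (if S zero ∧ N₀ u then t ℚ.* d else 0ℚ)
      link-of-u rewrite symm G (suc u) zero = cong (b ℚ.+_) (if-cong (S zero ∧ N₀ u)
        (cong (t ℚ.*_) (cliquePoly-ext G⁺ (λ i → ∧-swap (S⁺ i) (adj G⁺ u i) (N₀ i)))))

  cliquePoly-delete : ∀ {n} (G : Graph n) S u → S u ≡ true →
                      cliquePoly G S ≡ cliquePoly G (S ∖ u) ℚ.+ t ℚ.* cliquePoly G (S ∩ adj G u)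
  cliquePoly-delete G S u Su = ≡.trans (cliquePoly-delete-if G S u)
    (cong (λ b → cliquePoly G (S ∖ u) ℚ.+ (if b then t ℚ.* cliquePoly G (S ∩ adj G u) else 0ℚ)) Su)

IsCliqueIn : ∀ {n} → Graph n → VertexSet n → Subset n → Set
IsCliqueIn G S σ = IsClique G σ × (∀ i → i ∈ σ → S i ≡ true)

module _ {n} (G : Graph (suc n)) (S : VertexSet (suc n)) where

  IsCliqueIn-outside : ∀ σ → IsCliqueIn G S (outside Vec.∷ σ) ⇔ IsCliqueIn (tail G) (S ∘ suc) σ
  IsCliqueIn-outside σ = mk⇔
    (λ (clique , σ⊆S) →
      (λ i j i∈σ j∈σ i≢j → clique (suc i) (suc j) (there i∈σ) (there j∈σ) (i≢j ∘ Fin.suc-injective)) ,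
      (λ i i∈σ → σ⊆S (suc i) (there i∈σ)))
    (λ (clique , σ⊆S) →
      (λ { (suc i) (suc j) (there i∈σ) (there j∈σ) i≢j → clique i j i∈σ j∈σ (i≢j ∘ cong suc) }) ,
      (λ { (suc i) (there i∈σ) → σ⊆S i i∈σ }))

  IsCliqueIn-inside : S zero ≡ true → ∀ σ →
                      IsCliqueIn G S (inside Vec.∷ σ) ⇔ IsCliqueIn (tail G) ((S ∩ adj G zero) ∘ suc) σ
  IsCliqueIn-inside S0 σ = mk⇔
    (λ (clique , σ⊆S) →
      (λ i j i∈σ j∈σ i≢j → clique (suc i) (suc j) (there i∈σ) (there j∈σ) (i≢j ∘ Fin.suc-injective)) ,
      (λ i i∈σ → cong₂ _∧_ (σ⊆S (suc i) (there i∈σ)) (clique zero (suc i) here (there i∈σ) λ ())))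
    (λ (clique , σ⊆S∩N₀) →
      (λ { zero    zero    _           _           0≢0 → contradiction refl 0≢0
         ; zero    (suc j) _           (there j∈σ) _   → proj₂ (∧-true⁻ {S (suc j)} (σ⊆S∩N₀ j j∈σ))
         ; (suc i) zero    (there i∈σ) _           _   → adj-sym G (proj₂ (∧-true⁻ {S (suc i)} (σ⊆S∩N₀ i i∈σ)))
         ; (suc i) (suc j) (there i∈σ) (there j∈σ) i≢j → clique i j i∈σ j∈σ (i≢j ∘ cong suc) }) ,
      (λ { zero here → S0 ; (suc i) (there i∈σ) → proj₁ (∧-true⁻ (σ⊆S∩N₀ i i∈σ)) }))

module _ (t : ℚ) where

  weight : ∀ {n} → List (Subset n) → ℚ
  weight σs = foldr ℚ._+_ 0ℚ (map (λ σ → t ^ ∣ σ ∣) σs)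

  weight-++ : ∀ {n} (σs τs : List (Subset n)) → weight (σs ++ τs) ≡ weight σs ℚ.+ weight τs
  weight-++ []       τs = sym (ℚ.+-identityˡ (weight τs))
  weight-++ (σ ∷ σs) τs = ≡.trans (cong (t ^ ∣ σ ∣ ℚ.+_) (weight-++ σs τs))
                                  (sym (ℚ.+-assoc (t ^ ∣ σ ∣) (weight σs) (weight τs)))

  weight-outside : ∀ {n} {P : Pred (Subset (suc n)) 0ℓ} (P? : Decidable P) σs →
    weight (filter P? (map (outside Vec.∷_) σs)) ≡ weight (filter (P? ∘ (outside Vec.∷_)) σs)
  weight-outside P? [] = refl
  weight-outside P? (σ ∷ σs) with does (P? (outside Vec.∷ σ))
  ... | true  = cong (t ^ ∣ σ ∣ ℚ.+_) (weight-outside P? σs)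
  ... | false = weight-outside P? σs

  weight-inside : ∀ {n} {P : Pred (Subset (suc n)) 0ℓ} (P? : Decidable P) σs →
    weight (filter P? (map (inside Vec.∷_) σs)) ≡ t ℚ.* weight (filter (P? ∘ (inside Vec.∷_)) σs)
  weight-inside P? [] = sym (ℚ.*-zeroʳ t)
  weight-inside P? (σ ∷ σs) with does (P? (inside Vec.∷ σ))
  ... | true  = ≡.trans (cong (t ^ ∣ inside Vec.∷ σ ∣ ℚ.+_) (weight-inside P? σs))
                        (sym (ℚ.*-distribˡ-+ t (t ^ ∣ σ ∣) (weight (filter (P? ∘ (inside Vec.∷_)) σs))))
  ... | false = weight-inside P? σs

  weight-cliques : ∀ {n} (G : Graph n) S {P : Pred (Subset n) 0ℓ} (P? : Decidable P) →
                   (∀ σ → P σ ⇔ IsCliqueIn G S σ) → weight (filter P? (allSubsets n)) ≡ cliquePoly t G S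
  weight-cliques {zero} G S P? P⇔ with P? Vec.[]
  ... | yes _  = refl
  ... | no ¬P∅ = contradiction (Equivalence.from (P⇔ Vec.[]) ((λ ()) , λ ())) ¬P∅
  weight-cliques {suc n} G S {P} P? P⇔ = begin
    weight (filter P? (map (outside Vec.∷_) σs ++ map (inside Vec.∷_) σs))
      ≡⟨ cong weight (filter-++ P? (map (outside Vec.∷_) σs) (map (inside Vec.∷_) σs)) ⟩
    weight (filter P? (map (outside Vec.∷_) σs) ++ filter P? (map (inside Vec.∷_) σs))
      ≡⟨ weight-++ (filter P? (map (outside Vec.∷_) σs)) _ ⟩
    weight (filter P? (map (outside Vec.∷_) σs)) ℚ.+ weight (filter P? (map (inside Vec.∷_) σs))
      ≡⟨ cong₂ ℚ._+_ (weight-outside P? σs) (weight-inside P? σs) ⟩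
    weight (filter (P? ∘ (outside Vec.∷_)) σs) ℚ.+ t ℚ.* weight (filter (P? ∘ (inside Vec.∷_)) σs)
      ≡⟨ cong₂ ℚ._+_ cliques-without-zero cliques-with-zero ⟩
    cliquePoly t G S ∎
    where
    open ≡.≡-Reasoning
    σs : List (Subset n)
    σs = allSubsets n
    cliques-without-zero : weight (filter (P? ∘ (outside Vec.∷_)) σs) ≡ cliquePoly t (tail G) (S ∘ suc)
    cliques-without-zero = weight-cliques (tail G) (S ∘ suc) (P? ∘ (outside Vec.∷_)) λ σ →
      IsCliqueIn-outside G S σ ⇔-∘ P⇔ (outside Vec.∷ σ)
    cliques-with-zero : t ℚ.* weight (filter (P? ∘ (inside Vec.∷_)) σs) ≡
                        (if S zero then t ℚ.* cliquePoly t (tail G) ((S ∩ adj G zero) ∘ suc) else 0ℚ)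
    cliques-with-zero with S zero in S0
    ... | true  = cong (t ℚ.*_) (weight-cliques (tail G) ((S ∩ adj G zero) ∘ suc) (P? ∘ (inside Vec.∷_)) λ σ →
                    IsCliqueIn-inside G S S0 σ ⇔-∘ P⇔ (inside Vec.∷ σ))
    ... | false = ≡.trans (cong (λ σs → t ℚ.* weight σs) (filter-none (P? ∘ (inside Vec.∷_)) (All.universal ¬P σs)))
                          (ℚ.*-zeroʳ t)
      where
      ¬P : ∀ σ → ¬ P (inside Vec.∷ σ)
      ¬P σ Pσ = true≢false (proj₂ (Equivalence.to (P⇔ (inside Vec.∷ σ)) Pσ) zero here) S0

fPolynomial-cliqueComplex : ∀ {n} (G : Graph n) t → fPolynomial (cliqueComplex G) t ≡ cliquePoly t G everything
fPolynomial-cliqueComplex G t =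
  weight-cliques t G everything (isClique? G) λ σ → mk⇔ (λ clique → clique , λ _ _ → refl) proj₁

-- Edge subdivision

-- The f-polynomial of two points.
S⁰-poly : ℚ → ℚ
S⁰-poly t = 1ℚ ℚ.+ (t ℚ.+ t)

link : ∀ {n} → Graph n → List (Fin n) → VertexSet n
link G σ i = all (λ a → adj G a i) σ

link-++ : ∀ {n} (G : Graph n) σ τ i → link G (σ ++ τ) i ≡ link G σ i ∧ link G τ i
link-++ G []      τ i = refl
link-++ G (a ∷ σ) τ i =
  ≡.trans (cong (adj G a i ∧_) (link-++ G σ τ i)) (sym (∧-assoc (adj G a i) (link G σ i) (link G τ i)))

link-↭ : ∀ {n} (G : Graph n) {σ τ} → σ ↭ τ → ∀ i → link G σ i ≡ link G τ i
link-↭ G ↭.refl         i = refl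
link-↭ G (prep a σ↭τ)   i = cong (adj G a i ∧_) (link-↭ G σ↭τ i)
link-↭ G {_ ∷ _ ∷ σ} {_ ∷ _ ∷ τ} (swap a b σ↭τ) i = begin
  adj G a i ∧ (adj G b i ∧ link G σ i) ≡⟨ ∧-assoc (adj G a i) (adj G b i) (link G σ i) ⟨
  (adj G a i ∧ adj G b i) ∧ link G σ i ≡⟨ cong₂ _∧_ (∧-comm (adj G a i) (adj G b i)) (link-↭ G σ↭τ i) ⟩
  (adj G b i ∧ adj G a i) ∧ link G τ i ≡⟨ ∧-assoc (adj G b i) (adj G a i) (link G τ i) ⟩
  adj G b i ∧ (adj G a i ∧ link G τ i) ∎
  where open ≡.≡-Reasoning
link-↭ G (↭.trans ρ↭σ σ↭τ) i = ≡.trans (link-↭ G ρ↭σ i) (link-↭ G σ↭τ i)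

linkPoly : ∀ {n} → Graph n → List (Fin n) → ℚ → ℚ
linkPoly G σ t = cliquePoly t G (link G σ)

linkPoly-↭ : ∀ {n} (G : Graph n) {σ τ} → σ ↭ τ → ∀ t → linkPoly G σ t ≡ linkPoly G τ t
linkPoly-↭ G σ↭τ t = cliquePoly-ext t G (link-↭ G σ↭τ)

addVertex : ∀ {n} → Graph n → VertexSet n → Graph (suc n)
addVertex {n} G N = record { adj = adj⁺ ; symm = symm⁺ ; irrefl = irrefl⁺ }
  where
  adj⁺ : Fin (suc n) → Fin (suc n) → Bool
  adj⁺ zero    zero    = false
  adj⁺ zero    (suc j) = N j
  adj⁺ (suc i) zero    = N i
  adj⁺ (suc i) (suc j) = adj G i j
  symm⁺ : ∀ i j → adj⁺ i j ≡ adj⁺ j i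
  symm⁺ zero    zero    = refl
  symm⁺ zero    (suc j) = refl
  symm⁺ (suc i) zero    = refl
  symm⁺ (suc i) (suc j) = symm G i j
  irrefl⁺ : ∀ i → adj⁺ i i ≡ false
  irrefl⁺ zero    = refl
  irrefl⁺ (suc i) = irrefl G i

module Subdivision {n} (G : Graph n) (u v : Fin n) (uv : adj G u v ≡ true) where

  u≢v : u ≢ v
  u≢v = adjacent⇒≢ G uv

  data EdgeView : Fin n → Set where
    at-u : EdgeView u
    at-v : EdgeView v
    away : ∀ {i} → i ≢ u → i ≢ v → EdgeView i

  edgeView : ∀ i → EdgeView i
  edgeView i with i Fin.≟ u | i Fin.≟ v
  ... | yes refl | _        = at-u
  ... | no _     | yes refl = at-v
  ... | no i≢u   | no i≢v   = away i≢u i≢v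

  onEdge common nearby : VertexSet n
  onEdge i = (i == u) ∨ (i == v)
  common = link G (u ∷ v ∷ [])
  nearby i = onEdge i ∨ common i

  isEdge : Fin n → Fin n → Bool
  isEdge i j = ((i == u) ∧ (j == v)) ∨ ((i == v) ∧ (j == u))

  isEdge-sym : ∀ i j → isEdge i j ≡ isEdge j i
  isEdge-sym i j = ≡.trans (∨-comm ((i == u) ∧ (j == v)) ((i == v) ∧ (j == u)))
    (cong₂ _∨_ (∧-comm (i == v) (j == u)) (∧-comm (i == u) (j == v)))

  withoutEdge : Graph n
  withoutEdge = record
    { adj    = λ i j → adj G i j ∧ not (isEdge i j)
    ; symm   = λ i j → cong₂ (λ a b → a ∧ not b) (symm G i j) (isEdge-sym i j)
    ; irrefl = λ i → cong (_∧ not (isEdge i i)) (irrefl G i)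
    }

  subdivision : Graph (suc n)
  subdivision = addVertex withoutEdge nearby

  isEdge-u : ∀ j → isEdge u j ≡ (j == v)
  isEdge-u j rewrite ==-refl u | ≢⇒==-false u≢v = ∨-identityʳ (j == v)

  withoutEdge-away : ∀ {i j} → i ≢ u → i ≢ v → adj withoutEdge i j ≡ adj G i j
  withoutEdge-away {i} {j} i≢u i≢v rewrite ≢⇒==-false i≢u | ≢⇒==-false i≢v = ∧-identityʳ (adj G i j)

  withoutEdge-awayʳ : ∀ {i j} → j ≢ u → j ≢ v → adj withoutEdge i j ≡ adj G i j
  withoutEdge-awayʳ {i} {j} j≢u j≢v =
    ≡.trans (symm withoutEdge i j) (≡.trans (withoutEdge-away j≢u j≢v) (symm G j i))

  withoutEdge-uv : adj withoutEdge u v ≡ false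
  withoutEdge-uv = ∧-falseʳ (adj G u v) (cong not (≡.trans (isEdge-u v) (==-refl v)))

  onEdge-u : onEdge u ≡ true
  onEdge-u rewrite ==-refl u = refl

  onEdge-v : onEdge v ≡ true
  onEdge-v rewrite ==-refl v = ∨-zeroʳ (v == u)

  onEdge-away : ∀ {i} → i ≢ u → i ≢ v → onEdge i ≡ false
  onEdge-away i≢u i≢v rewrite ≢⇒==-false i≢u | ≢⇒==-false i≢v = refl

  nearby-u : nearby u ≡ true
  nearby-u = cong (_∨ common u) onEdge-u

  nearby-v : nearby v ≡ true
  nearby-v = cong (_∨ common v) onEdge-v

  nearby-common : ∀ {i} → adj G u i ≡ true → adj G v i ≡ true → nearby i ≡ true
  nearby-common {i} ui vi rewrite ui | vi = ∨-zeroʳ (onEdge i)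

  nearby-away : ∀ {i} → i ≢ u → i ≢ v → nearby i ≡ common i
  nearby-away {i} i≢u i≢v = cong (_∨ common i) (onEdge-away i≢u i≢v)

  common-u : common u ≡ false
  common-u rewrite irrefl G u = refl

  common-v : common v ≡ false
  common-v rewrite irrefl G v = ∧-zeroʳ (adj G u v)

  private
    absorbˡ : ∀ a b → (a ∧ (b ∧ true)) ∧ a ≡ a ∧ (b ∧ true)
    absorbˡ false _     = refl
    absorbˡ true  false = refl
    absorbˡ true  true  = refl

    absorbʳ : ∀ a b → (a ∧ (b ∧ true)) ∧ b ≡ a ∧ (b ∧ true)
    absorbʳ false _     = refl
    absorbʳ true  false = refl
    absorbʳ true  true  = refl

  nearby∩adj-u : ∀ i → nearby i ∧ adj withoutEdge u i ≡ common i
  nearby∩adj-u i with edgeView i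
  ... | at-u = ≡.trans (∧-falseʳ (nearby u) (irrefl withoutEdge u)) (sym common-u)
  ... | at-v = ≡.trans (∧-falseʳ (nearby v) withoutEdge-uv) (sym common-v)
  ... | away i≢u i≢v = ≡.trans (cong₂ _∧_ (nearby-away i≢u i≢v) (withoutEdge-awayʳ i≢u i≢v))
                               (absorbˡ (adj G u i) (adj G v i))

  nearby∩adj-v : ∀ i → nearby i ∧ adj withoutEdge v i ≡ common i
  nearby∩adj-v i with edgeView i
  ... | at-u = ≡.trans (∧-falseʳ (nearby u) (≡.trans (symm withoutEdge v u) withoutEdge-uv)) (sym common-u)
  ... | at-v = ≡.trans (∧-falseʳ (nearby v) (irrefl withoutEdge v)) (sym common-v)
  ... | away i≢u i≢v = ≡.trans (cong₂ _∧_ (nearby-away i≢u i≢v) (withoutEdge-awayʳ i≢u i≢v))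
                               (absorbʳ (adj G u i) (adj G v i))

  ∩nearby∖u∩adj-v : ∀ R i → (R ∩ nearby ∖ u ∩ adj withoutEdge v) i ≡ R i ∧ common i
  ∩nearby∖u∩adj-v R i with edgeView i
  ... | at-u = ≡.trans (cong (_∧ adj withoutEdge v u) (∖-self (R ∩ nearby) u)) (sym (∧-falseʳ (R u) common-u))
  ... | at-v = ≡.trans (cong (_∧ adj withoutEdge v v) (∖-other (R ∩ nearby) (u≢v ∘ sym)))
                       (≡.trans (∧-assoc (R v) (nearby v) _) (cong (R v ∧_) (nearby∩adj-v v)))
  ... | away i≢u _ = ≡.trans (cong (_∧ adj withoutEdge v i) (∖-other (R ∩ nearby) i≢u))
                             (≡.trans (∧-assoc (R i) (nearby i) _) (cong (R i ∧_) (nearby∩adj-v i)))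

  ∩nearby∖u∖v : ∀ R i → (R ∩ nearby ∖ u ∖ v) i ≡ R i ∧ common i
  ∩nearby∖u∖v R i with edgeView i
  ... | at-u = ≡.trans (≡.trans (∖-other (R ∩ nearby ∖ u) u≢v) (∖-self (R ∩ nearby) u))
                       (sym (∧-falseʳ (R u) common-u))
  ... | at-v = ≡.trans (∖-self (R ∩ nearby ∖ u) v) (sym (∧-falseʳ (R v) common-v))
  ... | away i≢u i≢v = ≡.trans (∖-other (R ∩ nearby ∖ u) i≢v)
                               (≡.trans (∖-other (R ∩ nearby) i≢u) (cong (R i ∧_) (nearby-away i≢u i≢v)))

  ∖v∩nearby : ∀ R i → (R ∩ adj G u ∖ v) i ∧ nearby i ≡ (R ∩ adj G u) i ∧ adj G v i
  ∖v∩nearby R i with edgeView i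
  ... | at-u rewrite irrefl G u | ∧-zeroʳ (R u) = refl
  ... | at-v = ≡.trans (cong (_∧ nearby v) (∖-self (R ∩ adj G u) v)) (sym (∧-falseʳ ((R ∩ adj G u) v) (irrefl G v)))
  ... | away i≢u i≢v = ≡.trans (cong₂ _∧_ (∖-other (R ∩ adj G u) i≢v) (nearby-away i≢u i≢v))
                               (absorb (R i) (adj G u i) (adj G v i))
    where
    absorb : ∀ r a b → (r ∧ a) ∧ (a ∧ (b ∧ true)) ≡ (r ∧ a) ∧ b
    absorb false _     _     = refl
    absorb true  false _     = refl
    absorb true  true  false = refl
    absorb true  true  true  = refl

  link-old : ∀ σ → link G σ u ≡ true → link G σ v ≡ true → ∀ i → link subdivision (map suc σ) (suc i) ≡ link G σ i
  link-old []      _ _ i = refl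
  link-old (a ∷ σ) σu σv i with au , σu ← ∧-true⁻ σu | av , σv ← ∧-true⁻ σv =
    cong₂ _∧_ (withoutEdge-away (adjacent⇒≢ G au) (adjacent⇒≢ G av)) (link-old σ σu σv i)

  link-new : ∀ σ → link G σ u ≡ true → link G σ v ≡ true → link subdivision (map suc σ) zero ≡ true
  link-new []      _ _ = refl
  link-new (a ∷ σ) σu σv with au , σu ← ∧-true⁻ σu | av , σv ← ∧-true⁻ σv =
    cong₂ _∧_ (nearby-common (adj-sym G au) (adj-sym G av)) (link-new σ σu σv)

  module _ (t : ℚ) where

    withoutEdge-avoiding : ∀ S → S u ≡ false ⊎ S v ≡ false → cliquePoly t withoutEdge S ≡ cliquePoly t G S
    withoutEdge-avoiding S avoids = cliquePoly-cong t (λ _ → refl) λ i j Si Sj →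
      ≡.trans (cong (λ b → adj G i j ∧ not b) (not-edge avoids Si Sj)) (∧-identityʳ (adj G i j))
      where
      not-in-S : ∀ {a i} → S a ≡ false → S i ≡ true → (i == a) ≡ false
      not-in-S {a} {i} Sa Si = ≢⇒==-false {i = i} {a} λ { refl → true≢false Si Sa }
      not-edge : S u ≡ false ⊎ S v ≡ false → ∀ {i j} → S i ≡ true → S j ≡ true → isEdge i j ≡ false
      not-edge (inj₁ Su) {i} Si Sj rewrite not-in-S Su Si | not-in-S Su Sj = ∧-zeroʳ (i == v)
      not-edge (inj₂ Sv) {i} Si Sj rewrite not-in-S Sv Si | not-in-S Sv Sj | ∧-zeroʳ (i == u) = refl

    cliquePoly-removeEdge : ∀ S → S u ≡ true → S v ≡ true →
      cliquePoly t G S ≡ cliquePoly t withoutEdge S ℚ.+ t ℚ.* (t ℚ.* cliquePoly t G (S ∩ common))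
    cliquePoly-removeEdge S Su Sv = begin
      cliquePoly t G S
        ≡⟨ cliquePoly-delete t G S u Su ⟩
      A ℚ.+ t ℚ.* cliquePoly t G (S ∩ adj G u)
        ≡⟨ cong (λ z → A ℚ.+ t ℚ.* z) (cliquePoly-delete t G (S ∩ adj G u) v (cong₂ _∧_ Sv uv)) ⟩
      A ℚ.+ t ℚ.* (B ℚ.+ t ℚ.* cliquePoly t G (S ∩ adj G u ∩ adj G v))
        ≡⟨ cong (λ z → A ℚ.+ t ℚ.* (B ℚ.+ t ℚ.* z)) (cliquePoly-ext t G S∩adj-u∩adj-v) ⟩
      A ℚ.+ t ℚ.* (B ℚ.+ t ℚ.* C)
        ≡⟨ distribute t A B C ⟩
      (A ℚ.+ t ℚ.* B) ℚ.+ t ℚ.* (t ℚ.* C)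
        ≡⟨ cong (ℚ._+ t ℚ.* (t ℚ.* C)) without-edge ⟨
      cliquePoly t withoutEdge S ℚ.+ t ℚ.* (t ℚ.* C) ∎
      where
      open ≡.≡-Reasoning
      A B C : ℚ
      A = cliquePoly t G (S ∖ u)
      B = cliquePoly t G (S ∩ adj G u ∖ v)
      C = cliquePoly t G (S ∩ common)
      distribute : ∀ t a b c → a ℚ.+ t ℚ.* (b ℚ.+ t ℚ.* c) ≡ (a ℚ.+ t ℚ.* b) ℚ.+ t ℚ.* (t ℚ.* c)
      distribute = solve-∀ ℚ-ring
      S∩adj-u∩adj-v : ∀ i → (S i ∧ adj G u i) ∧ adj G v i ≡ S i ∧ common i
      S∩adj-u∩adj-v i = ≡.trans (∧-assoc (S i) (adj G u i) (adj G v i))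
        (cong (λ b → S i ∧ (adj G u i ∧ b)) (sym (∧-identityʳ (adj G v i))))
      S∩adj⁻-u : ∀ i → (S ∩ adj withoutEdge u) i ≡ (S ∩ adj G u ∖ v) i
      S∩adj⁻-u i = ≡.trans (cong (λ b → S i ∧ (adj G u i ∧ not b)) (isEdge-u i)) (sym (∧-assoc (S i) (adj G u i) _))
      without-edge : cliquePoly t withoutEdge S ≡ A ℚ.+ t ℚ.* B
      without-edge = ≡.trans (cliquePoly-delete t withoutEdge S u Su) (cong₂ (λ a b → a ℚ.+ t ℚ.* b)
        (withoutEdge-avoiding (S ∖ u) (inj₁ (∖-self S u)))
        (≡.trans (cliquePoly-ext t withoutEdge S∩adj⁻-u)
                 (withoutEdge-avoiding (S ∩ adj G u ∖ v) (inj₂ (∖-self (S ∩ adj G u) v)))))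

    cliquePoly-withoutEdge-common : ∀ {S} R → (∀ i → S i ≡ R i ∧ common i) →
      cliquePoly t withoutEdge S ≡ cliquePoly t G (R ∩ common)
    cliquePoly-withoutEdge-common R S≗R∩common = ≡.trans (cliquePoly-ext t withoutEdge S≗R∩common)
      (withoutEdge-avoiding (R ∩ common) (inj₁ (∧-falseʳ (R u) common-u)))

    -- The new vertex is joined to the suspension of the link of the edge.
    cliquePoly-suspension : ∀ R → R u ≡ true → R v ≡ true →
      cliquePoly t withoutEdge (R ∩ nearby) ≡ S⁰-poly t ℚ.* cliquePoly t G (R ∩ common)
    cliquePoly-suspension R Ru Rv = begin
      K W
        ≡⟨ cliquePoly-delete t withoutEdge W u (cong₂ _∧_ Ru nearby-u) ⟩
      K (W ∖ u) ℚ.+ t ℚ.* K (W ∩ adj withoutEdge u)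
        ≡⟨ cong (ℚ._+ t ℚ.* K (W ∩ adj withoutEdge u))
             (cliquePoly-delete t withoutEdge (W ∖ u) v (≡.trans (∖-other W (u≢v ∘ sym)) (cong₂ _∧_ Rv nearby-v))) ⟩
      (K (W ∖ u ∖ v) ℚ.+ t ℚ.* K (W ∖ u ∩ adj withoutEdge v)) ℚ.+ t ℚ.* K (W ∩ adj withoutEdge u)
        ≡⟨ cong₂ (λ a b → a ℚ.+ t ℚ.* b)
             (cong₂ (λ a b → a ℚ.+ t ℚ.* b) (cliquePoly-withoutEdge-common R (∩nearby∖u∖v R))
               (cliquePoly-withoutEdge-common R (∩nearby∖u∩adj-v R)))
             (cliquePoly-withoutEdge-common R W∩adj-u) ⟩
      (C ℚ.+ t ℚ.* C) ℚ.+ t ℚ.* C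
        ≡⟨ factor t C ⟩
      S⁰-poly t ℚ.* C ∎
      where
      open ≡.≡-Reasoning
      K : VertexSet n → ℚ
      K = cliquePoly t withoutEdge
      W : VertexSet n
      W = R ∩ nearby
      C : ℚ
      C = cliquePoly t G (R ∩ common)
      factor : ∀ t c → (c ℚ.+ t ℚ.* c) ℚ.+ t ℚ.* c ≡ (1ℚ ℚ.+ (t ℚ.+ t)) ℚ.* c
      factor = solve-∀ ℚ-ring
      W∩adj-u : ∀ i → (W ∩ adj withoutEdge u) i ≡ R i ∧ common i
      W∩adj-u i = ≡.trans (∧-assoc (R i) (nearby i) _) (cong (R i ∧_) (nearby∩adj-u i))

  module _ (σ : List (Fin n)) (σu : link G σ u ≡ true) (σv : link G σ v ≡ true) where
    private
      R : VertexSet n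
      R = link G σ

      σ′ : List (Fin (suc n))
      σ′ = map suc σ

      link-edge : ∀ t → cliquePoly t G (R ∩ common) ≡ linkPoly G (σ ++ u ∷ v ∷ []) t
      link-edge t = cliquePoly-ext t G λ i → sym (link-++ G σ (u ∷ v ∷ []) i)

    linkPoly-oldFace : ∀ t → linkPoly subdivision σ′ t ≡
                       linkPoly G σ t ℚ.+ (t ℚ.+ t ℚ.* t) ℚ.* linkPoly G (σ ++ u ∷ v ∷ []) t
    linkPoly-oldFace t = begin
      linkPoly subdivision σ′ t
        ≡⟨ cong (λ b → K S ℚ.+ (if b then t ℚ.* K (S ∩ nearby) else 0ℚ)) (link-new σ σu σv) ⟩
      K S ℚ.+ t ℚ.* K (S ∩ nearby)
        ≡⟨ cong₂ (λ a b → a ℚ.+ t ℚ.* b) (cliquePoly-ext t withoutEdge (link-old σ σu σv))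
             (cliquePoly-ext t withoutEdge (λ i → cong (_∧ nearby i) (link-old σ σu σv i))) ⟩
      K R ℚ.+ t ℚ.* K (R ∩ nearby)
        ≡⟨ cong (λ z → K R ℚ.+ t ℚ.* z) (cliquePoly-suspension t R σu σv) ⟩
      K R ℚ.+ t ℚ.* (S⁰-poly t ℚ.* C)
        ≡⟨ regroup t (K R) C ⟩
      (K R ℚ.+ t ℚ.* (t ℚ.* C)) ℚ.+ (t ℚ.+ t ℚ.* t) ℚ.* C
        ≡⟨ cong₂ (λ a c → a ℚ.+ (t ℚ.+ t ℚ.* t) ℚ.* c) (sym (cliquePoly-removeEdge t R σu σv)) (link-edge t) ⟩
      linkPoly G σ t ℚ.+ (t ℚ.+ t ℚ.* t) ℚ.* linkPoly G (σ ++ u ∷ v ∷ []) t ∎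
      where
      open ≡.≡-Reasoning
      K : VertexSet n → ℚ
      K = cliquePoly t withoutEdge
      S : VertexSet n
      S = link subdivision σ′ ∘ suc
      C : ℚ
      C = cliquePoly t G (R ∩ common)
      regroup : ∀ t a c → a ℚ.+ t ℚ.* ((1ℚ ℚ.+ (t ℚ.+ t)) ℚ.* c) ≡ (a ℚ.+ t ℚ.* (t ℚ.* c)) ℚ.+ (t ℚ.+ t ℚ.* t) ℚ.* c
      regroup = solve-∀ ℚ-ring

    private
      link-old-++ : ∀ τ i → link subdivision (σ′ ++ τ) (suc i) ≡ R i ∧ link subdivision τ (suc i)
      link-old-++ τ i = ≡.trans (link-++ subdivision σ′ τ (suc i)) (cong (_∧ _) (link-old σ σu σv i))

      linkPoly-apart : ∀ τ t → link subdivision τ zero ≡ false →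
        linkPoly subdivision (σ′ ++ τ) t ≡ cliquePoly t withoutEdge (λ i → R i ∧ link subdivision τ (suc i))
      linkPoly-apart τ t τ-new = begin
        linkPoly subdivision (σ′ ++ τ) t
          ≡⟨ cong (λ b → K S ℚ.+ (if b then t ℚ.* K (S ∩ nearby) else 0ℚ))
               (≡.trans (link-++ subdivision σ′ τ zero) (∧-falseʳ (link subdivision σ′ zero) τ-new)) ⟩
        K S ℚ.+ 0ℚ
          ≡⟨ ℚ.+-identityʳ (K S) ⟩
        K S
          ≡⟨ cliquePoly-ext t withoutEdge (link-old-++ τ) ⟩
        K (λ i → R i ∧ link subdivision τ (suc i)) ∎
        where
        open ≡.≡-Reasoning
        K : VertexSet n → ℚ
        K = cliquePoly t withoutEdge
        S : VertexSet n
        S = link subdivision (σ′ ++ τ) ∘ suc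

    linkPoly-newVertex : ∀ t → linkPoly subdivision (σ′ ++ zero ∷ []) t ≡
                         S⁰-poly t ℚ.* linkPoly G (σ ++ u ∷ v ∷ []) t
    linkPoly-newVertex t = begin
      linkPoly subdivision (σ′ ++ zero ∷ []) t
        ≡⟨ linkPoly-apart (zero ∷ []) t refl ⟩
      cliquePoly t withoutEdge (λ i → R i ∧ (nearby i ∧ true))
        ≡⟨ cliquePoly-ext t withoutEdge (λ i → cong (R i ∧_) (∧-identityʳ (nearby i))) ⟩
      cliquePoly t withoutEdge (R ∩ nearby)
        ≡⟨ cliquePoly-suspension t R σu σv ⟩
      S⁰-poly t ℚ.* cliquePoly t G (R ∩ common)
        ≡⟨ cong (S⁰-poly t ℚ.*_) (link-edge t) ⟩
      S⁰-poly t ℚ.* linkPoly G (σ ++ u ∷ v ∷ []) t ∎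
      where open ≡.≡-Reasoning

    linkPoly-halfEdge : ∀ t → linkPoly subdivision (σ′ ++ suc u ∷ zero ∷ []) t ≡ linkPoly G (σ ++ u ∷ v ∷ []) t
    linkPoly-halfEdge t = begin
      linkPoly subdivision (σ′ ++ suc u ∷ zero ∷ []) t
        ≡⟨ linkPoly-apart (suc u ∷ zero ∷ []) t (∧-zeroʳ (nearby u)) ⟩
      cliquePoly t withoutEdge (λ i → R i ∧ (adj withoutEdge u i ∧ (nearby i ∧ true)))
        ≡⟨ cliquePoly-withoutEdge-common t R (λ i → cong (R i ∧_) (adj-u∩nearby i)) ⟩
      cliquePoly t G (R ∩ common)
        ≡⟨ link-edge t ⟩
      linkPoly G (σ ++ u ∷ v ∷ []) t ∎
      where
      open ≡.≡-Reasoning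
      adj-u∩nearby : ∀ i → adj withoutEdge u i ∧ (nearby i ∧ true) ≡ common i
      adj-u∩nearby i = ≡.trans (cong (adj withoutEdge u i ∧_) (∧-identityʳ (nearby i)))
        (≡.trans (∧-comm (adj withoutEdge u i) (nearby i)) (nearby∩adj-u i))

    -- In the link of u, the new vertex takes the place of v.
    linkPoly-endpoint : ∀ t → linkPoly subdivision (σ′ ++ suc u ∷ []) t ≡ linkPoly G (σ ++ u ∷ []) t
    linkPoly-endpoint t = begin
      linkPoly subdivision (σ′ ++ suc u ∷ []) t
        ≡⟨ cong (λ b → K S ℚ.+ (if b then t ℚ.* K (S ∩ nearby) else 0ℚ)) S-new ⟩
      K S ℚ.+ t ℚ.* K (S ∩ nearby)
        ≡⟨ cong₂ (λ a b → a ℚ.+ t ℚ.* b) (cliquePoly-ext t withoutEdge S≗M∖v)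
             (cliquePoly-ext t withoutEdge S∩nearby≗M∩adj-v) ⟩
      K (M ∖ v) ℚ.+ t ℚ.* K (M ∩ adj G v)
        ≡⟨ cong₂ (λ a b → a ℚ.+ t ℚ.* b) (withoutEdge-avoiding t (M ∖ v) (inj₂ (∖-self M v)))
             (withoutEdge-avoiding t (M ∩ adj G v) (inj₁ (cong (_∧ adj G v u) M-u))) ⟩
      cliquePoly t G (M ∖ v) ℚ.+ t ℚ.* cliquePoly t G (M ∩ adj G v)
        ≡⟨ cliquePoly-delete t G M v (cong₂ _∧_ σv uv) ⟨
      cliquePoly t G M
        ≡⟨ cliquePoly-ext t G M≗link ⟩
      linkPoly G (σ ++ u ∷ []) t ∎
      where
      open ≡.≡-Reasoning
      K : VertexSet n → ℚ
      K = cliquePoly t withoutEdge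
      S M : VertexSet n
      S = link subdivision (σ′ ++ suc u ∷ []) ∘ suc
      M = R ∩ adj G u
      S-new : link subdivision (σ′ ++ suc u ∷ []) zero ≡ true
      S-new = ≡.trans (link-++ subdivision σ′ (suc u ∷ []) zero)
                      (cong₂ _∧_ (link-new σ σu σv) (≡.trans (∧-identityʳ (nearby u)) nearby-u))
      M-u : M u ≡ false
      M-u = ∧-falseʳ (R u) (irrefl G u)
      M≗link : ∀ i → M i ≡ link G (σ ++ u ∷ []) i
      M≗link i = sym (≡.trans (link-++ G σ (u ∷ []) i) (cong (R i ∧_) (∧-identityʳ (adj G u i))))
      S≗M∖v : ∀ i → S i ≡ (M ∖ v) i
      S≗M∖v i = begin
        S i                                    ≡⟨ link-old-++ (suc u ∷ []) i ⟩
        R i ∧ (adj withoutEdge u i ∧ true)     ≡⟨ cong (R i ∧_) (∧-identityʳ (adj withoutEdge u i)) ⟩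
        R i ∧ (adj G u i ∧ not (isEdge u i))   ≡⟨ cong (λ b → R i ∧ (adj G u i ∧ not b)) (isEdge-u i) ⟩
        R i ∧ (adj G u i ∧ not (i == v))       ≡⟨ ∧-assoc (R i) (adj G u i) (not (i == v)) ⟨
        (M ∖ v) i                              ∎
      S∩nearby≗M∩adj-v : ∀ i → S i ∧ nearby i ≡ M i ∧ adj G v i
      S∩nearby≗M∩adj-v i = ≡.trans (cong (_∧ nearby i) (S≗M∖v i)) (∖v∩nearby R i)

-- Sequences of rationals

Eventually : (ℕ → Set) → Set
Eventually P = ∃ λ N → ∀ n → N ℕ.≤ n → P n

always : ∀ {P} → (∀ n → P n) → Eventually P
always p = 0 , λ n _ → p n

Eventually-map : ∀ {P Q : ℕ → Set} → (∀ n → P n → Q n) → Eventually P → Eventually Q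
Eventually-map f (N , p) = N , λ n N≤n → f n (p n N≤n)

Eventually-zipWith : ∀ {P Q R : ℕ → Set} → (∀ n → P n → Q n → R n) → Eventually P → Eventually Q → Eventually R
Eventually-zipWith f (M , p) (N , q) = M ℕ.⊔ N , λ n M⊔N≤n →
  f n (p n (ℕ.m⊔n≤o⇒m≤o M N M⊔N≤n)) (q n (ℕ.m⊔n≤o⇒n≤o M N M⊔N≤n))

Eventually-zip : ∀ {P Q : ℕ → Set} → Eventually P → Eventually Q → Eventually (λ n → P n × Q n)
Eventually-zip = Eventually-zipWith (λ _ → _,_)

Eventually⇒∃ : ∀ {P : ℕ → Set} → Eventually P → ∃ P
Eventually⇒∃ (N , p) = N , p N ℕ.≤-refl

record Near (e p q : ℚ) : Set where
  constructor near
  field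
    below : p ℚ.< q ℚ.+ e
    above : q ℚ.< p ℚ.+ e

open Near

Near-refl : ∀ {e p} → 0ℚ ℚ.< e → Near e p p
Near-refl 0<e = near (p<p+q 0<e) (p<p+q 0<e)

Near-sym : ∀ {e p q} → Near e p q → Near e q p
Near-sym (near p<q+e q<p+e) = near q<p+e p<q+e

Near-mono : ∀ {d e p q} → d ℚ.≤ e → Near d p q → Near e p q
Near-mono {p = p} {q} d≤e (near p<q+d q<p+d) =
  near (ℚ.<-≤-trans p<q+d (ℚ.+-monoʳ-≤ q d≤e)) (ℚ.<-≤-trans q<p+d (ℚ.+-monoʳ-≤ p d≤e))

∣p-q∣<e⇒Near : ∀ {e p q} → ℚ.∣ p ℚ.- q ∣ ℚ.< e → Near e p q
∣p-q∣<e⇒Near {e} {p} {q} ∣p-q∣<e = near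
  (<-resp-difference (ℚ.≤-<-trans (p≤∣p∣ (p ℚ.- q)) ∣p-q∣<e) (solve (e ∷ p ∷ q ∷ []) ℚ-ring))
  (<-resp-difference (ℚ.≤-<-trans (p≤∣p∣ (ℚ.- (p ℚ.- q))) ∣-[p-q]∣<e) (solve (e ∷ p ∷ q ∷ []) ℚ-ring))
  where
  ∣-[p-q]∣<e : ℚ.∣ ℚ.- (p ℚ.- q) ∣ ℚ.< e
  ∣-[p-q]∣<e = subst (ℚ._< e) (sym (ℚ.∣-p∣≡∣p∣ (p ℚ.- q))) ∣p-q∣<e

Near⇒∣p-q∣<e : ∀ {e p q} → Near e p q → ℚ.∣ p ℚ.- q ∣ ℚ.< e
Near⇒∣p-q∣<e {e} {p} {q} (near p<q+e q<p+e) with ℚ.∣p∣≡p∨∣p∣≡-p (p ℚ.- q)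
... | inj₁ eq = subst (ℚ._< e) (sym eq) (<-resp-difference p<q+e (solve (e ∷ p ∷ q ∷ []) ℚ-ring))
... | inj₂ eq = subst (ℚ._< e) (sym eq) (<-resp-difference q<p+e (solve (e ∷ p ∷ q ∷ []) ℚ-ring))

Near-+ : ∀ {d e p q p′ q′} → Near d p q → Near e p′ q′ → Near (d ℚ.+ e) (p ℚ.+ p′) (q ℚ.+ q′)
Near-+ {d} {e} {p} {q} {p′} {q′} (near p<q+d q<p+d) (near p′<q′+e q′<p′+e) = near
  (<-resp-difference (ℚ.+-mono-< p<q+d p′<q′+e) (solve (d ∷ e ∷ p ∷ q ∷ p′ ∷ q′ ∷ []) ℚ-ring))
  (<-resp-difference (ℚ.+-mono-< q<p+d q′<p′+e) (solve (d ∷ e ∷ p ∷ q ∷ p′ ∷ q′ ∷ []) ℚ-ring))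

Near-+-½ : ∀ {e p q p′ q′} → Near (½ ℚ.* e) p q → Near (½ ℚ.* e) p′ q′ → Near e (p ℚ.+ p′) (q ℚ.+ q′)
Near-+-½ {e} p~q p′~q′ = subst (λ d → Near d _ _) (½+½ e) (Near-+ p~q p′~q′)

Near-neg : ∀ {e p q} → Near e p q → Near e (ℚ.- p) (ℚ.- q)
Near-neg {e} {p} {q} (near p<q+e q<p+e) = near
  (<-resp-difference q<p+e (solve (e ∷ p ∷ q ∷ []) ℚ-ring))
  (<-resp-difference p<q+e (solve (e ∷ p ∷ q ∷ []) ℚ-ring))

Near-⊓ : ∀ {e p q p′ q′} → Near e p q → Near e p′ q′ → Near e (p ℚ.⊓ p′) (q ℚ.⊓ q′)
Near-⊓ {e} {p} {q} {p′} {q′} (near p<q+e q<p+e) (near p′<q′+e q′<p′+e) = near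
  (subst (p ℚ.⊓ p′ ℚ.<_) (sym (+-distribʳ-⊓ e q q′)) (⊓-mono-< p<q+e p′<q′+e))
  (subst (q ℚ.⊓ q′ ℚ.<_) (sym (+-distribʳ-⊓ e p p′)) (⊓-mono-< q<p+e q′<p′+e))

Near-abs : ∀ {e p q} → Near e p q → Near e ℚ.∣ p ∣ ℚ.∣ q ∣
Near-abs {e} p~q = near (∣p∣<∣q∣+e p~q) (∣p∣<∣q∣+e (Near-sym p~q))
  where
  ∣p∣<∣q∣+e : ∀ {p q} → Near e p q → ℚ.∣ p ∣ ℚ.< ℚ.∣ q ∣ ℚ.+ e
  ∣p∣<∣q∣+e {p} {q} p~q = begin-strict
    ℚ.∣ p ∣                       ≡⟨ cong ℚ.∣_∣ q+[p-q]≡p ⟨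
    ℚ.∣ q ℚ.+ (p ℚ.- q) ∣         ≤⟨ ℚ.∣p+q∣≤∣p∣+∣q∣ q (p ℚ.- q) ⟩
    ℚ.∣ q ∣ ℚ.+ ℚ.∣ p ℚ.- q ∣     <⟨ ℚ.+-monoʳ-< ℚ.∣ q ∣ (Near⇒∣p-q∣<e p~q) ⟩
    ℚ.∣ q ∣ ℚ.+ e                 ∎
    where
    open ℚ.≤-Reasoning
    q+[p-q]≡p : q ℚ.+ (p ℚ.- q) ≡ p
    q+[p-q]≡p = solve (p ∷ q ∷ []) ℚ-ring

Near-* : ∀ {d B p q p′ q′} → 0ℚ ℚ.< B → ℚ.∣ p ∣ ℚ.≤ B → ℚ.∣ q′ ∣ ℚ.≤ B → Near d p q → Near d p′ q′ →
         Near (B ℚ.* d ℚ.+ B ℚ.* d) (p ℚ.* p′) (q ℚ.* q′)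
Near-* {d} {B} {p} {q} {p′} {q′} 0<B ∣p∣≤B ∣q′∣≤B p~q p′~q′ = ∣p-q∣<e⇒Near (begin-strict
  ℚ.∣ p ℚ.* p′ ℚ.- q ℚ.* q′ ∣
    ≡⟨ cong ℚ.∣_∣ difference ⟩
  ℚ.∣ p ℚ.* (p′ ℚ.- q′) ℚ.+ q′ ℚ.* (p ℚ.- q) ∣
    ≤⟨ ℚ.∣p+q∣≤∣p∣+∣q∣ (p ℚ.* (p′ ℚ.- q′)) (q′ ℚ.* (p ℚ.- q)) ⟩
  ℚ.∣ p ℚ.* (p′ ℚ.- q′) ∣ ℚ.+ ℚ.∣ q′ ℚ.* (p ℚ.- q) ∣
    <⟨ ℚ.+-mono-< (∣r*s∣<B*d p (p′ ℚ.- q′) ∣p∣≤B (Near⇒∣p-q∣<e p′~q′))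
                  (∣r*s∣<B*d q′ (p ℚ.- q) ∣q′∣≤B (Near⇒∣p-q∣<e p~q)) ⟩
  B ℚ.* d ℚ.+ B ℚ.* d ∎)
  where
  open ℚ.≤-Reasoning
  difference : p ℚ.* p′ ℚ.- q ℚ.* q′ ≡ p ℚ.* (p′ ℚ.- q′) ℚ.+ q′ ℚ.* (p ℚ.- q)
  difference = solve (p ∷ q ∷ p′ ∷ q′ ∷ []) ℚ-ring
  ∣r*s∣<B*d : ∀ r s → ℚ.∣ r ∣ ℚ.≤ B → ℚ.∣ s ∣ ℚ.< d → ℚ.∣ r ℚ.* s ∣ ℚ.< B ℚ.* d
  ∣r*s∣<B*d r s ∣r∣≤B ∣s∣<d = begin-strict
    ℚ.∣ r ℚ.* s ∣         ≡⟨ ℚ.∣p*q∣≡∣p∣*∣q∣ r s ⟩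
    ℚ.∣ r ∣ ℚ.* ℚ.∣ s ∣   ≤⟨ ℚ.*-monoʳ-≤-nonNeg ℚ.∣ s ∣ {{ℚ.∣-∣-nonNeg s}} ∣r∣≤B ⟩
    B ℚ.* ℚ.∣ s ∣         <⟨ ℚ.*-monoʳ-<-pos B {{ℚ.positive 0<B}} ∣s∣<d ⟩
    B ℚ.* d               ∎

-- Real numbers

Cauchy-Near : ∀ x {e} → 0ℚ ℚ.< e → ∃ λ N → ∀ m n → N ℕ.≤ m → N ℕ.≤ n → Near e (seq x m) (seq x n)
Cauchy-Near x 0<e = let N , close = cauchy x _ 0<e in N , λ m n N≤m N≤n → ∣p-q∣<e⇒Near (close m n N≤m N≤n)

private
  abstract
    ⊓-cauchy : ∀ x y → Cauchy (λ n → seq x n ℚ.⊓ seq y n)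
    ⊓-cauchy x y e 0<e =
      let M , x-close = Cauchy-Near x 0<e
          N , y-close = Cauchy-Near y 0<e
      in M ℕ.⊔ N , λ m n M⊔N≤m M⊔N≤n → Near⇒∣p-q∣<e (Near-⊓
           (x-close m n (ℕ.m⊔n≤o⇒m≤o M N M⊔N≤m) (ℕ.m⊔n≤o⇒m≤o M N M⊔N≤n))
           (y-close m n (ℕ.m⊔n≤o⇒n≤o M N M⊔N≤m) (ℕ.m⊔n≤o⇒n≤o M N M⊔N≤n)))

    abs-cauchy : ∀ x → Cauchy (λ n → ℚ.∣ seq x n ∣)
    abs-cauchy x e 0<e =
      let N , x-close = Cauchy-Near x 0<e
      in N , λ m n N≤m N≤n → Near⇒∣p-q∣<e (Near-abs (x-close m n N≤m N≤n))

infixl 7 _⊓_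

_⊓_ : ℝ → ℝ → ℝ
x ⊓ y = mkℝ (λ n → seq x n ℚ.⊓ seq y n) (⊓-cauchy x y)

abs : ℝ → ℝ
abs x = mkℝ (λ n → ℚ.∣ seq x n ∣) (abs-cauchy x)

bounded : ∀ x → ∃ λ B → 0ℚ ℚ.< B × Eventually λ n → ℚ.∣ seq x n ∣ ℚ.≤ B
bounded x = let N , close = Cauchy-Near (abs x) 0<1 in
  ℚ.∣ seq x N ∣ ℚ.+ 1ℚ , ℚ.+-mono-≤-< (ℚ.0≤∣p∣ (seq x N)) 0<1 ,
  N , λ n N≤n → ℚ.<⇒≤ (below (close n N N≤n ℕ.≤-refl))

infix 4 _≃_ _≲_

Close : ℚ → ℝ → ℝ → Set
Close e x y = Eventually λ n → Near e (seq x n) (seq y n)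

-- The relations _≈_, _≤_ and _<_ unfold to statements about the functions seq alone,
-- from which Agda cannot infer the real numbers; the records below keep them.
record _≃_ (x y : ℝ) : Set where
  constructor mk≃
  field close : ∀ {e} → 0ℚ ℚ.< e → Close e x y

open _≃_

record _≲_ (x y : ℝ) : Set where
  constructor mk≲
  field eventually-below : ∀ {e} → 0ℚ ℚ.< e → Eventually λ n → seq x n ℚ.< seq y n ℚ.+ e

open _≲_

record Positive (x : ℝ) : Set where
  field
    {bound}          : ℚ
    0<bound          : 0ℚ ℚ.< bound
    eventually-above : Eventually λ n → bound ℚ.< seq x n

open Positive

≈⇒≃ : ∀ {x y} → x ≈ y → x ≃ y
≈⇒≃ x≈y = mk≃ λ 0<e → Eventually-map (λ _ → ∣p-q∣<e⇒Near) (x≈y _ 0<e)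

≃⇒≈ : ∀ {x y} → x ≃ y → x ≈ y
≃⇒≈ x≃y _ 0<e = Eventually-map (λ _ → Near⇒∣p-q∣<e) (close x≃y 0<e)

≃-setoid : Setoid 0ℓ 0ℓ
≃-setoid = record
  { Carrier = ℝ
  ; _≈_ = _≃_
  ; isEquivalence = record
    { refl  = mk≃ λ 0<e → always λ _ → Near-refl 0<e
    ; sym   = λ x≃y → mk≃ λ 0<e → Eventually-map (λ _ → Near-sym) (close x≃y 0<e)
    ; trans = λ {x} {y} {z} x≃y y≃z → ≈⇒≃ (≈.trans {x} {y} {z} (≃⇒≈ x≃y) (≃⇒≈ y≃z))
    }
  }
  where module ≈ = Setoid ℝ-setoid

open Setoid ≃-setoid using () renaming (refl to ≃-refl; sym to ≃-sym; trans to ≃-trans; reflexive to ≡⇒≃)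
module ≃-Reasoning = SetoidReasoning ≃-setoid

≗⇒≃ : ∀ {x y} → (∀ n → seq x n ≡ seq y n) → x ≃ y
≗⇒≃ {x} x≗y = mk≃ λ 0<e → always λ n → subst (Near _ (seq x n)) (x≗y n) (Near-refl 0<e)

+-cong : ∀ {x y x′ y′} → x ≃ y → x′ ≃ y′ → x + x′ ≃ y + y′
+-cong x≃y x′≃y′ = mk≃ λ 0<e →
  Eventually-zipWith (λ _ → Near-+-½) (close x≃y (0<½*p 0<e)) (close x′≃y′ (0<½*p 0<e))

-‿cong : ∀ {x y} → x ≃ y → - x ≃ - y
-‿cong x≃y = mk≃ λ 0<e → Eventually-map (λ _ → Near-neg) (close x≃y 0<e)

⊓-cong : ∀ {x y x′ y′} → x ≃ y → x′ ≃ y′ → x ⊓ x′ ≃ y ⊓ y′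
⊓-cong x≃y x′≃y′ = mk≃ λ 0<e → Eventually-zipWith (λ _ → Near-⊓) (close x≃y 0<e) (close x′≃y′ 0<e)

*-cong : ∀ {x y x′ y′} → x ≃ y → x′ ≃ y′ → x * x′ ≃ y * y′
*-cong {x} {y} {x′} {y′} x≃y x′≃y′ = mk≃ x*x′-close
  where
  x*x′-close : ∀ {e} → 0ℚ ℚ.< e → Close e (x * x′) (y * y′)
  x*x′-close {e} 0<e =
    let A , 0<A , ∣x∣≤A  = bounded x
        B , 0<B , ∣y′∣≤B = bounded y′
        0<A+B = ℚ.+-mono-< 0<A 0<B
        A≤A+B = ℚ.<⇒≤ (p<p+q 0<B)
        B≤A+B = subst (B ℚ.≤_) (ℚ.+-comm B A) (ℚ.<⇒≤ (p<p+q 0<A))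
        d , [A+B]*d≡½e , 0<d = divide (½ ℚ.* e) 0<A+B
        2[A+B]d≡e = ≡.trans (cong₂ ℚ._+_ [A+B]*d≡½e [A+B]*d≡½e) (½+½ e)
    in Eventually-zipWith
         (λ n (∣xₙ∣≤A , ∣y′ₙ∣≤B) (xₙ~yₙ , x′ₙ~y′ₙ) →
           subst (λ e → Near e (seq x n ℚ.* seq x′ n) (seq y n ℚ.* seq y′ n)) 2[A+B]d≡e
             (Near-* 0<A+B (ℚ.≤-trans ∣xₙ∣≤A A≤A+B) (ℚ.≤-trans ∣y′ₙ∣≤B B≤A+B) xₙ~yₙ x′ₙ~y′ₙ))
         (Eventually-zip ∣x∣≤A ∣y′∣≤B)
         (Eventually-zip (close x≃y (0<d (0<½*p 0<e))) (close x′≃y′ (0<d (0<½*p 0<e))))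

+-0-commutativeMonoid : CommutativeMonoid 0ℓ 0ℓ
+-0-commutativeMonoid = record
  { Carrier = ℝ
  ; _≈_ = _≃_
  ; _∙_ = _+_
  ; ε = 0ℝ
  ; isCommutativeMonoid = record
    { isMonoid = record
      { isSemigroup = record
        { isMagma = record { isEquivalence = Setoid.isEquivalence ≃-setoid ; ∙-cong = +-cong }
        ; assoc = λ x y z → ≗⇒≃ λ n → ℚ.+-assoc (seq x n) (seq y n) (seq z n)
        }
      ; identity = (λ x → ≗⇒≃ λ n → ℚ.+-identityˡ (seq x n)) , (λ x → ≗⇒≃ λ n → ℚ.+-identityʳ (seq x n))
      }
    ; comm = λ x y → ≗⇒≃ λ n → ℚ.+-comm (seq x n) (seq y n)
    }
  }

open CommutativeMonoidSum +-0-commutativeMonoid using (sum-cong-≋; ∑-distrib-+; sum-replicate-zero)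
open CommutativeMonoid +-0-commutativeMonoid using ()
  renaming (assoc to +-assoc; comm to +-comm; identityˡ to +-identityˡ; identityʳ to +-identityʳ)

≲⇒≤ : ∀ {x y} → x ≲ y → x ≤ y
≲⇒≤ x≲y (e , 0<e , y<x) =
  let _ , xₙ<xₙ = Eventually⇒∃ (Eventually-zipWith (λ _ → ℚ.<-trans) (eventually-below x≲y 0<e) y<x)
  in ℚ.<-irrefl refl xₙ<xₙ

≤⇒≲ : ∀ {x y} → x ≤ y → x ≲ y
≤⇒≲ {x} {y} x≤y = mk≲ λ {e} 0<e →
  let 0<⅛e = 0<½*p (0<½*p (0<½*p 0<e))
      M , x-close = Cauchy-Near x 0<⅛e
      N , y-close = Cauchy-Near y 0<⅛e
      k = M ℕ.⊔ N
      xₙ~xₖ = λ n k≤n → x-close n k (ℕ.m⊔n≤o⇒m≤o M N k≤n) (ℕ.m≤m⊔n M N)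
      yₙ~yₖ = λ n k≤n → y-close n k (ℕ.m⊔n≤o⇒n≤o M N k≤n) (ℕ.m≤n⊔m M N)
      xₖ≤yₖ+½e = ℚ.≮⇒≥ λ yₖ+½e<xₖ → x≤y (½ ℚ.* (½ ℚ.* e) , 0<½*p (0<½*p 0<e) ,
                   k , λ n k≤n → separated {e} yₖ+½e<xₖ (xₙ~xₖ n k≤n) (yₙ~yₖ n k≤n))
  in k , λ n k≤n → approached 0<e xₖ≤yₖ+½e (xₙ~xₖ n k≤n) (yₙ~yₖ n k≤n)
  where
  separated : ∀ {e xₙ xₖ yₙ yₖ} → yₖ ℚ.+ ½ ℚ.* e ℚ.< xₖ →
              Near (½ ℚ.* (½ ℚ.* (½ ℚ.* e))) xₙ xₖ → Near (½ ℚ.* (½ ℚ.* (½ ℚ.* e))) yₙ yₖ →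
              yₙ ℚ.+ ½ ℚ.* (½ ℚ.* e) ℚ.< xₙ
  separated {e} {xₙ} {xₖ} {yₙ} {yₖ} yₖ+½e<xₖ xₙ~xₖ yₙ~yₖ = <-resp-difference
    (ℚ.+-mono-< yₖ+½e<xₖ (ℚ.+-mono-< (above xₙ~xₖ) (below yₙ~yₖ)))
    (solve (e ∷ xₙ ∷ xₖ ∷ yₙ ∷ yₖ ∷ []) ℚ-ring)
  approached : ∀ {e xₙ xₖ yₙ yₖ} → 0ℚ ℚ.< e → xₖ ℚ.≤ yₖ ℚ.+ ½ ℚ.* e →
               Near (½ ℚ.* (½ ℚ.* (½ ℚ.* e))) xₙ xₖ → Near (½ ℚ.* (½ ℚ.* (½ ℚ.* e))) yₙ yₖ →
               xₙ ℚ.< yₙ ℚ.+ e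
  approached {e} {xₙ} {xₖ} {yₙ} {yₖ} 0<e xₖ≤yₖ+½e xₙ~xₖ yₙ~yₖ = <-resp-difference
    (ℚ.+-mono-< (ℚ.+-mono-≤-< xₖ≤yₖ+½e (0<½*p (0<½*p 0<e))) (ℚ.+-mono-< (below xₙ~xₖ) (above yₙ~yₖ)))
    (solve (e ∷ xₙ ∷ xₖ ∷ yₙ ∷ yₖ ∷ []) ℚ-ring)

≃⇒≲ : ∀ {x y} → x ≃ y → x ≲ y
≃⇒≲ x≃y = mk≲ λ 0<e → Eventually-map (λ _ → below) (close x≃y 0<e)

≲-refl : ∀ {x} → x ≲ x
≲-refl = ≃⇒≲ ≃-refl

≲-trans : ∀ {x y z} → x ≲ y → y ≲ z → x ≲ z
≲-trans {x} {y} {z} x≲y y≲z = mk≲ λ {e} 0<e → Eventually-zipWith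
  (λ n xₙ<yₙ+½e yₙ<zₙ+½e →
    <-resp-difference (ℚ.+-mono-< xₙ<yₙ+½e yₙ<zₙ+½e) (identity (seq x n) (seq y n) (seq z n) e))
  (eventually-below x≲y (0<½*p 0<e)) (eventually-below y≲z (0<½*p 0<e))
  where
  identity : ∀ p q r e → (r ℚ.+ e) ℚ.- p ≡ ((q ℚ.+ ½ ℚ.* e) ℚ.+ (r ℚ.+ ½ ℚ.* e)) ℚ.- (p ℚ.+ q)
  identity = solve-∀ ℚ-ring

≲-antisym : ∀ {x y} → x ≲ y → y ≲ x → x ≃ y
≲-antisym x≲y y≲x = mk≃ λ 0<e →
  Eventually-zipWith (λ _ → near) (eventually-below x≲y 0<e) (eventually-below y≲x 0<e)

pointwise⇒≲ : ∀ {x y} → (∀ n → seq x n ℚ.≤ seq y n) → x ≲ y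
pointwise⇒≲ x≤y = mk≲ λ 0<e → always λ n → ℚ.≤-<-trans (x≤y n) (p<p+q 0<e)

≲-+ : ∀ {x y x′ y′} → x ≲ y → x′ ≲ y′ → x + x′ ≲ y + y′
≲-+ {x} {y} {x′} {y′} x≲y x′≲y′ = mk≲ λ {e} 0<e → Eventually-zipWith
  (λ n xₙ<yₙ+½e x′ₙ<y′ₙ+½e →
    <-resp-difference (ℚ.+-mono-< xₙ<yₙ+½e x′ₙ<y′ₙ+½e) (identity (seq x n) (seq y n) (seq x′ n) (seq y′ n) e))
  (eventually-below x≲y (0<½*p 0<e)) (eventually-below x′≲y′ (0<½*p 0<e))
  where
  identity : ∀ p q p′ q′ e →
    ((q ℚ.+ q′) ℚ.+ e) ℚ.- (p ℚ.+ p′) ≡ ((q ℚ.+ ½ ℚ.* e) ℚ.+ (q′ ℚ.+ ½ ℚ.* e)) ℚ.- (p ℚ.+ p′)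
  identity = solve-∀ ℚ-ring

0≲x+y : ∀ {x y} → 0ℝ ≲ x → 0ℝ ≲ y → 0ℝ ≲ x + y
0≲x+y 0≲x 0≲y = mk≲ (eventually-below (≲-+ 0≲x 0≲y))

x+y≲0 : ∀ {x y} → x ≲ 0ℝ → y ≲ 0ℝ → x + y ≲ 0ℝ
x+y≲0 x≲0 y≲0 = mk≲ (eventually-below (≲-+ x≲0 y≲0))

0≲x⊓y : ∀ {x y} → 0ℝ ≲ x → 0ℝ ≲ y → 0ℝ ≲ x ⊓ y
0≲x⊓y {x} {y} 0≲x 0≲y = mk≲ λ {e} 0<e → Eventually-zipWith
  (λ n 0<xₙ+e 0<yₙ+e →
    subst₂ ℚ._<_ (sym (ℚ.+-identityˡ 0ℚ)) (sym (+-distribʳ-⊓ e (seq x n) (seq y n))) (0<p⊓q 0<xₙ+e 0<yₙ+e))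
  (eventually-below 0≲x 0<e) (eventually-below 0≲y 0<e)

x⊓y≲x : ∀ x y → x ⊓ y ≲ x
x⊓y≲x x y = pointwise⇒≲ λ n → ℚ.p⊓q≤p (seq x n) (seq y n)

x⊓y≲y : ∀ x y → x ⊓ y ≲ y
x⊓y≲y x y = pointwise⇒≲ λ n → ℚ.p⊓q≤q (seq x n) (seq y n)

0≲x⇒abs≃x : ∀ {x} → 0ℝ ≲ x → abs x ≃ x
0≲x⇒abs≃x {x} 0≲x = ≲-antisym (mk≲ λ 0<e → Eventually-map (λ n → ∣p∣<p+e 0<e) (eventually-below 0≲x (0<½*p 0<e)))
  (pointwise⇒≲ λ n → p≤∣p∣ (seq x n))
  where
  ∣p∣<p+e : ∀ {p e} → 0ℚ ℚ.< e → 0ℚ ℚ.< p ℚ.+ ½ ℚ.* e → ℚ.∣ p ∣ ℚ.< p ℚ.+ e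
  ∣p∣<p+e {p} {e} 0<e 0<p+½e with ℚ.∣p∣≡p∨∣p∣≡-p p
  ... | inj₁ ∣p∣≡p  = subst (ℚ._< p ℚ.+ e) (sym ∣p∣≡p) (p<p+q 0<e)
  ... | inj₂ ∣p∣≡-p = subst (ℚ._< p ℚ.+ e) (sym ∣p∣≡-p)
    (<-resp-difference (ℚ.+-mono-< 0<p+½e 0<p+½e) (solve (p ∷ e ∷ []) ℚ-ring))

0<⇒Positive : ∀ {x} → 0ℝ < x → Positive x
0<⇒Positive (e , 0<e , 0+e<x) = record
  { 0<bound = 0<e ; eventually-above = Eventually-map (λ _ → subst (ℚ._< _) (ℚ.+-identityˡ e)) 0+e<x }

Positive⇒0< : ∀ {x} → Positive x → 0ℝ < x
Positive⇒0< 0<x =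
  bound 0<x , 0<bound 0<x , Eventually-map (λ _ → subst (ℚ._< _) (sym (ℚ.+-identityˡ _))) (eventually-above 0<x)

Positive-≲ : ∀ {x y} → x ≲ y → Positive x → Positive y
Positive-≲ {x} {y} x≲y 0<x = record
  { 0<bound = 0<½*p (0<bound 0<x)
  ; eventually-above = Eventually-zipWith
      (λ n b<xₙ xₙ<yₙ+½b → <-resp-difference (ℚ.+-mono-< b<xₙ xₙ<yₙ+½b) (identity (bound 0<x) (seq x n) (seq y n)))
      (eventually-above 0<x) (eventually-below x≲y (0<½*p (0<bound 0<x)))
  }
  where
  identity : ∀ b p q → q ℚ.- ½ ℚ.* b ≡ (p ℚ.+ (q ℚ.+ ½ ℚ.* b)) ℚ.- (b ℚ.+ p)
  identity = solve-∀ ℚ-ring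

Positive-square : ∀ {x} → Positive x → Positive (x * x)
Positive-square 0<x = record
  { 0<bound = 0<p*q (0<bound 0<x) (0<bound 0<x)
  ; eventually-above = Eventually-map (λ _ → square-mono-< (ℚ.<⇒≤ (0<bound 0<x))) (eventually-above 0<x)
  }

¬Positive⇒≲0 : ∀ {x} → ¬ Positive x → x ≲ 0ℝ
¬Positive⇒≲0 ¬0<x = ≤⇒≲ (¬0<x ∘ 0<⇒Positive)

-- For nonnegative reals this amounts to x ⊓ y ≃ 0ℝ, without deciding which of the two vanishes.
Disjoint : ℝ → ℝ → Set
Disjoint x y = ¬ (Positive x × Positive y)

Disjoint-sym : ∀ {x y} → Disjoint x y → Disjoint y x
Disjoint-sym x∥y (0<y , 0<x) = x∥y (0<x , 0<y)

Disjoint-≲ : ∀ {x y z} → x ≲ y → Disjoint y z → Disjoint x z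
Disjoint-≲ x≲y y∥z (0<x , 0<z) = y∥z (Positive-≲ x≲y 0<x , 0<z)

¬Positive-0ℝ : ¬ Positive 0ℝ
¬Positive-0ℝ 0<0 = ℚ.<-irrefl refl (ℚ.<-trans (0<bound 0<0) (proj₂ (Eventually⇒∃ (eventually-above 0<0))))

Disjoint-+ : ∀ {x y z} → Disjoint x z → Disjoint y z → Disjoint (x + y) z
Disjoint-+ x∥z y∥z (0<x+y , 0<z) = ¬Positive-0ℝ (Positive-≲
  (x+y≲0 (¬Positive⇒≲0 λ 0<x → x∥z (0<x , 0<z)) (¬Positive⇒≲0 λ 0<y → y∥z (0<y , 0<z))) 0<x+y)

pointwise⇒Disjoint : ∀ {x y} → (∀ n → ¬ (0ℚ ℚ.< seq x n × 0ℚ ℚ.< seq y n)) → Disjoint x y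
pointwise⇒Disjoint xₙ∥yₙ (0<x , 0<y) =
  let n , b<xₙ , c<yₙ = Eventually⇒∃ (Eventually-zip (eventually-above 0<x) (eventually-above 0<y))
  in xₙ∥yₙ n (ℚ.<-trans (0<bound 0<x) b<xₙ , ℚ.<-trans (0<bound 0<y) c<yₙ)

Disjoint⇒⊓≃0 : ∀ {x y} → 0ℝ ≲ x → 0ℝ ≲ y → Disjoint x y → x ⊓ y ≃ 0ℝ
Disjoint⇒⊓≃0 {x} {y} 0≲x 0≲y x∥y = ≲-antisym
  (¬Positive⇒≲0 λ 0<x⊓y → x∥y (Positive-≲ (x⊓y≲x x y) 0<x⊓y , Positive-≲ (x⊓y≲y x y) 0<x⊓y))
  (0≲x⊓y 0≲x 0≲y)

half : ℝ → ℝ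
half x = fromℚ ½ * x

0≲half : ∀ {x} → 0ℝ ≲ x → 0ℝ ≲ half x
0≲half {x} 0≲x = mk≲ λ {e} 0<e → Eventually-map
  (λ n 0<xₙ+e → <-resp-difference (ℚ.+-mono-< (0<½*p 0<xₙ+e) (0<½*p 0<e)) (identity (seq x n) e))
  (eventually-below 0≲x 0<e)
  where
  identity : ∀ p e → (½ ℚ.* p ℚ.+ e) ℚ.- 0ℚ ≡ (½ ℚ.* (p ℚ.+ e) ℚ.+ ½ ℚ.* e) ℚ.- (0ℚ ℚ.+ 0ℚ)
  identity = solve-∀ ℚ-ring

half≲x : ∀ {x} → 0ℝ ≲ x → half x ≲ x
half≲x {x} 0≲x = mk≲ λ {e} 0<e → Eventually-map
  (λ n 0<xₙ+e → <-resp-difference (ℚ.+-mono-< (0<½*p 0<xₙ+e) (0<½*p 0<e)) (identity (seq x n) e))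
  (eventually-below 0≲x 0<e)
  where
  identity : ∀ p e → (p ℚ.+ e) ℚ.- ½ ℚ.* p ≡ (½ ℚ.* (p ℚ.+ e) ℚ.+ ½ ℚ.* e) ℚ.- (0ℚ ℚ.+ 0ℚ)
  identity = solve-∀ ℚ-ring

x≲x+y : ∀ {x y} → 0ℝ ≲ y → x ≲ x + y
x≲x+y {x} 0≲y = ≲-trans (≃⇒≲ (≃-sym (+-identityʳ x))) (≲-+ ≲-refl 0≲y)

y≲x+y : ∀ {x y} → 0ℝ ≲ x → y ≲ x + y
y≲x+y {x} {y} 0≲x = ≲-trans (≃⇒≲ (≃-sym (+-identityˡ y))) (≲-+ 0≲x ≲-refl)

0≲Σ : ∀ {n} {x : Vector ℝ n} → (∀ i → 0ℝ ≲ x i) → 0ℝ ≲ Σℝ x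
0≲Σ {zero}  0≲x = ≲-refl
0≲Σ {suc n} 0≲x = 0≲x+y (0≲x zero) (0≲Σ (0≲x ∘ suc))

term≲Σ : ∀ {n} {x : Vector ℝ n} → (∀ i → 0ℝ ≲ x i) → ∀ i → x i ≲ Σℝ x
term≲Σ 0≲x zero    = x≲x+y (0≲Σ (0≲x ∘ suc))
term≲Σ 0≲x (suc i) = ≲-trans (term≲Σ (0≲x ∘ suc) i) (y≲x+y (0≲x zero))

-- Square roots

record SqrtApprox (d q r : ℚ) : Set where
  field
    nonNegative : 0ℚ ℚ.≤ r
    lower       : r ℚ.* r ℚ.≤ q
    upper       : q ℚ.< (r ℚ.+ d) ℚ.* (r ℚ.+ d)

open SqrtApprox

SqrtApprox-square : ∀ {d r} → 0ℚ ℚ.< d → 0ℚ ℚ.≤ r → SqrtApprox d (r ℚ.* r) r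
SqrtApprox-square 0<d 0≤r = record
  { nonNegative = 0≤r ; lower = ℚ.≤-refl ; upper = square-mono-< 0≤r (p<p+q 0<d) }

module _ {d q : ℚ} (0<d : 0ℚ ℚ.< d) (0≤q : 0ℚ ℚ.≤ q) where
  private
    [1+n]*d≡n*d+d : ∀ n → fromℕ (suc n) ℚ.* d ≡ fromℕ n ℚ.* d ℚ.+ d
    [1+n]*d≡n*d+d n = ≡.trans (cong (ℚ._* d) (fromℕ-suc n)) (identity d (fromℕ n))
      where
      identity : ∀ d p → (1ℚ ℚ.+ p) ℚ.* d ≡ p ℚ.* d ℚ.+ d
      identity = solve-∀ ℚ-ring

    search : ∀ n → q ℚ.< (fromℕ n ℚ.* d) ℚ.* (fromℕ n ℚ.* d) → ∃ (SqrtApprox d q)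
    search zero q<[0*d]² = contradiction (ℚ.≤-<-trans 0≤q (subst (q ℚ.<_) ([0*d]²≡0 d) q<[0*d]²)) (ℚ.<-irrefl refl)
      where
      [0*d]²≡0 : ∀ d → (0ℚ ℚ.* d) ℚ.* (0ℚ ℚ.* d) ≡ 0ℚ
      [0*d]²≡0 = solve-∀ ℚ-ring
    search (suc n) q<[[1+n]*d]² with q ℚ.<? (fromℕ n ℚ.* d) ℚ.* (fromℕ n ℚ.* d)
    ... | yes q<[n*d]² = search n q<[n*d]²
    ... | no  q≮[n*d]² = fromℕ n ℚ.* d , record
      { nonNegative = 0≤p*q (fromℕ-mono-≤ {0} {n} ℕ.z≤n) (ℚ.<⇒≤ 0<d)
      ; lower       = ℚ.≮⇒≥ q≮[n*d]²
      ; upper       = subst (λ r → q ℚ.< r ℚ.* r) ([1+n]*d≡n*d+d n) q<[[1+n]*d]²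
      }

  SqrtApprox-exists : ∃ (SqrtApprox d q)
  SqrtApprox-exists =
    let p , d*p≡q+1 , _ = divide (q ℚ.+ 1ℚ) 0<d
        n , p<n = archimedean p
        q+1<n*d = subst₂ ℚ._<_ d*p≡q+1 (ℚ.*-comm d (fromℕ n)) (ℚ.*-monoʳ-<-pos d {{ℚ.positive 0<d}} p<n)
    in search n (ℚ.<-trans q<[q+1]² (square-mono-< (ℚ.<⇒≤ 0<q+1) q+1<n*d))
    where
    0<q+1 : 0ℚ ℚ.< q ℚ.+ 1ℚ
    0<q+1 = ℚ.+-mono-≤-< 0≤q 0<1
    q<[q+1]² : q ℚ.< (q ℚ.+ 1ℚ) ℚ.* (q ℚ.+ 1ℚ)
    q<[q+1]² = <-resp-difference (ℚ.+-mono-≤-< (0≤p*p q) 0<q+1) (solve (q ∷ []) ℚ-ring)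

SqrtApprox-mono : ∀ {c d e p q r s} → 0ℚ ℚ.< d → 0ℚ ℚ.< e → SqrtApprox c p r → SqrtApprox d q s →
                  p ℚ.< q ℚ.+ e ℚ.* e → r ℚ.< s ℚ.+ (d ℚ.+ e)
SqrtApprox-mono {c} {d} {e} {p} {q} {r} {s} 0<d 0<e r≈√p s≈√q p<q+e² = square-cancel-<
  (ℚ.+-mono-≤ (nonNegative s≈√q) (ℚ.<⇒≤ (ℚ.+-mono-< 0<d 0<e)))
  (begin-strict
    r ℚ.* r                                             ≤⟨ lower r≈√p ⟩
    p                                                   <⟨ p<q+e² ⟩
    q ℚ.+ e ℚ.* e                                       <⟨ q+e²<[s+d+e]² ⟩
    (s ℚ.+ (d ℚ.+ e)) ℚ.* (s ℚ.+ (d ℚ.+ e))             ∎)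
  where
  open ℚ.≤-Reasoning
  0≤[s+d]*e : 0ℚ ℚ.≤ (s ℚ.+ d) ℚ.* e
  0≤[s+d]*e = 0≤p*q (ℚ.+-mono-≤ (nonNegative s≈√q) (ℚ.<⇒≤ 0<d)) (ℚ.<⇒≤ 0<e)
  q+e²<[s+d+e]² : q ℚ.+ e ℚ.* e ℚ.< (s ℚ.+ (d ℚ.+ e)) ℚ.* (s ℚ.+ (d ℚ.+ e))
  q+e²<[s+d+e]² = <-resp-difference (ℚ.+-mono-<-≤ (upper s≈√q) (ℚ.+-mono-≤ 0≤[s+d]*e 0≤[s+d]*e))
    (solve (d ∷ e ∷ q ∷ s ∷ []) ℚ-ring)

SqrtApprox-Near : ∀ {c d e p q r s} → 0ℚ ℚ.< c → 0ℚ ℚ.< d → c ℚ.< ½ ℚ.* e → d ℚ.< ½ ℚ.* e →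
                  SqrtApprox c p r → SqrtApprox d q s → Near ((½ ℚ.* e) ℚ.* (½ ℚ.* e)) p q → Near e r s
SqrtApprox-Near {e = e} {r = r} {s} 0<c 0<d c<½e d<½e r≈√p s≈√q p~q = near
  (ℚ.<-trans (SqrtApprox-mono 0<d 0<½e r≈√p s≈√q (below p~q)) (ℚ.+-monoʳ-< s (d+½e<e d<½e)))
  (ℚ.<-trans (SqrtApprox-mono 0<c 0<½e s≈√q r≈√p (above p~q)) (ℚ.+-monoʳ-< r (d+½e<e c<½e)))
  where
  0<½e : 0ℚ ℚ.< ½ ℚ.* e
  0<½e = ℚ.<-trans 0<c c<½e
  d+½e<e : ∀ {d} → d ℚ.< ½ ℚ.* e → d ℚ.+ ½ ℚ.* e ℚ.< e
  d+½e<e {d} d<½e = subst (d ℚ.+ ½ ℚ.* e ℚ.<_) (½+½ e) (ℚ.+-monoˡ-< (½ ℚ.* e) d<½e)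

0<fromℕ[1+n] : ∀ n → 0ℚ ℚ.< fromℕ (suc n)
0<fromℕ[1+n] n = ι-mono-< {+ 0} {+ suc n} (ℤ.+<+ ℕ.z<s)

1/[1+_] : ℕ → ℚ
1/[1+ n ] = proj₁ (divide 1ℚ (0<fromℕ[1+n] n))

[1+n]*1/[1+n]≡1 : ∀ n → fromℕ (suc n) ℚ.* 1/[1+ n ] ≡ 1ℚ
[1+n]*1/[1+n]≡1 n = proj₁ (proj₂ (divide 1ℚ (0<fromℕ[1+n] n)))

0<1/[1+n] : ∀ n → 0ℚ ℚ.< 1/[1+ n ]
0<1/[1+n] n = proj₂ (proj₂ (divide 1ℚ (0<fromℕ[1+n] n))) 0<1

1/[1+n]-small : ∀ {e} → 0ℚ ℚ.< e → Eventually λ n → 1/[1+ n ] ℚ.< e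
1/[1+n]-small {e} 0<e =
  let p , e*p≡1 , _ = divide 1ℚ 0<e
      N , p<N = archimedean p
  in N , λ n N≤n → let open ℚ.≤-Reasoning in begin-strict
       1/[1+ n ]                                ≡⟨ ℚ.*-identityʳ 1/[1+ n ] ⟨
       1/[1+ n ] ℚ.* 1ℚ                         ≡⟨ cong (1/[1+ n ] ℚ.*_) e*p≡1 ⟨
       1/[1+ n ] ℚ.* (e ℚ.* p)                  <⟨ ℚ.*-monoʳ-<-pos 1/[1+ n ] {{ℚ.positive (0<1/[1+n] n)}}
                                                     (ℚ.*-monoʳ-<-pos e {{ℚ.positive 0<e}}
                                                       (ℚ.<-≤-trans p<N (fromℕ-mono-≤ (ℕ.m≤n⇒m≤1+n N≤n)))) ⟩
       1/[1+ n ] ℚ.* (e ℚ.* fromℕ (suc n))      ≡⟨ rearrange 1/[1+ n ] e (fromℕ (suc n)) ⟩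
       e ℚ.* (fromℕ (suc n) ℚ.* 1/[1+ n ])      ≡⟨ cong (e ℚ.*_) ([1+n]*1/[1+n]≡1 n) ⟩
       e ℚ.* 1ℚ                                 ≡⟨ ℚ.*-identityʳ e ⟩
       e                                        ∎
  where
  rearrange : ∀ p q r → p ℚ.* (q ℚ.* r) ≡ q ℚ.* (r ℚ.* p)
  rearrange = solve-∀ ℚ-ring

0<[½e]² : ∀ {e} → 0ℚ ℚ.< e → 0ℚ ℚ.< (½ ℚ.* e) ℚ.* (½ ℚ.* e)
0<[½e]² 0<e = 0<p*q (0<½*p 0<e) (0<½*p 0<e)

private
  -- Abstract, as type checking must not run the search.
  abstract
    ∣seq∣-sqrt : ∀ x n → ∃ (SqrtApprox 1/[1+ n ] ℚ.∣ seq x n ∣)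
    ∣seq∣-sqrt x n = SqrtApprox-exists (0<1/[1+n] n) (ℚ.0≤∣p∣ (seq x n))

  √-near : ∀ x y m n {e} → 1/[1+ m ] ℚ.< ½ ℚ.* e → 1/[1+ n ] ℚ.< ½ ℚ.* e →
           Near ((½ ℚ.* e) ℚ.* (½ ℚ.* e)) (seq x m) (seq y n) →
           Near e (proj₁ (∣seq∣-sqrt x m)) (proj₁ (∣seq∣-sqrt y n))
  √-near x y m n 1/[1+m]<½e 1/[1+n]<½e xₘ~yₙ = SqrtApprox-Near (0<1/[1+n] m) (0<1/[1+n] n) 1/[1+m]<½e 1/[1+n]<½e
    (proj₂ (∣seq∣-sqrt x m)) (proj₂ (∣seq∣-sqrt y n)) (Near-abs xₘ~yₙ)

  abstract
    √-cauchy : ∀ x → Cauchy (λ n → proj₁ (∣seq∣-sqrt x n))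
    √-cauchy x e 0<e =
      let M , x-close = Cauchy-Near x (0<[½e]² 0<e)
          N , small   = 1/[1+n]-small (0<½*p 0<e)
      in M ℕ.⊔ N , λ m n M⊔N≤m M⊔N≤n → Near⇒∣p-q∣<e (√-near x x m n
           (small m (ℕ.m⊔n≤o⇒n≤o M N M⊔N≤m)) (small n (ℕ.m⊔n≤o⇒n≤o M N M⊔N≤n))
           (x-close m n (ℕ.m⊔n≤o⇒m≤o M N M⊔N≤m) (ℕ.m⊔n≤o⇒m≤o M N M⊔N≤n)))

-- The square root of the absolute value, which is defined everywhere.
√ : ℝ → ℝ
√ x = mkℝ (λ n → proj₁ (∣seq∣-sqrt x n)) (√-cauchy x)

√-SqrtApprox : ∀ x n → SqrtApprox 1/[1+ n ] ℚ.∣ seq x n ∣ (seq (√ x) n)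
√-SqrtApprox x n = proj₂ (∣seq∣-sqrt x n)

√-Close : ∀ {x y e} → 0ℚ ℚ.< e → Close ((½ ℚ.* e) ℚ.* (½ ℚ.* e)) x y → Close e (√ x) (√ y)
√-Close {x} {y} 0<e = Eventually-zipWith (λ n small xₙ~yₙ → √-near x y n n small small xₙ~yₙ)
  (1/[1+n]-small (0<½*p 0<e))

0≲√x : ∀ x → 0ℝ ≲ √ x
0≲√x x = pointwise⇒≲ λ n → nonNegative (√-SqrtApprox x n)

√[x*x]≃abs : ∀ x → √ (x * x) ≃ abs x
√[x*x]≃abs x = mk≃ λ 0<e → Eventually-map
  (λ n small → SqrtApprox-Near (0<1/[1+n] n) (0<1/[1+n] n) small small
    (√-SqrtApprox (x * x) n) (∣x∣≈√[x*x] n) (Near-refl (0<[½e]² 0<e)))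
  (1/[1+n]-small (0<½*p 0<e))
  where
  ∣x∣≈√[x*x] : ∀ n → SqrtApprox 1/[1+ n ] ℚ.∣ seq x n ℚ.* seq x n ∣ ℚ.∣ seq x n ∣
  ∣x∣≈√[x*x] n = subst (λ q → SqrtApprox _ q ℚ.∣ seq x n ∣) (sym (ℚ.∣p*q∣≡∣p∣*∣q∣ (seq x n) (seq x n)))
    (SqrtApprox-square (0<1/[1+n] n) (ℚ.0≤∣p∣ (seq x n)))

√x*√x≃abs : ∀ x → √ x * √ x ≃ abs x
√x*√x≃abs x = mk≃ √x*√x-close
  where
  √x*√x-close : ∀ {e} → 0ℚ ℚ.< e → Close e (√ x * √ x) (abs x)
  √x*√x-close {e} 0<e =
    let B , 0<B , ∣√x∣≤B = bounded (√ x)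
        0<C = ℚ.+-mono-< (ℚ.+-mono-< 0<B 0<B) 0<1
        d , C*d≡e , 0<d = divide e 0<C
    in Eventually-zipWith
         (λ n ∣r∣≤B (1/[1+n]<d , 1/[1+n]<1) → near
           (ℚ.≤-<-trans (lower (√-SqrtApprox x n)) (p<p+q 0<e))
           (subst (λ e → ℚ.∣ seq x n ∣ ℚ.< seq (√ x) n ℚ.* seq (√ x) n ℚ.+ e) C*d≡e
             (ℚ.<-trans (upper (√-SqrtApprox x n))
               ([r+c]²<r²+Cd 0<C (0<1/[1+n] n) (ℚ.≤-trans (p≤∣p∣ (seq (√ x) n)) ∣r∣≤B) 1/[1+n]<1 1/[1+n]<d))))
         ∣√x∣≤B (Eventually-zip (1/[1+n]-small (0<d 0<e)) (1/[1+n]-small 0<1))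
    where
    [r+c]²<r²+Cd : ∀ {B c d r} → 0ℚ ℚ.< B ℚ.+ B ℚ.+ 1ℚ → 0ℚ ℚ.< c → r ℚ.≤ B → c ℚ.< 1ℚ → c ℚ.< d →
                   (r ℚ.+ c) ℚ.* (r ℚ.+ c) ℚ.< r ℚ.* r ℚ.+ (B ℚ.+ B ℚ.+ 1ℚ) ℚ.* d
    [r+c]²<r²+Cd {B} {c} {d} {r} 0<C 0<c r≤B c<1 c<d = begin-strict
      (r ℚ.+ c) ℚ.* (r ℚ.+ c)
        ≡⟨ solve (c ∷ r ∷ []) ℚ-ring ⟩
      r ℚ.* r ℚ.+ (r ℚ.+ r ℚ.+ c) ℚ.* c
        <⟨ ℚ.+-monoʳ-< (r ℚ.* r) (ℚ.≤-<-trans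
             (ℚ.*-monoʳ-≤-nonNeg c {{ℚ.nonNegative (ℚ.<⇒≤ 0<c)}} (ℚ.+-mono-≤ (ℚ.+-mono-≤ r≤B r≤B) (ℚ.<⇒≤ c<1)))
             (ℚ.*-monoʳ-<-pos (B ℚ.+ B ℚ.+ 1ℚ) {{ℚ.positive 0<C}} c<d)) ⟩
      r ℚ.* r ℚ.+ (B ℚ.+ B ℚ.+ 1ℚ) ℚ.* d ∎
      where open ℚ.≤-Reasoning

-- Uniform continuity and homeomorphisms

infixl 8 _when_

_when_ : ℝ → Bool → ℝ
x when b = if b then x else 0ℝ

0≲when : ∀ b {x} → 0ℝ ≲ x → 0ℝ ≲ x when b
0≲when true  0≲x = 0≲x
0≲when false 0≲x = ≃⇒≲ ≃-refl

when-cong : ∀ b {x y} → x ≃ y → x when b ≃ y when b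
when-cong true  x≃y = x≃y
when-cong false x≃y = ≃-refl

record UniformlyContinuous {m} (P : Pred (Vector ℝ m) 0ℓ) (f : Vector ℝ m → ℝ) : Set where
  constructor mkUC
  field
    modulus : ∀ {e} → 0ℚ ℚ.< e → ∃ λ d → 0ℚ ℚ.< d ×
      (∀ {x y} → P x → P y → (∀ i → Close d (x i) (y i)) → Close e (f x) (f y))

open UniformlyContinuous

Close-mono : ∀ {d e x y} → d ℚ.≤ e → Close d x y → Close e x y
Close-mono d≤e = Eventually-map (λ _ → Near-mono d≤e)

module _ {m} {P : Pred (Vector ℝ m) 0ℓ} where

  coordinate-uc : ∀ i → UniformlyContinuous P (λ x → x i)
  coordinate-uc i = mkUC λ 0<e → _ , 0<e , λ _ _ x~y → x~y i

  const-uc : ∀ c → UniformlyContinuous P (λ _ → c)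
  const-uc c = mkUC λ 0<e → 1ℚ , 0<1 , λ _ _ _ → always λ _ → Near-refl 0<e

  ∘₁-uc : ∀ {f} (h : ℝ → ℝ) →
          (∀ {e} → 0ℚ ℚ.< e → ∃ λ d → 0ℚ ℚ.< d × (∀ x y → Close d x y → Close e (h x) (h y))) →
          UniformlyContinuous P f → UniformlyContinuous P (λ x → h (f x))
  ∘₁-uc {f} h h-uc f-uc = mkUC λ 0<e →
    let c , 0<c , h-close = h-uc 0<e
        d , 0<d , f-close = modulus f-uc 0<c
    in d , 0<d , λ {x} {y} Px Py x~y → h-close (f x) (f y) (f-close Px Py x~y)

  ∘₂-uc : ∀ {f g} (h : ℝ → ℝ → ℝ) →
          (∀ {e} → 0ℚ ℚ.< e → ∃ λ d → 0ℚ ℚ.< d ×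
            (∀ x y x′ y′ → Close d x y → Close d x′ y′ → Close e (h x x′) (h y y′))) →
          UniformlyContinuous P f → UniformlyContinuous P g → UniformlyContinuous P (λ x → h (f x) (g x))
  ∘₂-uc {f} {g} h h-uc f-uc g-uc = mkUC λ 0<e →
    let b , 0<b , h-close = h-uc 0<e
        c , 0<c , f-close = modulus f-uc 0<b
        d , 0<d , g-close = modulus g-uc 0<b
    in c ℚ.⊓ d , 0<p⊓q 0<c 0<d , λ {x} {y} Px Py x~y → h-close (f x) (f y) (g x) (g y)
         (f-close Px Py λ i → Close-mono {x = x i} {y i} (ℚ.p⊓q≤p c d) (x~y i))
         (g-close Px Py λ i → Close-mono {x = x i} {y i} (ℚ.p⊓q≤q c d) (x~y i))

  +-uc : ∀ {f g} → UniformlyContinuous P f → UniformlyContinuous P g → UniformlyContinuous P (λ x → f x + g x)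
  +-uc = ∘₂-uc _+_ λ 0<e → _ , 0<½*p 0<e , λ _ _ _ _ → Eventually-zipWith (λ _ → Near-+-½)

  neg-uc : ∀ {f} → UniformlyContinuous P f → UniformlyContinuous P (λ x → - f x)
  neg-uc = ∘₁-uc -_ λ 0<e → _ , 0<e , λ _ _ → Eventually-map (λ _ → Near-neg)

  ⊓-uc : ∀ {f g} → UniformlyContinuous P f → UniformlyContinuous P g → UniformlyContinuous P (λ x → f x ⊓ g x)
  ⊓-uc = ∘₂-uc _⊓_ λ 0<e → _ , 0<e , λ _ _ _ _ → Eventually-zipWith (λ _ → Near-⊓)

  √-uc : ∀ {f} → UniformlyContinuous P f → UniformlyContinuous P (λ x → √ (f x))
  √-uc = ∘₁-uc √ λ 0<e → _ , 0<[½e]² 0<e , λ x y → √-Close {x} {y} 0<e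

  half-uc : ∀ {f} → UniformlyContinuous P f → UniformlyContinuous P (λ x → half (f x))
  half-uc = ∘₁-uc half λ 0<e → _ , 0<e , λ _ _ → Eventually-map λ _ p~q → Near-mono (ℚ.<⇒≤ (½*p<p 0<e)) (Near-½ p~q)
    where
    ½*p<½*q+½*e : ∀ e p q → p ℚ.< q ℚ.+ e → ½ ℚ.* p ℚ.< ½ ℚ.* q ℚ.+ ½ ℚ.* e
    ½*p<½*q+½*e e p q p<q+e = subst (½ ℚ.* p ℚ.<_) (ℚ.*-distribˡ-+ ½ q e) (ℚ.*-monoʳ-<-pos ½ p<q+e)
    Near-½ : ∀ {e p q} → Near e p q → Near (½ ℚ.* e) (½ ℚ.* p) (½ ℚ.* q)
    Near-½ {e} {p} {q} (near p<q+e q<p+e) = near (½*p<½*q+½*e e p q p<q+e) (½*p<½*q+½*e e q p q<p+e)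

  when-uc : ∀ b {f} → UniformlyContinuous P f → UniformlyContinuous P (λ x → f x when b)
  when-uc true  f-uc = f-uc
  when-uc false f-uc = const-uc 0ℝ

  square-uc : ∀ {f B} → 0ℚ ℚ.< B → (∀ {x} → P x → Eventually λ n → ℚ.∣ seq (f x) n ∣ ℚ.≤ B) →
              UniformlyContinuous P f → UniformlyContinuous P (λ x → f x * f x)
  square-uc {f} {B} 0<B ∣f∣≤B f-uc = mkUC λ {e} 0<e →
    let c , 2B*c≡e , 0<c = divide e (ℚ.+-mono-< 0<B 0<B)
        Bc+Bc≡e = ≡.trans (sym (ℚ.*-distribʳ-+ c B B)) 2B*c≡e
        d , 0<d , f-close = modulus f-uc (0<c 0<e)
    in d , 0<d , λ {x} {y} Px Py x~y → Eventually-zipWith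
         (λ n (∣fxₙ∣≤B , ∣fyₙ∣≤B) fxₙ~fyₙ →
           subst (λ e → Near e (seq (f x) n ℚ.* seq (f x) n) (seq (f y) n ℚ.* seq (f y) n)) Bc+Bc≡e
             (Near-* 0<B ∣fxₙ∣≤B ∣fyₙ∣≤B fxₙ~fyₙ fxₙ~fyₙ))
         (Eventually-zip (∣f∣≤B Px) (∣f∣≤B Py)) (f-close Px Py x~y)

Within⇒Close : ∀ {m d} {x y : Vector ℝ m} → Within (fromℚ d) x y → ∀ i → Close d (x i) (y i)
Within⇒Close {d = d} {x} {y} within i = let xᵢ<yᵢ+d , yᵢ<xᵢ+d = within i in
  Eventually-zipWith (λ _ → near)
    (eventually {x i} {y i + fromℚ d} xᵢ<yᵢ+d) (eventually {y i} {x i + fromℚ d} yᵢ<xᵢ+d)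
  where
  eventually : ∀ {x y} → x < y → Eventually (λ n → seq x n ℚ.< seq y n)
  eventually (_ , 0<e , x+e<y) = Eventually-map (λ _ → ℚ.<-trans (p<p+q 0<e)) x+e<y

Close⇒Within : ∀ {m e ε} {x y : Vector ℝ m} → 0ℚ ℚ.< e → Eventually (λ n → 0ℚ ℚ.+ e ℚ.< seq ε n) →
               (∀ i → Close (½ ℚ.* e) (x i) (y i)) → Within ε x y
Close⇒Within {e = e} {ε} {x} {y} 0<e 0+e<ε x~y i = xᵢ<yᵢ+ε (x i) (y i) (Eventually-map (λ _ → below) (x~y i)) ,
                                                   xᵢ<yᵢ+ε (y i) (x i) (Eventually-map (λ _ → above) (x~y i))
  where
  shift : ∀ p q r → p ℚ.< q ℚ.+ ½ ℚ.* e → 0ℚ ℚ.+ e ℚ.< r → p ℚ.+ ½ ℚ.* e ℚ.< q ℚ.+ r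
  shift p q r p<q+½e 0+e<r = <-resp-difference (ℚ.+-mono-< p<q+½e 0+e<r) (solve (e ∷ p ∷ q ∷ r ∷ []) ℚ-ring)
  xᵢ<yᵢ+ε : ∀ x y → Eventually (λ n → seq x n ℚ.< seq y n ℚ.+ ½ ℚ.* e) → x < y + ε
  xᵢ<yᵢ+ε x y x<y+½e =
    ½ ℚ.* e , 0<½*p 0<e , Eventually-zipWith (λ n → shift (seq x n) (seq y n) (seq ε n)) x<y+½e 0+e<ε

common-modulus : ∀ {n} {Q : Fin n → ℚ → Set} → (∀ j {c d} → c ℚ.≤ d → Q j d → Q j c) →
                 (∀ j → ∃ λ d → 0ℚ ℚ.< d × Q j d) → ∃ λ d → 0ℚ ℚ.< d × (∀ j → Q j d)
common-modulus {zero}  antitone moduli = 1ℚ , 0<1 , λ ()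
common-modulus {suc n} antitone moduli =
  let c , 0<c , Qc = moduli zero
      d , 0<d , Qd = common-modulus (antitone ∘ suc) (moduli ∘ suc)
  in c ℚ.⊓ d , 0<p⊓q 0<c 0<d , λ
       { zero    → antitone zero (ℚ.p⊓q≤p c d) Qc
       ; (suc j) → antitone (suc j) (ℚ.p⊓q≤q c d) (Qd j) }

module _ {m n} {P : Pred (Vector ℝ m) 0ℓ} (Q : Pred (Vector ℝ n) 0ℓ) {f : Vector ℝ m → Vector ℝ n}
         (f-maps : ∀ {x} → P x → Q (f x)) (f-uc : ∀ j → UniformlyContinuous P (λ x → f x j)) where

  restrict : Σ (Vector ℝ m) P → Σ (Vector ℝ n) Q
  restrict (x , Px) = f x , f-maps Px

  restrict-cong : ∀ {x y} → P x → P y → (∀ i → x i ≃ y i) → ∀ j → f x j ≃ f y j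
  restrict-cong Px Py x≃y j = mk≃ λ 0<e →
    let d , 0<d , f-close = modulus (f-uc j) 0<e in f-close Px Py (λ i → close (x≃y i) 0<d)

  restrict-continuous : Continuous {P = P} {Q = Q} restrict
  restrict-continuous (x , Px) ε (e , 0<e , 0+e<ε) =
    let d , 0<d , f-close = common-modulus f-close-antitone (λ j → modulus (f-uc j) (0<½*p 0<e))
    in fromℚ d ,
       (½ ℚ.* d , 0<½*p 0<d , always λ _ → subst (ℚ._< d) (sym (ℚ.+-identityˡ (½ ℚ.* d))) (½*p<p 0<d)) ,
       λ (y , Py) within → Close⇒Within {ε = ε} {f x} {f y} 0<e 0+e<ε
         λ j → f-close j Px Py (Within⇒Close {x = x} {y} within)
    where
    f-close-antitone : ∀ j {c d} → c ℚ.≤ d →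
      (∀ {x y} → P x → P y → (∀ i → Close d (x i) (y i)) → Close (½ ℚ.* e) (f x j) (f y j)) →
      (∀ {x y} → P x → P y → (∀ i → Close c (x i) (y i)) → Close (½ ℚ.* e) (f x j) (f y j))
    f-close-antitone j c≤d f-close {x} {y} Px Py x~y =
      f-close Px Py (λ i → Close-mono {x = x i} {y i} c≤d (x~y i))

mkHomeomorphism : ∀ {m n} {P : Pred (Vector ℝ m) 0ℓ} {Q : Pred (Vector ℝ n) 0ℓ}
  (f : Vector ℝ m → Vector ℝ n) (g : Vector ℝ n → Vector ℝ m) →
  (∀ {x} → P x → Q (f x)) → (∀ {y} → Q y → P (g y)) →
  (∀ j → UniformlyContinuous P (λ x → f x j)) → (∀ i → UniformlyContinuous Q (λ y → g y i)) →
  (∀ {y} → Q y → ∀ j → f (g y) j ≃ y j) → (∀ {x} → P x → ∀ i → g (f x) i ≃ x i) → Homeomorphism P Q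
mkHomeomorphism {P = P} {Q} f g f-maps g-maps f-uc g-uc f∘g≃id g∘f≃id = record
  { bijection = record
    { to        = restrict Q f-maps f-uc
    ; from      = restrict P g-maps g-uc
    ; to-cong   = λ {(_ , Px)} {(_ , Py)} x≈y → ≃⇒≈ ∘ restrict-cong Q f-maps f-uc Px Py (≈⇒≃ ∘ x≈y)
    ; from-cong = λ {(_ , Qx)} {(_ , Qy)} x≈y → ≃⇒≈ ∘ restrict-cong P g-maps g-uc Qx Qy (≈⇒≃ ∘ x≈y)
    ; inverse   =
      (λ {(_ , Qy)} {(_ , Px)} x≈gy j → ≃⇒≈ (≃-trans
        (restrict-cong Q f-maps f-uc Px (g-maps Qy) (≈⇒≃ ∘ x≈gy) j) (f∘g≃id Qy j))) ,
      (λ {(_ , Px)} {(_ , Qy)} y≈fx i → ≃⇒≈ (≃-trans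
        (restrict-cong P g-maps g-uc Qy (f-maps Px) (≈⇒≃ ∘ y≈fx) i) (g∘f≃id Px i)))
    }
  ; to-continuous   = restrict-continuous Q f-maps f-uc
  ; from-continuous = restrict-continuous P g-maps g-uc
  }

Homeomorphism-trans : ∀ {l m n} {P : Pred (Vector ℝ l) 0ℓ} {Q : Pred (Vector ℝ m) 0ℓ} {R : Pred (Vector ℝ n) 0ℓ} →
                      Homeomorphism P Q → Homeomorphism Q R → Homeomorphism P R
Homeomorphism-trans P↔Q Q↔R = record
  { bijection       = inverse P↔Q.bijection Q↔R.bijection
  ; to-continuous   = λ x ε 0<ε →
      let η , 0<η , Q↔R-within = Q↔R.to-continuous (P↔Q.to x) ε 0<ε
          δ , 0<δ , P↔Q-within = P↔Q.to-continuous x η 0<η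
      in δ , 0<δ , λ y within → Q↔R-within (P↔Q.to y) (P↔Q-within y within)
  ; from-continuous = λ z ε 0<ε →
      let η , 0<η , P↔Q-within = P↔Q.from-continuous (Q↔R.from z) ε 0<ε
          δ , 0<δ , Q↔R-within = Q↔R.from-continuous z η 0<η
      in δ , 0<δ , λ y within → P↔Q-within (Q↔R.from y) (Q↔R-within y within)
  }
  where
  module P↔Q = Homeomorphism P↔Q
  module Q↔R = Homeomorphism Q↔R

-- Realizations of clique complexes

record Realization {n} (G : Graph n) (x : Vector ℝ n) : Set where
  field
    nonneg   : ∀ i → 0ℝ ≲ x i
    total    : Σℝ x ≃ 1ℝ
    disjoint : ∀ {i j} → i ≢ j → adj G i j ≡ false → Disjoint (x i) (x j)

open Realization

module _ {n} {G : Graph n} where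

  InRealization⇒Realization : ∀ x → InRealization (cliqueComplex G) x → Realization G x
  InRealization⇒Realization x (0≤x , Σx≈1 , positive⇒clique) = record
    { nonneg   = λ i → ≤⇒≲ (0≤x i)
    ; total    = ≈⇒≃ Σx≈1
    ; disjoint = λ {i} {j} i≢j ij (0<xᵢ , 0<xⱼ) → true≢false
        (positive⇒clique (⁅ i ⁆ ∪ ⁅ j ⁆) (positive 0<xᵢ 0<xⱼ)
          i j (x∈p∪q⁺ (inj₁ (x∈⁅x⁆ i))) (x∈p∪q⁺ (inj₂ (x∈⁅x⁆ j))) i≢j) ij
    }
    where
    positive : ∀ {i j} → Positive (x i) → Positive (x j) → ∀ k → k ∈ ⁅ i ⁆ ∪ ⁅ j ⁆ → 0ℝ < x k
    positive {i} {j} 0<xᵢ 0<xⱼ k k∈ij with x∈p∪q⁻ ⁅ i ⁆ ⁅ j ⁆ k∈ij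
    ... | inj₁ k∈i with refl ← x∈⁅y⁆⇒x≡y i k∈i = Positive⇒0< 0<xᵢ
    ... | inj₂ k∈j with refl ← x∈⁅y⁆⇒x≡y j k∈j = Positive⇒0< 0<xⱼ

  Realization⇒InRealization : ∀ {x} → Realization G x → InRealization (cliqueComplex G) x
  Realization⇒InRealization {x} real = (λ i → ≲⇒≤ (nonneg real i)) , ≃⇒≈ (total real) , positive⇒clique
    where
    positive⇒clique : ∀ τ → (∀ i → i ∈ τ → 0ℝ < x i) → IsClique G τ
    positive⇒clique τ positive i j i∈τ j∈τ i≢j with adj G i j in ij
    ... | true  = refl
    ... | false = contradiction (0<⇒Positive (positive i i∈τ) , 0<⇒Positive (positive j j∈τ)) (disjoint real i≢j ij)

Σ-when-== : ∀ {n} (u : Fin n) z → Σℝ (λ i → z when (i == u)) ≃ z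
Σ-when-== {suc n} zero    z = ≃-trans (+-cong ≃-refl (sum-replicate-zero n)) (+-identityʳ z)
Σ-when-== {suc n} (suc u) z = ≃-trans (+-identityˡ _) (Σ-when-== u z)

half+half : ∀ x → half x + half x ≃ x
half+half x = ≗⇒≃ λ n → ½+½ (seq x n)

x+z⊓y+z : ∀ x y z → (x + z) ⊓ (y + z) ≃ x ⊓ y + z
x+z⊓y+z x y z = ≗⇒≃ λ n → sym (+-distribʳ-⊓ (seq z n) (seq x n) (seq y n))

≲⇒0≲- : ∀ {x y} → y ≲ x → 0ℝ ≲ x + - y
≲⇒0≲- {x} {y} y≲x = mk≲ λ {e} 0<e → Eventually-map
  (λ n yₙ<xₙ+e → <-resp-difference yₙ<xₙ+e (identity (seq x n) (seq y n) e)) (eventually-below y≲x 0<e)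
  where
  identity : ∀ p q e → (p ℚ.+ ℚ.- q ℚ.+ e) ℚ.- 0ℚ ≡ (p ℚ.+ e) ℚ.- q
  identity = solve-∀ ℚ-ring

x+-y≲x : ∀ {x y} → 0ℝ ≲ y → x + - y ≲ x
x+-y≲x {x} {y} 0≲y = mk≲ λ {e} 0<e → Eventually-map
  (λ n 0<yₙ+e → <-resp-difference 0<yₙ+e (identity (seq x n) (seq y n) e)) (eventually-below 0≲y 0<e)
  where
  identity : ∀ p q e → (p ℚ.+ e) ℚ.- (p ℚ.+ ℚ.- q) ≡ (q ℚ.+ e) ℚ.- 0ℚ
  identity = solve-∀ ℚ-ring

Disjoint-when : ∀ b {x y} → (b ≡ true → Disjoint x y) → Disjoint (x when b) y
Disjoint-when true  x∥y = x∥y refl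
Disjoint-when false _   = λ (0<0 , _) → ¬Positive-0ℝ 0<0

excess-Disjoint : ∀ x y → Disjoint (x + - (x ⊓ y)) (y + - (x ⊓ y))
excess-Disjoint x y = pointwise⇒Disjoint λ n → not-both (seq x n) (seq y n)
  where
  p-p≯0 : ∀ p {q} → q ≡ p → ¬ 0ℚ ℚ.< p ℚ.- q
  p-p≯0 p refl 0<p-p = ℚ.<-irrefl refl (subst (0ℚ ℚ.<_) (ℚ.+-inverseʳ p) 0<p-p)
  not-both : ∀ p q → ¬ (0ℚ ℚ.< p ℚ.- p ℚ.⊓ q × 0ℚ ℚ.< q ℚ.- p ℚ.⊓ q)
  not-both p q (0<p-p⊓q , 0<q-p⊓q) with ℚ.⊓-sel p q
  ... | inj₁ p⊓q≡p = p-p≯0 p p⊓q≡p 0<p-p⊓q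
  ... | inj₂ p⊓q≡q = p-p≯0 q p⊓q≡q 0<q-p⊓q

module SubdivisionHomeomorphism {n} (G : Graph n) (u v : Fin n) (uv : adj G u v ≡ true) where
  open Subdivision G u v uv

  flatten : Vector ℝ (suc n) → Vector ℝ n
  flatten x i = x (suc i) + half (x zero) when onEdge i

  minimum : Vector ℝ n → ℝ
  minimum y = y u ⊓ y v

  lift : Vector ℝ n → Vector ℝ (suc n)
  lift y zero    = minimum y + minimum y
  lift y (suc i) = y i + - (minimum y when onEdge i)

  private
    when-onEdge : ∀ z i → z when onEdge i ≃ z when (i == u) + z when (i == v)
    when-onEdge z i with edgeView i
    ... | at-u rewrite ==-refl u | ≢⇒==-false u≢v = ≃-sym (+-identityʳ z)
    ... | at-v rewrite ==-refl v | ≢⇒==-false (u≢v ∘ sym) = ≃-sym (+-identityˡ z)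
    ... | away i≢u i≢v rewrite ≢⇒==-false i≢u | ≢⇒==-false i≢v = ≃-sym (+-identityˡ 0ℝ)

    Σ-when-onEdge : ∀ z → Σℝ (λ i → z when onEdge i) ≃ z + z
    Σ-when-onEdge z = begin
      Σℝ (λ i → z when onEdge i)
        ≈⟨ sum-cong-≋ (when-onEdge z) ⟩
      Σℝ (λ i → z when (i == u) + z when (i == v))
        ≈⟨ ∑-distrib-+ (λ i → z when (i == u)) (λ i → z when (i == v)) ⟩
      Σℝ (λ i → z when (i == u)) + Σℝ (λ i → z when (i == v))
        ≈⟨ +-cong (Σ-when-== u z) (Σ-when-== v z) ⟩
      z + z ∎
      where open ≃-Reasoning

    Σ-flatten : ∀ x → Σℝ (flatten x) ≃ Σℝ x
    Σ-flatten x = begin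
      Σℝ (flatten x)                                           ≈⟨ ∑-distrib-+ (x ∘ suc) _ ⟩
      Σℝ (x ∘ suc) + Σℝ (λ i → half (x zero) when onEdge i)    ≈⟨ +-cong ≃-refl (Σ-when-onEdge (half (x zero))) ⟩
      Σℝ (x ∘ suc) + (half (x zero) + half (x zero))           ≈⟨ +-cong ≃-refl (half+half (x zero)) ⟩
      Σℝ (x ∘ suc) + x zero                                    ≈⟨ +-comm (Σℝ (x ∘ suc)) (x zero) ⟩
      Σℝ x                                                     ∎
      where open ≃-Reasoning

    -‿when : ∀ b x → - (x when b) ≃ (- x) when b
    -‿when true  x = ≃-refl
    -‿when false x = ≗⇒≃ λ _ → refl

    Σ-lift : ∀ y → Σℝ (lift y) ≃ Σℝ y
    Σ-lift y = begin
      m + m + Σℝ (λ i → y i + - (m when onEdge i))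
        ≈⟨ +-cong ≃-refl (sum-cong-≋ λ i → +-cong ≃-refl (-‿when (onEdge i) m)) ⟩
      m + m + Σℝ (λ i → y i + (- m) when onEdge i)
        ≈⟨ +-cong ≃-refl (∑-distrib-+ y (λ i → (- m) when onEdge i)) ⟩
      m + m + (Σℝ y + Σℝ (λ i → (- m) when onEdge i))
        ≈⟨ +-cong ≃-refl (+-cong ≃-refl (Σ-when-onEdge (- m))) ⟩
      m + m + (Σℝ y + (- m + - m))
        ≈⟨ ≗⇒≃ (λ k → cancel (seq m k) (seq (Σℝ y) k)) ⟩
      Σℝ y ∎
      where
      open ≃-Reasoning
      m : ℝ
      m = minimum y
      cancel : ∀ p q → p ℚ.+ p ℚ.+ (q ℚ.+ (ℚ.- p ℚ.+ ℚ.- p)) ≡ q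
      cancel = solve-∀ ℚ-ring

    not-nearby : ∀ {i j} → onEdge j ≡ true → i ≢ j → adj G i j ≡ false → nearby i ≡ false
    not-nearby {i} {j} onEdge-j i≢j ij with edgeView j | edgeView i
    ... | at-u | at-u = contradiction refl i≢j
    ... | at-u | at-v = contradiction ij (true≢false (adj-sym G uv))
    ... | at-u | away i≢u i≢v = ≡.trans (nearby-away i≢u i≢v)
                                        (cong (_∧ (adj G v i ∧ true)) (≡.trans (symm G u i) ij))
    ... | at-v | at-u = contradiction ij (true≢false uv)
    ... | at-v | at-v = contradiction refl i≢j
    ... | at-v | away i≢u i≢v = ≡.trans (nearby-away i≢u i≢v)
                                        (∧-falseʳ (adj G u i) (cong (_∧ true) (≡.trans (symm G v i) ij)))
    ... | away j≢u j≢v | _ = contradiction (onEdge-away j≢u j≢v) (true≢false onEdge-j)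

    flatten-Realization : ∀ {x} → Realization subdivision x → Realization G (flatten x)
    flatten-Realization {x} real = record
      { nonneg   = λ i → 0≲x+y (nonneg real (suc i)) (0≲when (onEdge i) (0≲half (nonneg real zero)))
      ; total    = ≃-trans (Σ-flatten x) (total real)
      ; disjoint = λ {i} {j} i≢j ij → let ji = ≡.trans (symm G j i) ij in Disjoint-+
          (Disjoint-sym (Disjoint-+
            (disjoint real (i≢j ∘ sym ∘ Fin.suc-injective) (cong (_∧ not (isEdge j i)) ji))
            (bump∥old (i≢j ∘ sym) ji)))
          (Disjoint-sym (Disjoint-+
            (Disjoint-sym (bump∥old i≢j ij))
            (Disjoint-when (onEdge j) λ onEdge-j → Disjoint-sym (Disjoint-when (onEdge i) λ onEdge-i →
              contradiction (not-nearby onEdge-j i≢j ij) (true≢false (cong (_∨ common i) onEdge-i))))))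
      }
      where
      bump∥old : ∀ {i j} → i ≢ j → adj G i j ≡ false → Disjoint (half (x zero) when onEdge i) (x (suc j))
      bump∥old {i} {j} i≢j ij = Disjoint-when (onEdge i) λ onEdge-i → Disjoint-≲ (half≲x (nonneg real zero))
        (disjoint real (λ ()) (not-nearby onEdge-i (i≢j ∘ sym) (≡.trans (symm G j i) ij)))

    minimum∥y : ∀ {y} → Realization G y → ∀ {j} → nearby j ≡ false → Disjoint (minimum y) (y j)
    minimum∥y {y} real {j} far = by-adjacency (adj G u j) (adj G v j) refl refl
      where
      by-adjacency : ∀ a b → adj G u j ≡ a → adj G v j ≡ b → Disjoint (minimum y) (y j)
      by-adjacency false _     uj _  = Disjoint-≲ (x⊓y≲x (y u) (y v))
        (disjoint real (λ { refl → true≢false nearby-u far }) uj)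
      by-adjacency true  false _  vj = Disjoint-≲ (x⊓y≲y (y u) (y v))
        (disjoint real (λ { refl → true≢false nearby-v far }) vj)
      by-adjacency true  true  uj vj = contradiction far (true≢false (nearby-common uj vj))

    lift-ends-Disjoint : ∀ y → Disjoint (lift y (suc u)) (lift y (suc v))
    lift-ends-Disjoint y rewrite onEdge-u | onEdge-v = excess-Disjoint (y u) (y v)

    module _ {y : Vector ℝ n} (real : Realization G y) where

      0≲minimum : 0ℝ ≲ minimum y
      0≲minimum = 0≲x⊓y (nonneg real u) (nonneg real v)

      lift-nonneg : ∀ i → 0ℝ ≲ lift y i
      lift-nonneg zero = 0≲x+y 0≲minimum 0≲minimum
      lift-nonneg (suc i) with edgeView i
      ... | at-u rewrite onEdge-u = ≲⇒0≲- (x⊓y≲x (y u) (y v))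
      ... | at-v rewrite onEdge-v = ≲⇒0≲- (x⊓y≲y (y u) (y v))
      ... | away i≢u i≢v rewrite onEdge-away i≢u i≢v = ≲⇒0≲- (nonneg real i)

      lift-suc≲ : ∀ i → lift y (suc i) ≲ y i
      lift-suc≲ i = x+-y≲x (0≲when (onEdge i) 0≲minimum)

      new∥old : ∀ j → nearby j ≡ false → Disjoint (lift y zero) (lift y (suc j))
      new∥old j far = Disjoint-sym (Disjoint-≲ (lift-suc≲ j)
        (Disjoint-sym (Disjoint-+ (minimum∥y real far) (minimum∥y real far))))

      old∥old : ∀ {i j} → i ≢ j → adj G i j ≡ false → Disjoint (lift y (suc i)) (lift y (suc j))
      old∥old {i} {j} i≢j ij =
        Disjoint-≲ (lift-suc≲ i) (Disjoint-sym (Disjoint-≲ (lift-suc≲ j) (Disjoint-sym (disjoint real i≢j ij))))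

      lift-disjoint : ∀ i j → i ≢ j → adj subdivision i j ≡ false → Disjoint (lift y i) (lift y j)
      lift-disjoint zero    zero    0≢0 _ = contradiction refl 0≢0
      lift-disjoint zero    (suc j) _ far = new∥old j far
      lift-disjoint (suc i) zero    _ far = Disjoint-sym (new∥old i far)
      lift-disjoint (suc i) (suc j) i≢j far with edgeView i | edgeView j
      ... | at-u         | at-u         = contradiction refl i≢j
      ... | at-u         | at-v         = lift-ends-Disjoint y
      ... | at-v         | at-u         = Disjoint-sym (lift-ends-Disjoint y)
      ... | at-v         | at-v         = contradiction refl i≢j
      ... | away i≢u i≢v | _            = old∥old (i≢j ∘ cong suc) (≡.trans (sym (withoutEdge-away i≢u i≢v)) far)
      ... | _            | away j≢u j≢v = old∥old (i≢j ∘ cong suc) (≡.trans (sym (withoutEdge-awayʳ j≢u j≢v)) far)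

      lift-Realization : Realization subdivision (lift y)
      lift-Realization = record
        { nonneg   = lift-nonneg
        ; total    = ≃-trans (Σ-lift y) (total real)
        ; disjoint = λ {i} {j} → lift-disjoint i j
        }

    flatten∘lift : ∀ y i → flatten (lift y) i ≃ y i
    flatten∘lift y i with onEdge i
    ... | true  = ≗⇒≃ λ k → cancel (seq (y i) k) (seq (minimum y) k)
      where
      cancel : ∀ p m → (p ℚ.+ ℚ.- m) ℚ.+ ½ ℚ.* (m ℚ.+ m) ≡ p
      cancel = solve-∀ ℚ-ring
    ... | false = ≗⇒≃ λ k → cancel (seq (y i) k)
      where
      cancel : ∀ p → (p ℚ.+ ℚ.- 0ℚ) ℚ.+ 0ℚ ≡ p
      cancel = solve-∀ ℚ-ring

    minimum-flatten : ∀ {x} → Realization subdivision x → minimum (flatten x) ≃ half (x zero)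
    minimum-flatten {x} real rewrite onEdge-u | onEdge-v = begin
      (x (suc u) + h) ⊓ (x (suc v) + h)   ≈⟨ x+z⊓y+z (x (suc u)) (x (suc v)) h ⟩
      x (suc u) ⊓ x (suc v) + h           ≈⟨ +-cong ends-⊓ ≃-refl ⟩
      0ℝ + h                              ≈⟨ +-identityˡ h ⟩
      h                                   ∎
      where
      open ≃-Reasoning
      h : ℝ
      h = half (x zero)
      ends-⊓ : x (suc u) ⊓ x (suc v) ≃ 0ℝ
      ends-⊓ = Disjoint⇒⊓≃0 (nonneg real (suc u)) (nonneg real (suc v))
        (disjoint real (u≢v ∘ Fin.suc-injective) withoutEdge-uv)

    lift∘flatten : ∀ {x} → Realization subdivision x → ∀ i → lift (flatten x) i ≃ x i
    lift∘flatten {x} real zero = ≃-trans (+-cong (minimum-flatten real) (minimum-flatten real)) (half+half (x zero))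
    lift∘flatten {x} real (suc i) = begin
      flatten x i + - (minimum (flatten x) when onEdge i)
        ≈⟨ +-cong ≃-refl (-‿cong (when-cong (onEdge i) (minimum-flatten real))) ⟩
      x (suc i) + bump + - bump
        ≈⟨ ≗⇒≃ (λ k → cancel (seq (x (suc i)) k) (seq bump k)) ⟩
      x (suc i) ∎
      where
      open ≃-Reasoning
      bump : ℝ
      bump = half (x zero) when onEdge i
      cancel : ∀ p q → p ℚ.+ q ℚ.+ ℚ.- q ≡ p
      cancel = solve-∀ ℚ-ring

    flatten-uc : ∀ {P} i → UniformlyContinuous P (λ x → flatten x i)
    flatten-uc i = +-uc (coordinate-uc (suc i)) (when-uc (onEdge i) (half-uc (coordinate-uc zero)))

    minimum-uc : ∀ {P} → UniformlyContinuous P minimum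
    minimum-uc = ⊓-uc (coordinate-uc u) (coordinate-uc v)

    lift-uc : ∀ {P} i → UniformlyContinuous P (λ y → lift y i)
    lift-uc zero    = +-uc minimum-uc minimum-uc
    lift-uc (suc i) = +-uc (coordinate-uc i) (neg-uc (when-uc (onEdge i) minimum-uc))

  subdivision-homeomorphism :
    Homeomorphism (InRealization (cliqueComplex subdivision)) (InRealization (cliqueComplex G))
  subdivision-homeomorphism = mkHomeomorphism flatten lift
    (λ {x} x∈X′ → Realization⇒InRealization (flatten-Realization (InRealization⇒Realization x x∈X′)))
    (λ {y} y∈X → Realization⇒InRealization (lift-Realization (InRealization⇒Realization y y∈X)))
    flatten-uc lift-uc
    (λ {y} _ → flatten∘lift y) (λ {x} x∈X′ → lift∘flatten (InRealization⇒Realization x x∈X′))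

-- The boundary of the cross-polytope

0≲x*x : ∀ x → 0ℝ ≲ x * x
0≲x*x x = pointwise⇒≲ λ n → 0≤p*p (seq x n)

negPart posPart : ℝ → ℝ
negPart x = - (x ⊓ 0ℝ)
posPart x = negPart (- x)

signedPart : Fin 2 → ℝ → ℝ
signedPart 0F = posPart
signedPart 1F = negPart

signedSquare : Fin 2 → ℝ → ℝ
signedSquare s x = signedPart s x * signedPart s x

data Parts (p : ℚ) : ℚ → ℚ → Set where
  nonnegative : Parts p p 0ℚ
  nonpositive : Parts p 0ℚ (ℚ.- p)

parts : ∀ x n → Parts (seq x n) (seq (posPart x) n) (seq (negPart x) n)
parts x n = by-sign (seq x n) (ℚ.≤-total 0ℚ (seq x n))
  where
  by-sign : ∀ p → 0ℚ ℚ.≤ p ⊎ p ℚ.≤ 0ℚ → Parts p (ℚ.- (ℚ.- p ℚ.⊓ 0ℚ)) (ℚ.- (p ℚ.⊓ 0ℚ))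
  by-sign p (inj₁ 0≤p) = subst₂ (Parts p)
    (sym (≡.trans (cong ℚ.-_ (ℚ.p≤q⇒p⊓q≡p (ℚ.neg-antimono-≤ 0≤p))) (neg-involutive p)))
    (cong ℚ.-_ (sym (ℚ.p≥q⇒p⊓q≡q 0≤p)))
    nonnegative
  by-sign p (inj₂ p≤0) = subst₂ (Parts p)
    (cong ℚ.-_ (sym (ℚ.p≥q⇒p⊓q≡q (ℚ.neg-antimono-≤ p≤0))))
    (cong ℚ.-_ (sym (ℚ.p≤q⇒p⊓q≡p p≤0)))
    nonpositive

0≲signedPart : ∀ s x → 0ℝ ≲ signedPart s x
0≲signedPart 0F x = pointwise⇒≲ λ n → ℚ.neg-antimono-≤ (ℚ.p⊓q≤q (ℚ.- seq x n) 0ℚ)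
0≲signedPart 1F x = pointwise⇒≲ λ n → ℚ.neg-antimono-≤ (ℚ.p⊓q≤q (seq x n) 0ℚ)

∣signedPart∣≤∣x∣ : ∀ s x n → ℚ.∣ seq (signedPart s x) n ∣ ℚ.≤ ℚ.∣ seq x n ∣
∣signedPart∣≤∣x∣ 0F x n with seq (posPart x) n | seq (negPart x) n | parts x n
... | _ | _ | nonnegative = ℚ.≤-refl
... | _ | _ | nonpositive = ℚ.0≤∣p∣ (seq x n)
∣signedPart∣≤∣x∣ 1F x n with seq (posPart x) n | seq (negPart x) n | parts x n
... | _ | _ | nonnegative = ℚ.0≤∣p∣ (seq x n)
... | _ | _ | nonpositive = ℚ.≤-reflexive (ℚ.∣-p∣≡∣p∣ (seq x n))

posPart-negPart : ∀ x → posPart x + - negPart x ≃ x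
posPart-negPart x = ≗⇒≃ λ n → difference (parts x n)
  where
  difference : ∀ {p q r} → Parts p q r → q ℚ.+ ℚ.- r ≡ p
  difference nonnegative = ℚ.+-identityʳ _
  difference {p} nonpositive = 0--p≡p p
    where
    0--p≡p : ∀ p → 0ℚ ℚ.+ ℚ.- (ℚ.- p) ≡ p
    0--p≡p = solve-∀ ℚ-ring

signedSquare-+ : ∀ x → signedSquare 0F x + signedSquare 1F x ≃ x * x
signedSquare-+ x = ≗⇒≃ λ n → squares (parts x n)
  where
  squares : ∀ {p q r} → Parts p q r → q ℚ.* q ℚ.+ r ℚ.* r ≡ p ℚ.* p
  squares nonnegative = ℚ.+-identityʳ _
  squares {p} nonpositive = ≡.trans (ℚ.+-identityˡ _) (-p*-p≡p*p p)

signedSquare-Disjoint : ∀ {r s} x → r ≢ s → Disjoint (signedSquare r x) (signedSquare s x)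
signedSquare-Disjoint {0F} {0F} x 0≢0 = contradiction refl 0≢0
signedSquare-Disjoint {0F} {1F} x _   = pointwise⇒Disjoint λ n → not-both (parts x n)
  where
  not-both : ∀ {p q r} → Parts p q r → ¬ (0ℚ ℚ.< q ℚ.* q × 0ℚ ℚ.< r ℚ.* r)
  not-both nonnegative (_ , 0<0) = ℚ.<-irrefl refl 0<0
  not-both nonpositive (0<0 , _) = ℚ.<-irrefl refl 0<0
signedSquare-Disjoint {1F} {0F} x _   = Disjoint-sym (signedSquare-Disjoint {0F} {1F} x λ ())
signedSquare-Disjoint {1F} {1F} x 1≢1 = contradiction refl 1≢1

negPart-cong : ∀ {x y} → x ≃ y → negPart x ≃ negPart y
negPart-cong x≃y = -‿cong (⊓-cong x≃y ≃-refl)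

negPart-difference : ∀ {x y} → x ⊓ y ≃ 0ℝ → negPart (x + - y) ≃ y
negPart-difference {x} {y} x⊓y≃0 = begin
  - ((x + - y) ⊓ 0ℝ)         ≈⟨ negate (⊓-cong ≃-refl (≗⇒≃ λ n → sym (ℚ.+-inverseʳ (seq y n)))) ⟩
  - ((x + - y) ⊓ (y + - y))  ≈⟨ negate (x+z⊓y+z x y (- y)) ⟩
  - (x ⊓ y + - y)            ≈⟨ negate (+-cong x⊓y≃0 ≃-refl) ⟩
  - (0ℝ + - y)               ≈⟨ ≗⇒≃ (λ n → -[0-p]≡p (seq y n)) ⟩
  y                          ∎
  where
  open ≃-Reasoning
  negate : ∀ {x y} → x ≃ y → - x ≃ - y
  negate = -‿cong
  -[0-p]≡p : ∀ p → ℚ.- (0ℚ ℚ.+ ℚ.- p) ≡ p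
  -[0-p]≡p = solve-∀ ℚ-ring

posPart-difference : ∀ {x y} → x ⊓ y ≃ 0ℝ → posPart (x + - y) ≃ x
posPart-difference {x} {y} x⊓y≃0 = begin
  negPart (- (x + - y)) ≈⟨ negPart-cong (≗⇒≃ λ n → -[p-q]≡q-p (seq x n) (seq y n)) ⟩
  negPart (y + - x)     ≈⟨ negPart-difference y⊓x≃0 ⟩
  x                     ∎
  where
  open ≃-Reasoning
  y⊓x≃0 : y ⊓ x ≃ 0ℝ
  y⊓x≃0 = ≃-trans (≗⇒≃ λ n → ℚ.⊓-comm (seq y n) (seq x n)) x⊓y≃0
  -[p-q]≡q-p : ∀ p q → ℚ.- (p ℚ.+ ℚ.- q) ≡ q ℚ.+ ℚ.- p
  -[p-q]≡q-p = solve-∀ ℚ-ring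

Σ-combine : ∀ n (x : Vector ℝ (n ℕ.* 2)) → Σℝ {n} (λ k → x (combine k 0F) + x (combine k 1F)) ≃ Σℝ x
Σ-combine zero    x = ≃-refl
Σ-combine (suc n) x = ≃-trans (+-cong ≃-refl (Σ-combine n (λ i → x (suc (suc i))))) (+-assoc (x 0F) (x 1F) _)

==-true⇒≡ : ∀ {n} {i j : Fin n} → (i == j) ≡ true → i ≡ j
==-true⇒≡ {i = i} {j} _ with i Fin.≟ j
==-true⇒≡ _ | yes i≡j = i≡j

not-false : ∀ {b} → not b ≡ false → b ≡ true
not-false {true} _ = refl

-- The vertices of the cross-polytope are ± the unit vectors.
module CrossPolytope (n : ℕ) where

  vertex : Fin n → Fin 2 → Fin (n ℕ.* 2)
  vertex = combine

  axis : Fin (n ℕ.* 2) → Fin n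
  axis = quotient 2

  side : Fin (n ℕ.* 2) → Fin 2
  side = remainder {n} 2

  crossPolytope : Graph (n ℕ.* 2)
  crossPolytope = record
    { adj    = λ i j → not (axis i == axis j)
    ; symm   = λ i j → cong not (==-sym (axis i) (axis j))
    ; irrefl = λ i → cong not (==-refl (axis i))
    }

open CrossPolytope using (crossPolytope)

sphere-bounded : ∀ {d} z → Sphere d z → ∀ i → Eventually λ n → ℚ.∣ seq (z i) n ∣ ℚ.≤ fromℕ 2
sphere-bounded z Σz²≈1 i = Eventually-map
  (λ n zᵢ²<4 → ℚ.<⇒≤ (square-cancel-< (fromℕ-mono-≤ {0} {2} ℕ.z≤n)
    (subst (ℚ._< fromℕ 4) (sym (∣p∣*∣p∣≡p*p (seq (z i) n))) zᵢ²<4)))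
  (eventually-below zᵢ²≲1 {fromℕ 3} (0<fromℕ[1+n] 2))
  where
  zᵢ²≲1 : z i * z i ≲ 1ℝ
  zᵢ²≲1 = ≲-trans (term≲Σ (λ i → 0≲x*x (z i)) i) (≃⇒≲ (≈⇒≃ Σz²≈1))

module CrossPolytopeHomeomorphism (d : ℕ) where

  open CrossPolytope (suc d) using (vertex; axis; side)

  signedRoots : Vector ℝ (suc d ℕ.* 2) → Vector ℝ (suc d)
  signedRoots x k = √ (x (vertex k 0F)) + - √ (x (vertex k 1F))

  splitSquares : Vector ℝ (suc d) → Vector ℝ (suc d ℕ.* 2)
  splitSquares z i = signedSquare (side i) (z (axis i))

  private
    G : Graph (suc d ℕ.* 2)
    G = crossPolytope (suc d)

    axis-vertex : ∀ k s → axis (vertex k s) ≡ k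
    axis-vertex k s = cong proj₁ (Fin.remQuot-combine k s)

    side-vertex : ∀ k s → side (vertex k s) ≡ s
    side-vertex k s = cong proj₂ (Fin.remQuot-combine k s)

    splitSquares-vertex : ∀ z k s → splitSquares z (vertex k s) ≡ signedSquare s (z k)
    splitSquares-vertex z k s = cong₂ (λ s k → signedSquare s (z k)) (side-vertex k s) (axis-vertex k s)

    module _ {x : Vector ℝ (suc d ℕ.* 2)} (real : Realization G x) where

      √-Positive⁻ : ∀ i → Positive (√ (x i)) → Positive (x i)
      √-Positive⁻ i 0<√xᵢ = Positive-≲
        (≃⇒≲ (≃-trans (√x*√x≃abs (x i)) (0≲x⇒abs≃x (nonneg real i)))) (Positive-square 0<√xᵢ)

      √-antipodes : ∀ k → √ (x (vertex k 0F)) ⊓ √ (x (vertex k 1F)) ≃ 0ℝ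
      √-antipodes k = Disjoint⇒⊓≃0 (0≲√x (x (vertex k 0F))) (0≲√x (x (vertex k 1F))) λ (0<√x₊ , 0<√x₋) →
        disjoint real antipodes-distinct antipodes-nonadjacent
          (√-Positive⁻ (vertex k 0F) 0<√x₊ , √-Positive⁻ (vertex k 1F) 0<√x₋)
        where
        antipodes-distinct : vertex k 0F ≢ vertex k 1F
        antipodes-distinct eq with () ← Fin.combine-injectiveʳ k 0F k 1F eq
        antipodes-nonadjacent : adj G (vertex k 0F) (vertex k 1F) ≡ false
        antipodes-nonadjacent = cong not (≡.trans (cong₂ _==_ (axis-vertex k 0F) (axis-vertex k 1F)) (==-refl k))

      signedPart-signedRoots : ∀ k s → signedPart s (signedRoots x k) ≃ √ (x (vertex k s))
      signedPart-signedRoots k 0F = posPart-difference (√-antipodes k)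
      signedPart-signedRoots k 1F = negPart-difference (√-antipodes k)

      signedSquare-signedRoots : ∀ k s → signedSquare s (signedRoots x k) ≃ x (vertex k s)
      signedSquare-signedRoots k s = begin
        signedSquare s (signedRoots x k)          ≈⟨ *-cong signedPart≃√x signedPart≃√x ⟩
        √ (x (vertex k s)) * √ (x (vertex k s))   ≈⟨ √x*√x≃abs (x (vertex k s)) ⟩
        abs (x (vertex k s))                      ≈⟨ 0≲x⇒abs≃x (nonneg real (vertex k s)) ⟩
        x (vertex k s)                            ∎
        where
        open ≃-Reasoning
        signedPart≃√x : signedPart s (signedRoots x k) ≃ √ (x (vertex k s))
        signedPart≃√x = signedPart-signedRoots k s

      signedRoots-sphere : Σℝ (λ k → signedRoots x k * signedRoots x k) ≃ 1ℝ
      signedRoots-sphere = begin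
        Σℝ (λ k → signedRoots x k * signedRoots x k)
          ≈⟨ sum-cong-≋ (λ k → ≃-trans (≃-sym (signedSquare-+ (signedRoots x k)))
               (+-cong (signedSquare-signedRoots k 0F) (signedSquare-signedRoots k 1F))) ⟩
        Σℝ (λ k → x (vertex k 0F) + x (vertex k 1F))
          ≈⟨ Σ-combine (suc d) x ⟩
        Σℝ x
          ≈⟨ total real ⟩
        1ℝ ∎
        where open ≃-Reasoning

      splitSquares∘signedRoots : ∀ i → splitSquares (signedRoots x) i ≃ x i
      splitSquares∘signedRoots i with k , s , refl ← Fin.combine-surjective {suc d} {2} i =
        ≃-trans (≡⇒≃ (splitSquares-vertex (signedRoots x) k s)) (signedSquare-signedRoots k s)

    splitSquares-Disjoint : ∀ z {i j} → i ≢ j → adj G i j ≡ false → Disjoint (splitSquares z i) (splitSquares z j)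
    splitSquares-Disjoint z {i} {j} i≢j ij =
      subst (λ k → Disjoint (splitSquares z i) (signedSquare (side j) (z k))) axes-agree
        (signedSquare-Disjoint (z (axis i)) sides-differ)
      where
      axes-agree : axis i ≡ axis j
      axes-agree = ==-true⇒≡ (not-false ij)
      sides-differ : side i ≢ side j
      sides-differ sides-agree = i≢j (begin
        i                         ≡⟨ Fin.combine-remQuot {suc d} 2 i ⟨
        vertex (axis i) (side i)  ≡⟨ cong₂ vertex axes-agree sides-agree ⟩
        vertex (axis j) (side j)  ≡⟨ Fin.combine-remQuot {suc d} 2 j ⟩
        j                         ∎)
        where open ≡.≡-Reasoning

    splitSquares-Realization : ∀ {z} → Sphere d z → Realization G (splitSquares z)
    splitSquares-Realization {z} Σz²≈1 = record
      { nonneg   = λ i → 0≲x*x _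
      ; total    = begin
          Σℝ (splitSquares z)
            ≈⟨ Σ-combine (suc d) (splitSquares z) ⟨
          Σℝ (λ k → splitSquares z (vertex k 0F) + splitSquares z (vertex k 1F))
            ≈⟨ sum-cong-≋ (λ k → ≃-trans (≡⇒≃ (cong₂ _+_ (splitSquares-vertex z k 0F) (splitSquares-vertex z k 1F)))
                 (signedSquare-+ (z k))) ⟩
          Σℝ (λ k → z k * z k)
            ≈⟨ ≈⇒≃ Σz²≈1 ⟩
          1ℝ ∎
      ; disjoint = splitSquares-Disjoint z
      }
      where open ≃-Reasoning

    signedRoots∘splitSquares : ∀ z k → signedRoots (splitSquares z) k ≃ z k
    signedRoots∘splitSquares z k = begin
      √ (splitSquares z (vertex k 0F)) + - √ (splitSquares z (vertex k 1F))
        ≡⟨ cong₂ (λ x y → √ x + - √ y) (splitSquares-vertex z k 0F) (splitSquares-vertex z k 1F) ⟩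
      √ (signedSquare 0F (z k)) + - √ (signedSquare 1F (z k))
        ≈⟨ +-cong (√-square 0F) (-‿cong (√-square 1F)) ⟩
      posPart (z k) + - negPart (z k)
        ≈⟨ posPart-negPart (z k) ⟩
      z k ∎
      where
      open ≃-Reasoning
      √-square : ∀ s → √ (signedSquare s (z k)) ≃ signedPart s (z k)
      √-square s = ≃-trans (√[x*x]≃abs (signedPart s (z k))) (0≲x⇒abs≃x (0≲signedPart s (z k)))

    signedRoots-uc : ∀ {P} k → UniformlyContinuous P (λ x → signedRoots x k)
    signedRoots-uc k = +-uc (√-uc (coordinate-uc (vertex k 0F))) (neg-uc (√-uc (coordinate-uc (vertex k 1F))))

    signedPart-uc : ∀ {m} {P : Pred (Vector ℝ m) 0ℓ} {f} s →
                    UniformlyContinuous P f → UniformlyContinuous P (λ x → signedPart s (f x))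
    signedPart-uc 0F f-uc = neg-uc (⊓-uc (neg-uc f-uc) (const-uc 0ℝ))
    signedPart-uc 1F f-uc = neg-uc (⊓-uc f-uc (const-uc 0ℝ))

    splitSquares-uc : ∀ i → UniformlyContinuous (Sphere d) (λ z → splitSquares z i)
    splitSquares-uc i = square-uc (0<fromℕ[1+n] 1)
      (λ {z} z∈S → Eventually-map
        (λ n → ℚ.≤-trans (∣signedPart∣≤∣x∣ (side i) (z (axis i)) n)) (sphere-bounded z z∈S (axis i)))
      (signedPart-uc (side i) (coordinate-uc (axis i)))

  crossPolytope-homeomorphism : Homeomorphism (InRealization (cliqueComplex G)) (Sphere d)
  crossPolytope-homeomorphism = mkHomeomorphism signedRoots splitSquares
    (λ {x} x∈X → ≃⇒≈ (signedRoots-sphere (InRealization⇒Realization x x∈X)))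
    (λ {z} z∈S → Realization⇒InRealization (splitSquares-Realization {z} z∈S))
    signedRoots-uc splitSquares-uc
    (λ {z} _ → signedRoots∘splitSquares z) (λ {x} x∈X → splitSquares∘signedRoots (InRealization⇒Realization x x∈X))

-- Flag 3-spheres with a marked facet

-- The f-polynomial of a (4 + k)-gon.
polygon-poly : ℕ → ℚ → ℚ
polygon-poly k t = S⁰-poly t ℚ.* S⁰-poly t ℚ.+ fromℕ k ℚ.* (t ℚ.+ t ℚ.* t)

polygon-poly-zero : ∀ t → polygon-poly 0 t ≡ S⁰-poly t ℚ.* S⁰-poly t
polygon-poly-zero t = identity (S⁰-poly t) (t ℚ.+ t ℚ.* t)
  where
  identity : ∀ s w → s ℚ.* s ℚ.+ 0ℚ ℚ.* w ≡ s ℚ.* s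
  identity = solve-∀ ℚ-ring

polygon-poly-suc : ∀ k t → polygon-poly (suc k) t ≡ polygon-poly k t ℚ.+ (t ℚ.+ t ℚ.* t) ℚ.* 1ℚ
polygon-poly-suc k t = ≡.trans
  (cong (λ q → S⁰-poly t ℚ.* S⁰-poly t ℚ.+ q ℚ.* (t ℚ.+ t ℚ.* t)) (fromℕ-suc k))
  (identity (S⁰-poly t) (t ℚ.+ t ℚ.* t) (fromℕ k))
  where
  identity : ∀ s w q → s ℚ.* s ℚ.+ (1ℚ ℚ.+ q) ℚ.* w ≡ s ℚ.* s ℚ.+ q ℚ.* w ℚ.+ w ℚ.* 1ℚ
  identity = solve-∀ ℚ-ring

-- d² γ(e/d) for γ(t) = 1 + A t + B t².
homogenized : ℚ → ℚ → ℚ → ℚ → ℚ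
homogenized A B d e = d ℚ.* d ℚ.+ (A ℚ.* (e ℚ.* d) ℚ.+ B ℚ.* (e ℚ.* e))

-- Since h(t) = (1+t)⁴ γ(t/(1+t)²), the f-polynomial (1+t)⁴ h(t/(1+t)) is
-- (1+2t)⁴ γ((t+t²)/(1+2t)²).
fγ : ℕ → ℕ → ℚ → ℚ
fγ a b t = homogenized (fromℕ a) (fromℕ b) (S⁰-poly t ℚ.* S⁰-poly t) (t ℚ.+ t ℚ.* t)

fγ-suc : ∀ a b k t → fγ (suc a) (b ℕ.+ k) t ≡ fγ a b t ℚ.+ (t ℚ.+ t ℚ.* t) ℚ.* polygon-poly k t
fγ-suc a b k t = ≡.trans
  (cong₂ (λ A B → homogenized A B (S⁰-poly t ℚ.* S⁰-poly t) (t ℚ.+ t ℚ.* t)) (fromℕ-suc a) (ι-homo-+ (+ b) (+ k)))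
  (identity (S⁰-poly t ℚ.* S⁰-poly t) (t ℚ.+ t ℚ.* t) (fromℕ a) (fromℕ b) (fromℕ k))
  where
  identity : ∀ d w a b k → d ℚ.* d ℚ.+ ((1ℚ ℚ.+ a) ℚ.* (w ℚ.* d) ℚ.+ (b ℚ.+ k) ℚ.* (w ℚ.* w)) ≡
    d ℚ.* d ℚ.+ (a ℚ.* (w ℚ.* d) ℚ.+ b ℚ.* (w ℚ.* w)) ℚ.+ w ℚ.* (d ℚ.+ k ℚ.* w)
  identity = solve-∀ ℚ-ring

cliquePoly-crossPolytope : ∀ n (R : VertexSet n) t →
  cliquePoly t (crossPolytope n) (R ∘ CrossPolytope.axis n) ≡ S⁰-poly t ^ ∣ Vec.tabulate R ∣
cliquePoly-crossPolytope zero    R t = refl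
cliquePoly-crossPolytope (suc n) R t = on-first-axis (R zero) refl
  where
  open ≡.≡-Reasoning
  S : VertexSet (n ℕ.* 2)
  S i = R (suc (CrossPolytope.axis n i))
  A S₁ Π : ℚ
  A = cliquePoly t (tail (tail (crossPolytope (suc n)))) S
  S₁ = cliquePoly t (tail (tail (crossPolytope (suc n)))) (S ∩ everything)
  Π = S⁰-poly t ^ ∣ Vec.tabulate (R ∘ suc) ∣
  A≡Π : A ≡ Π
  A≡Π = ≡.trans
    (cliquePoly-cong t {G = tail (tail (crossPolytope (suc n)))} {crossPolytope n} (λ _ → refl) (λ _ _ _ _ → refl))
    (cliquePoly-crossPolytope n (R ∘ suc) t)
  S₁≡A : S₁ ≡ A
  S₁≡A = cliquePoly-ext t (tail (tail (crossPolytope (suc n)))) (λ i → ∧-identityʳ (S i))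
  suspend : ∀ t a → a ℚ.+ t ℚ.* a ℚ.+ t ℚ.* (a ℚ.+ 0ℚ) ≡ (1ℚ ℚ.+ (t ℚ.+ t)) ℚ.* a
  suspend = solve-∀ ℚ-ring
  on-first-axis : ∀ b → R zero ≡ b →
    cliquePoly t (crossPolytope (suc n)) (R ∘ CrossPolytope.axis (suc n)) ≡ S⁰-poly t ^ ∣ Vec.tabulate R ∣
  on-first-axis false R₀ rewrite R₀ = begin
    A ℚ.+ 0ℚ ℚ.+ 0ℚ                           ≡⟨ ℚ.+-identityʳ (A ℚ.+ 0ℚ) ⟩
    A ℚ.+ 0ℚ                                  ≡⟨ ℚ.+-identityʳ A ⟩
    A                                         ≡⟨ A≡Π ⟩
    Π                                         ∎
  on-first-axis true  R₀ rewrite R₀ = begin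
    A ℚ.+ t ℚ.* S₁ ℚ.+ t ℚ.* (S₁ ℚ.+ 0ℚ)      ≡⟨ cong (λ p → A ℚ.+ t ℚ.* p ℚ.+ t ℚ.* (p ℚ.+ 0ℚ)) S₁≡A ⟩
    A ℚ.+ t ℚ.* A ℚ.+ t ℚ.* (A ℚ.+ 0ℚ)        ≡⟨ suspend t A ⟩
    S⁰-poly t ℚ.* A                           ≡⟨ cong (S⁰-poly t ℚ.*_) A≡Π ⟩
    S⁰-poly t ℚ.* Π                           ∎

f-poly-subdivide : ∀ {n} (G : Graph n) u v (uv : adj G u v ≡ true) γ₁ γ₂ k → let open Subdivision G u v uv in
  (∀ t → linkPoly G [] t ≡ fγ γ₁ γ₂ t) → (∀ t → linkPoly G (u ∷ v ∷ []) t ≡ polygon-poly k t) →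
  ∀ t → linkPoly subdivision [] t ≡ fγ (suc γ₁) (γ₂ ℕ.+ k) t
f-poly-subdivide G u v uv γ₁ γ₂ k f-poly link-uv t = begin
  linkPoly subdivision [] t
    ≡⟨ linkPoly-oldFace [] refl refl t ⟩
  linkPoly G [] t ℚ.+ (t ℚ.+ t ℚ.* t) ℚ.* linkPoly G (u ∷ v ∷ []) t
    ≡⟨ cong₂ (λ p q → p ℚ.+ (t ℚ.+ t ℚ.* t) ℚ.* q) (f-poly t) (link-uv t) ⟩
  fγ γ₁ γ₂ t ℚ.+ (t ℚ.+ t ℚ.* t) ℚ.* polygon-poly k t
    ≡⟨ fγ-suc γ₁ γ₂ k t ⟨
  fγ (suc γ₁) (γ₂ ℕ.+ k) t ∎
  where
  open Subdivision G u v uv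
  open ≡.≡-Reasoning

record Tetrahedron {n} (G : Graph n) (a b c d : Fin n) : Set where
  field
    ab : adj G a b ≡ true
    ac : adj G a c ≡ true
    ad : adj G a d ≡ true
    bc : adj G b c ≡ true
    bd : adj G b d ≡ true
    cd : adj G c d ≡ true

Tetrahedron-reverse : ∀ {n} {G : Graph n} {a b c d} → Tetrahedron G a b c d → Tetrahedron G d c b a
Tetrahedron-reverse {G = G} T = record
  { ab = adj-sym G cd
  ; ac = adj-sym G bd
  ; ad = adj-sym G ad
  ; bc = adj-sym G bc
  ; bd = adj-sym G ac
  ; cd = adj-sym G ab
  }
  where open Tetrahedron T

module _ {n} {G : Graph n} {a b c d} (T : Tetrahedron G a b c d) where
  open Tetrahedron T

  Tetrahedron-subdivide-cd : Tetrahedron (Subdivision.subdivision G c d cd) (suc a) (suc b) (suc c) zero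
  Tetrahedron-subdivide-cd = record
    { ab = ≡.trans (withoutEdge-away (adjacent⇒≢ G ac) (adjacent⇒≢ G ad)) ab
    ; ac = ≡.trans (withoutEdge-away (adjacent⇒≢ G ac) (adjacent⇒≢ G ad)) ac
    ; ad = nearby-common (adj-sym G ac) (adj-sym G ad)
    ; bc = ≡.trans (withoutEdge-away (adjacent⇒≢ G bc) (adjacent⇒≢ G bd)) bc
    ; bd = nearby-common (adj-sym G bc) (adj-sym G bd)
    ; cd = nearby-u
    }
    where open Subdivision G c d cd

  Tetrahedron-subdivide-bc : Tetrahedron (Subdivision.subdivision G b c bc) (suc a) (suc b) zero (suc d)
  Tetrahedron-subdivide-bc = record
    { ab = ≡.trans (withoutEdge-away (adjacent⇒≢ G ab) (adjacent⇒≢ G ac)) ab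
    ; ac = nearby-common (adj-sym G ab) (adj-sym G ac)
    ; ad = ≡.trans (withoutEdge-away (adjacent⇒≢ G ab) (adjacent⇒≢ G ac)) ad
    ; bc = nearby-u
    ; bd = ≡.trans (withoutEdge-awayʳ (adjacent⇒≢ G (adj-sym G bd)) (adjacent⇒≢ G (adj-sym G cd))) bd
    ; cd = nearby-common bd cd
    }
    where open Subdivision G b c bc

-- A flag 3-sphere with γ(t) = 1 + γ₁ t + γ₂ t² and a facet {a, b, c, d} in which the
-- links of ab, bc and cd have lengths 4 + k, 4 and 4 + l.
record MarkedSphere (k l γ₁ γ₂ : ℕ) : Set where
  field
    {size}       : ℕ
    graph        : Graph size
    triangulates : TriangulatesS³ (cliqueComplex graph)
    {a b c d}    : Fin size
    facet        : Tetrahedron graph a b c d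
    f-poly       : ∀ t → linkPoly graph [] t ≡ fγ γ₁ γ₂ t
    link-ab      : ∀ t → linkPoly graph (a ∷ b ∷ []) t ≡ polygon-poly k t
    link-bc      : ∀ t → linkPoly graph (b ∷ c ∷ []) t ≡ polygon-poly 0 t
    link-cd      : ∀ t → linkPoly graph (c ∷ d ∷ []) t ≡ polygon-poly l t
    link-abc     : ∀ t → linkPoly graph (a ∷ b ∷ c ∷ []) t ≡ S⁰-poly t
    link-bcd     : ∀ t → linkPoly graph (b ∷ c ∷ d ∷ []) t ≡ S⁰-poly t
    link-abcd    : ∀ t → linkPoly graph (a ∷ b ∷ c ∷ d ∷ []) t ≡ 1ℚ
  open Tetrahedron facet public

crossPolytope-sphere : MarkedSphere 0 0 0 0
crossPolytope-sphere = record
  { graph        = crossPolytope 4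
  ; triangulates = CrossPolytopeHomeomorphism.crossPolytope-homeomorphism 3
  ; a            = vertex 0F
  ; b            = vertex 1F
  ; c            = vertex 2F
  ; d            = vertex 3F
  ; facet        = record { ab = refl ; ac = refl ; ad = refl ; bc = refl ; bd = refl ; cd = refl }
  ; f-poly       = λ t → ≡.trans (linkPoly-crossPolytope [] t) (s⁴ (S⁰-poly t) (t ℚ.+ t ℚ.* t))
  ; link-ab      = λ t → ≡.trans (linkPoly-crossPolytope (vertex 0F ∷ vertex 1F ∷ []) t)
                     (s² (S⁰-poly t) (t ℚ.+ t ℚ.* t))
  ; link-bc      = λ t → ≡.trans (linkPoly-crossPolytope (vertex 1F ∷ vertex 2F ∷ []) t)
                     (s² (S⁰-poly t) (t ℚ.+ t ℚ.* t))
  ; link-cd      = λ t → ≡.trans (linkPoly-crossPolytope (vertex 2F ∷ vertex 3F ∷ []) t)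
                     (s² (S⁰-poly t) (t ℚ.+ t ℚ.* t))
  ; link-abc     = λ t → ≡.trans (linkPoly-crossPolytope (vertex 0F ∷ vertex 1F ∷ vertex 2F ∷ []) t)
                     (ℚ.*-identityʳ (S⁰-poly t))
  ; link-bcd     = λ t → ≡.trans (linkPoly-crossPolytope (vertex 1F ∷ vertex 2F ∷ vertex 3F ∷ []) t)
                     (ℚ.*-identityʳ (S⁰-poly t))
  ; link-abcd    = linkPoly-crossPolytope (vertex 0F ∷ vertex 1F ∷ vertex 2F ∷ vertex 3F ∷ [])
  }
  where
  vertex : Fin 4 → Fin (4 ℕ.* 2)
  vertex k = CrossPolytope.vertex 4 k 0F
  linkPoly-crossPolytope : ∀ σ t → linkPoly (crossPolytope 4) σ t ≡
    S⁰-poly t ^ ∣ Vec.tabulate (λ k → all (λ i → not (CrossPolytope.axis 4 i == k)) σ) ∣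
  linkPoly-crossPolytope σ = cliquePoly-crossPolytope 4 (λ k → all (λ i → not (CrossPolytope.axis 4 i == k)) σ)
  s⁴ : ∀ s w → s ℚ.* (s ℚ.* (s ℚ.* (s ℚ.* 1ℚ))) ≡
    (s ℚ.* s) ℚ.* (s ℚ.* s) ℚ.+ (0ℚ ℚ.* (w ℚ.* (s ℚ.* s)) ℚ.+ 0ℚ ℚ.* (w ℚ.* w))
  s⁴ = solve-∀ ℚ-ring
  s² : ∀ s w → s ℚ.* (s ℚ.* 1ℚ) ≡ s ℚ.* s ℚ.+ 0ℚ ℚ.* w
  s² = solve-∀ ℚ-ring

reversed : ∀ {k l γ₁ γ₂} → MarkedSphere k l γ₁ γ₂ → MarkedSphere l k γ₁ γ₂
reversed X = record
  { graph        = graph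
  ; triangulates = triangulates
  ; facet        = Tetrahedron-reverse facet
  ; f-poly       = f-poly
  ; link-ab      = λ t → ≡.trans (linkPoly-↭ graph (↭-reverse (c ∷ d ∷ [])) t) (link-cd t)
  ; link-bc      = λ t → ≡.trans (linkPoly-↭ graph (↭-reverse (b ∷ c ∷ [])) t) (link-bc t)
  ; link-cd      = λ t → ≡.trans (linkPoly-↭ graph (↭-reverse (a ∷ b ∷ [])) t) (link-ab t)
  ; link-abc     = λ t → ≡.trans (linkPoly-↭ graph (↭-reverse (b ∷ c ∷ d ∷ [])) t) (link-bcd t)
  ; link-bcd     = λ t → ≡.trans (linkPoly-↭ graph (↭-reverse (a ∷ b ∷ c ∷ [])) t) (link-abc t)
  ; link-abcd    = λ t → ≡.trans (linkPoly-↭ graph (↭-reverse (a ∷ b ∷ c ∷ d ∷ [])) t) (link-abcd t)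
  }
  where open MarkedSphere X

_∧-true⁺_ : ∀ {a b} → a ≡ true → b ≡ true → a ∧ b ≡ true
refl ∧-true⁺ b≡true = b≡true

infixr 5 _∧-true⁺_

subdivide-cd : ∀ {k l γ₁ γ₂} → MarkedSphere k l γ₁ γ₂ → MarkedSphere (suc k) l (suc γ₁) (γ₂ ℕ.+ l)
subdivide-cd {k} {l} {γ₁} {γ₂} X = record
  { graph        = subdivision
  ; triangulates = Homeomorphism-trans subdivision-homeomorphism triangulates
  ; facet        = Tetrahedron-subdivide-cd facet
  ; f-poly       = f-poly-subdivide graph c d cd γ₁ γ₂ l f-poly link-cd
  ; link-ab      = λ t → begin
      linkPoly subdivision (suc a ∷ suc b ∷ []) t
        ≡⟨ linkPoly-oldFace (a ∷ b ∷ []) c∈link-ab d∈link-ab t ⟩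
      linkPoly graph (a ∷ b ∷ []) t ℚ.+ (t ℚ.+ t ℚ.* t) ℚ.* linkPoly graph (a ∷ b ∷ c ∷ d ∷ []) t
        ≡⟨ cong₂ (λ p q → p ℚ.+ (t ℚ.+ t ℚ.* t) ℚ.* q) (link-ab t) (link-abcd t) ⟩
      polygon-poly k t ℚ.+ (t ℚ.+ t ℚ.* t) ℚ.* 1ℚ
        ≡⟨ polygon-poly-suc k t ⟨
      polygon-poly (suc k) t ∎
  ; link-bc      = λ t → ≡.trans (linkPoly-endpoint (b ∷ []) (bc ∧-true⁺ refl) (bd ∧-true⁺ refl) t) (link-bc t)
  ; link-cd      = λ t → ≡.trans (linkPoly-halfEdge [] refl refl t) (link-cd t)
  ; link-abc     = λ t → ≡.trans (linkPoly-endpoint (a ∷ b ∷ []) c∈link-ab d∈link-ab t) (link-abc t)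
  ; link-bcd     = λ t → ≡.trans (linkPoly-halfEdge (b ∷ []) (bc ∧-true⁺ refl) (bd ∧-true⁺ refl) t) (link-bcd t)
  ; link-abcd    = λ t → ≡.trans (linkPoly-halfEdge (a ∷ b ∷ []) c∈link-ab d∈link-ab t) (link-abcd t)
  }
  where
  open MarkedSphere X
  open Subdivision graph c d cd
  open SubdivisionHomeomorphism graph c d cd
  open ≡.≡-Reasoning
  c∈link-ab : link graph (a ∷ b ∷ []) c ≡ true
  c∈link-ab = ac ∧-true⁺ bc ∧-true⁺ refl
  d∈link-ab : link graph (a ∷ b ∷ []) d ≡ true
  d∈link-ab = ad ∧-true⁺ bd ∧-true⁺ refl

-- The link of the edge cd becomes the suspension of the two points of link-bcd.
subdivide-bc : ∀ {k l γ₁ γ₂} → MarkedSphere k l γ₁ γ₂ → MarkedSphere k 0 (suc γ₁) γ₂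
subdivide-bc {k} {l} {γ₁} {γ₂} X = record
  { graph        = subdivision
  ; triangulates = Homeomorphism-trans subdivision-homeomorphism triangulates
  ; facet        = Tetrahedron-subdivide-bc facet
  ; f-poly       = subst (λ γ₂ → ∀ t → linkPoly subdivision [] t ≡ fγ (suc γ₁) γ₂ t) (ℕ.+-identityʳ γ₂)
                     (f-poly-subdivide graph b c bc γ₁ γ₂ 0 f-poly link-bc)
  ; link-ab      = λ t → ≡.trans (linkPoly-endpoint (a ∷ []) (ab ∧-true⁺ refl) (ac ∧-true⁺ refl) t) (link-ab t)
  ; link-bc      = λ t → ≡.trans (linkPoly-halfEdge [] refl refl t) (link-bc t)
  ; link-cd      = λ t → begin
      linkPoly subdivision (zero ∷ suc d ∷ []) t
        ≡⟨ linkPoly-↭ subdivision (↭-reverse (suc d ∷ zero ∷ [])) t ⟩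
      linkPoly subdivision (suc d ∷ zero ∷ []) t
        ≡⟨ linkPoly-newVertex (d ∷ []) b∈link-d c∈link-d t ⟩
      S⁰-poly t ℚ.* linkPoly graph (d ∷ b ∷ c ∷ []) t
        ≡⟨ cong (S⁰-poly t ℚ.*_) (link-dbc t) ⟩
      S⁰-poly t ℚ.* S⁰-poly t
        ≡⟨ polygon-poly-zero t ⟨
      polygon-poly 0 t ∎
  ; link-abc     = λ t → ≡.trans (linkPoly-halfEdge (a ∷ []) (ab ∧-true⁺ refl) (ac ∧-true⁺ refl) t) (link-abc t)
  ; link-bcd     = λ t → begin
      linkPoly subdivision (suc b ∷ zero ∷ suc d ∷ []) t
        ≡⟨ linkPoly-↭ subdivision (rotate (suc b) zero (suc d)) t ⟩
      linkPoly subdivision (suc d ∷ suc b ∷ zero ∷ []) t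
        ≡⟨ linkPoly-halfEdge (d ∷ []) b∈link-d c∈link-d t ⟩
      linkPoly graph (d ∷ b ∷ c ∷ []) t
        ≡⟨ link-dbc t ⟩
      S⁰-poly t ∎
  ; link-abcd    = λ t → begin
      linkPoly subdivision (suc a ∷ suc b ∷ zero ∷ suc d ∷ []) t
        ≡⟨ linkPoly-↭ subdivision (prep (suc a) (rotate (suc b) zero (suc d))) t ⟩
      linkPoly subdivision (suc a ∷ suc d ∷ suc b ∷ zero ∷ []) t
        ≡⟨ linkPoly-halfEdge (a ∷ d ∷ []) (ab ∧-true⁺ b∈link-d) (ac ∧-true⁺ c∈link-d) t ⟩
      linkPoly graph (a ∷ d ∷ b ∷ c ∷ []) t
        ≡⟨ linkPoly-↭ graph (prep a (rotate b c d)) t ⟨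
      linkPoly graph (a ∷ b ∷ c ∷ d ∷ []) t
        ≡⟨ link-abcd t ⟩
      1ℚ ∎
  }
  where
  open MarkedSphere X
  open Subdivision graph b c bc
  open SubdivisionHomeomorphism graph b c bc
  open ≡.≡-Reasoning
  rotate : ∀ {n} (i j k : Fin n) → i ∷ j ∷ k ∷ [] ↭ k ∷ i ∷ j ∷ []
  rotate i j k = ++-comm (i ∷ j ∷ []) (k ∷ [])
  b∈link-d : link graph (d ∷ []) b ≡ true
  b∈link-d = adj-sym graph bd ∧-true⁺ refl
  c∈link-d : link graph (d ∷ []) c ≡ true
  c∈link-d = adj-sym graph cd ∧-true⁺ refl
  link-dbc : ∀ t → linkPoly graph (d ∷ b ∷ c ∷ []) t ≡ S⁰-poly t
  link-dbc t = ≡.trans (sym (linkPoly-↭ graph (rotate b c d) t)) (link-bcd t)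

subdivide-cd^ : ∀ m {k l γ₁ γ₂} → MarkedSphere k l γ₁ γ₂ → MarkedSphere (m ℕ.+ k) l (m ℕ.+ γ₁) (m ℕ.* l ℕ.+ γ₂)
subdivide-cd^ zero    X = X
subdivide-cd^ (suc m) {k} {l} {γ₁} {γ₂} X =
  subst (MarkedSphere (suc m ℕ.+ k) l (suc m ℕ.+ γ₁)) (m*l+γ₂+l m l γ₂) (subdivide-cd (subdivide-cd^ m X))
  where
  m*l+γ₂+l : ∀ m l γ₂ → m ℕ.* l ℕ.+ γ₂ ℕ.+ l ≡ (1 ℕ.+ m) ℕ.* l ℕ.+ γ₂
  m*l+γ₂+l = ℕ-Solver.solve-∀

subdivide-ab^ : ∀ m {k l γ₁ γ₂} → MarkedSphere k l γ₁ γ₂ → MarkedSphere k (m ℕ.+ l) (m ℕ.+ γ₁) (m ℕ.* k ℕ.+ γ₂)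
subdivide-ab^ m X = reversed (subdivide-cd^ m (reversed X))

subdivide-bc^ : ∀ m {k l γ₁ γ₂} → MarkedSphere k l γ₁ γ₂ → MarkedSphere k 0 (suc m ℕ.+ γ₁) γ₂
subdivide-bc^ zero    X = subdivide-bc X
subdivide-bc^ (suc m) X = subdivide-bc (subdivide-bc^ m X)

Realizable : ℕ → ℕ → Set
Realizable γ₁ γ₂ = ∃₂ λ k l → MarkedSphere k l γ₁ γ₂

-- Subdividing bc makes the link of cd a quadrilateral again, so r subdivisions of ab
-- turn it into a (4 + r)-gon, and a last subdivision of cd adds r to γ₂.
realize-quotient-remainder : ∀ q r o p → Realizable (suc ((r ℕ.+ p) ℕ.+ suc (q ℕ.+ o))) (q ℕ.* (r ℕ.+ p) ℕ.+ r)
realize-quotient-remainder q r o p = suc (q ℕ.+ 0) , r ℕ.+ 0 ,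
  subst₂ (MarkedSphere (suc (q ℕ.+ 0)) (r ℕ.+ 0)) (γ₁≡ q r o p) (γ₂≡ q r p)
    (subdivide-cd (subdivide-ab^ r (subdivide-bc^ o (subdivide-ab^ p (subdivide-cd^ q crossPolytope-sphere)))))
  where
  γ₁≡ : ∀ q r o p → 1 ℕ.+ (r ℕ.+ ((1 ℕ.+ o) ℕ.+ (p ℕ.+ (q ℕ.+ 0)))) ≡ 1 ℕ.+ ((r ℕ.+ p) ℕ.+ (1 ℕ.+ (q ℕ.+ o)))
  γ₁≡ = ℕ-Solver.solve-∀
  γ₂≡ : ∀ q r p → r ℕ.* (q ℕ.+ 0) ℕ.+ (p ℕ.* (q ℕ.+ 0) ℕ.+ (q ℕ.* 0 ℕ.+ 0)) ℕ.+ (r ℕ.+ 0) ≡ q ℕ.* (r ℕ.+ p) ℕ.+ r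
  γ₂≡ = ℕ-Solver.solve-∀

≤-product⇒quotient-remainder : ∀ m n g → g ℕ.≤ suc m ℕ.* n → ∃₂ λ q r → q ℕ.≤ m × r ℕ.≤ n × g ≡ q ℕ.* n ℕ.+ r
≤-product⇒quotient-remainder zero n g g≤n+0 = 0 , g , ℕ.z≤n , subst (g ℕ.≤_) (ℕ.+-identityʳ n) g≤n+0 , refl
≤-product⇒quotient-remainder (suc m) n g g≤ with ℕ.≤-total g n
... | inj₁ g≤n = 0 , g , ℕ.z≤n , g≤n , refl
... | inj₂ n≤g with g′ , refl ← ℕ.m≤n⇒∃[o]m+o≡n n≤g =
  let q , r , q≤m , r≤n , g′≡ = ≤-product⇒quotient-remainder m n g′ (ℕ.+-cancelˡ-≤ n g′ (suc m ℕ.* n) g≤)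
  in suc q , r , ℕ.s≤s q≤m , r≤n , ≡.trans (cong (n ℕ.+_) g′≡) (sym (ℕ.+-assoc n (q ℕ.* n) r))

n*n≤4⌊n/2⌋⌈n/2⌉+1 : ∀ n → n ℕ.* n ℕ.≤ 4 ℕ.* (⌊ n /2⌋ ℕ.* ⌈ n /2⌉) ℕ.+ 1
n*n≤4⌊n/2⌋⌈n/2⌉+1 zero          = ℕ.z≤n
n*n≤4⌊n/2⌋⌈n/2⌉+1 (suc zero)    = ℕ.≤-refl
n*n≤4⌊n/2⌋⌈n/2⌉+1 (suc (suc n)) = begin
  (2 ℕ.+ n) ℕ.* (2 ℕ.+ n)
    ≡⟨ expand n ⟩
  n ℕ.* n ℕ.+ (4 ℕ.* n ℕ.+ 4)
    ≤⟨ ℕ.+-monoˡ-≤ (4 ℕ.* n ℕ.+ 4) (n*n≤4⌊n/2⌋⌈n/2⌉+1 n) ⟩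
  4 ℕ.* (⌊ n /2⌋ ℕ.* ⌈ n /2⌉) ℕ.+ 1 ℕ.+ (4 ℕ.* n ℕ.+ 4)
    ≡⟨ cong (λ m → 4 ℕ.* (⌊ n /2⌋ ℕ.* ⌈ n /2⌉) ℕ.+ 1 ℕ.+ (4 ℕ.* m ℕ.+ 4)) (ℕ.⌊n/2⌋+⌈n/2⌉≡n n) ⟨
  4 ℕ.* (⌊ n /2⌋ ℕ.* ⌈ n /2⌉) ℕ.+ 1 ℕ.+ (4 ℕ.* (⌊ n /2⌋ ℕ.+ ⌈ n /2⌉) ℕ.+ 4)
    ≡⟨ collect ⌊ n /2⌋ ⌈ n /2⌉ ⟩
  4 ℕ.* (suc ⌊ n /2⌋ ℕ.* suc ⌈ n /2⌉) ℕ.+ 1 ∎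
  where
  open ℕ.≤-Reasoning
  expand : ∀ n → (2 ℕ.+ n) ℕ.* (2 ℕ.+ n) ≡ n ℕ.* n ℕ.+ (4 ℕ.* n ℕ.+ 4)
  expand = ℕ-Solver.solve-∀
  collect : ∀ x y → 4 ℕ.* (x ℕ.* y) ℕ.+ 1 ℕ.+ (4 ℕ.* (x ℕ.+ y) ℕ.+ 4) ≡ 4 ℕ.* ((1 ℕ.+ x) ℕ.* (1 ℕ.+ y)) ℕ.+ 1
  collect = ℕ-Solver.solve-∀

4g≤n*n⇒g≤⌊n/2⌋⌈n/2⌉ : ∀ n g → 4 ℕ.* g ℕ.≤ n ℕ.* n → g ℕ.≤ ⌊ n /2⌋ ℕ.* ⌈ n /2⌉
4g≤n*n⇒g≤⌊n/2⌋⌈n/2⌉ n g 4g≤n*n = ℕ.≤-pred (ℕ.*-cancelˡ-< 4 g (suc m) (begin-strict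
  4 ℕ.* g         ≤⟨ 4g≤n*n ⟩
  n ℕ.* n         ≤⟨ n*n≤4⌊n/2⌋⌈n/2⌉+1 n ⟩
  4 ℕ.* m ℕ.+ 1   <⟨ ℕ.+-monoʳ-< (4 ℕ.* m) (ℕ.s<s ℕ.z<s) ⟩
  4 ℕ.* m ℕ.+ 4   ≡⟨ identity m ⟩
  4 ℕ.* suc m     ∎))
  where
  open ℕ.≤-Reasoning
  m : ℕ
  m = ⌊ n /2⌋ ℕ.* ⌈ n /2⌉
  identity : ∀ m → 4 ℕ.* m ℕ.+ 4 ≡ 4 ℕ.* (1 ℕ.+ m)
  identity = ℕ-Solver.solve-∀

realize : ∀ a g → 4 ℕ.* g ℕ.≤ a ℕ.* a → Realizable (suc a) g
realize zero    zero _ = 0 , 0 , subdivide-bc crossPolytope-sphere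
realize (suc a) g 4g≤[1+a]² =
  let q , r , q≤⌊a/2⌋ , r≤⌈a/2⌉ , g≡ = ≤-product⇒quotient-remainder ⌊ a /2⌋ ⌈ a /2⌉ g
        (subst (g ℕ.≤_) (ℕ.*-comm ⌈ a /2⌉ (suc ⌊ a /2⌋)) (4g≤n*n⇒g≤⌊n/2⌋⌈n/2⌉ (suc a) g 4g≤[1+a]²))
      o , q+o≡⌊a/2⌋ = ℕ.m≤n⇒∃[o]m+o≡n q≤⌊a/2⌋
      p , r+p≡⌈a/2⌉ = ℕ.m≤n⇒∃[o]m+o≡n r≤⌈a/2⌉
  in subst₂ Realizable
       (cong suc (begin
         (r ℕ.+ p) ℕ.+ suc (q ℕ.+ o)   ≡⟨ cong₂ (λ x y → x ℕ.+ suc y) r+p≡⌈a/2⌉ q+o≡⌊a/2⌋ ⟩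
         ⌈ a /2⌉ ℕ.+ suc ⌊ a /2⌋       ≡⟨ ℕ.⌊n/2⌋+⌈n/2⌉≡n (suc a) ⟩
         suc a                         ∎))
       (≡.trans (cong (λ x → q ℕ.* x ℕ.+ r) r+p≡⌈a/2⌉) (sym g≡))
       (realize-quotient-remainder q r o p)
  where open ≡.≡-Reasoning

-- The h-polynomial

hPolynomial : ℤ → ℤ → Polynomial
hPolynomial γ₁ γ₂ = + 1 ∷ + 4 ℤ.+ γ₁ ∷ + 6 ℤ.+ (γ₁ ℤ.+ γ₁ ℤ.+ γ₂) ∷ + 4 ℤ.+ γ₁ ∷ + 1 ∷ []

evalℚ-hPolynomial : ∀ γ₁ γ₂ t →
  evalℚ (hPolynomial γ₁ γ₂) t ≡ homogenized (ι γ₁) (ι γ₂) ((1ℚ ℚ.+ t) ℚ.* (1ℚ ℚ.+ t)) t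
evalℚ-hPolynomial γ₁ γ₂ t = ≡.trans
  (cong₂ (λ p q → 1ℚ ℚ.+ t ℚ.* (p ℚ.+ t ℚ.* (q ℚ.+ t ℚ.* (p ℚ.+ t ℚ.* (1ℚ ℚ.+ t ℚ.* 0ℚ))))) ι[4+γ₁] ι[6+2γ₁+γ₂])
  (collect (ι γ₁) (ι γ₂) t)
  where
  ι[4+γ₁] : ι (+ 4 ℤ.+ γ₁) ≡ fromℕ 4 ℚ.+ ι γ₁
  ι[4+γ₁] = ι-homo-+ (+ 4) γ₁
  ι[6+2γ₁+γ₂] : ι (+ 6 ℤ.+ (γ₁ ℤ.+ γ₁ ℤ.+ γ₂)) ≡ fromℕ 6 ℚ.+ (ι γ₁ ℚ.+ ι γ₁ ℚ.+ ι γ₂)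
  ι[6+2γ₁+γ₂] = begin
    ι (+ 6 ℤ.+ (γ₁ ℤ.+ γ₁ ℤ.+ γ₂))           ≡⟨ ι-homo-+ (+ 6) (γ₁ ℤ.+ γ₁ ℤ.+ γ₂) ⟩
    fromℕ 6 ℚ.+ ι (γ₁ ℤ.+ γ₁ ℤ.+ γ₂)         ≡⟨ cong (fromℕ 6 ℚ.+_) (ι-homo-+ (γ₁ ℤ.+ γ₁) γ₂) ⟩
    fromℕ 6 ℚ.+ (ι (γ₁ ℤ.+ γ₁) ℚ.+ ι γ₂)     ≡⟨ cong (λ p → fromℕ 6 ℚ.+ (p ℚ.+ ι γ₂)) (ι-homo-+ γ₁ γ₁) ⟩
    fromℕ 6 ℚ.+ (ι γ₁ ℚ.+ ι γ₁ ℚ.+ ι γ₂)     ∎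
    where open ≡.≡-Reasoning
  collect : ∀ A B t →
    1ℚ ℚ.+ t ℚ.* ((fromℕ 4 ℚ.+ A) ℚ.+ t ℚ.* ((fromℕ 6 ℚ.+ (A ℚ.+ A ℚ.+ B)) ℚ.+ t ℚ.* ((fromℕ 4 ℚ.+ A) ℚ.+
      t ℚ.* (1ℚ ℚ.+ t ℚ.* 0ℚ)))) ≡
    ((1ℚ ℚ.+ t) ℚ.* (1ℚ ℚ.+ t)) ℚ.* ((1ℚ ℚ.+ t) ℚ.* (1ℚ ℚ.+ t)) ℚ.+
      (A ℚ.* (t ℚ.* ((1ℚ ℚ.+ t) ℚ.* (1ℚ ℚ.+ t))) ℚ.+ B ℚ.* (t ℚ.* t))
  collect = solve-∀ ℚ-ring

homogenized-scale : ∀ A B c d e → homogenized A B (c ℚ.* d) (c ℚ.* e) ≡ c ℚ.* c ℚ.* homogenized A B d e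
homogenized-scale = identity
  where
  identity : ∀ A B c d e →
    (c ℚ.* d) ℚ.* (c ℚ.* d) ℚ.+ (A ℚ.* ((c ℚ.* e) ℚ.* (c ℚ.* d)) ℚ.+ B ℚ.* ((c ℚ.* e) ℚ.* (c ℚ.* e))) ≡
    c ℚ.* c ℚ.* (d ℚ.* d ℚ.+ (A ℚ.* (e ℚ.* d) ℚ.+ B ℚ.* (e ℚ.* e)))
  identity = solve-∀ ℚ-ring

p^4≡p²*p² : ∀ p → p ^ 4 ≡ (p ℚ.* p) ℚ.* (p ℚ.* p)
p^4≡p²*p² = identity
  where
  identity : ∀ p → p ℚ.* (p ℚ.* (p ℚ.* (p ℚ.* 1ℚ))) ≡ (p ℚ.* p) ℚ.* (p ℚ.* p)
  identity = solve-∀ ℚ-ring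

hPolynomial-γ : ∀ γ₁ γ₂ → Is[1+t]⁴p[t/[1+t]²] (hPolynomial γ₁ γ₂) (+ 1 ∷ γ₁ ∷ γ₂ ∷ [])
hPolynomial-γ γ₁ γ₂ t = begin
  evalℚ (hPolynomial γ₁ γ₂) t                          ≡⟨ evalℚ-hPolynomial γ₁ γ₂ t ⟩
  homogenized A B (y ℚ.* y) t                          ≡⟨ cong₂ (homogenized A B) (y*y≡y²*1 y) y²*[t÷y²]≡t ⟨
  homogenized A B (y ^ 2 ℚ.* 1ℚ) (y ^ 2 ℚ.* x)         ≡⟨ homogenized-scale A B (y ^ 2) 1ℚ x ⟩
  y ^ 2 ℚ.* y ^ 2 ℚ.* homogenized A B 1ℚ x             ≡⟨ cong₂ ℚ._*_ (y²*y²≡y⁴ y) (dehomogenize A B x) ⟩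
  y ^ 4 ℚ.* evalℚ (+ 1 ∷ γ₁ ∷ γ₂ ∷ []) x               ∎
  where
  open ≡.≡-Reasoning
  A B y x : ℚ
  A = ι γ₁
  B = ι γ₂
  y = 1ℚ ℚ.+ t
  x = t ℚ.÷ (y ^ 2)
  y*y≡y²*1 : ∀ y → y ℚ.* (y ℚ.* 1ℚ) ℚ.* 1ℚ ≡ y ℚ.* y
  y*y≡y²*1 = solve-∀ ℚ-ring
  y²*y²≡y⁴ : ∀ y → (y ℚ.* (y ℚ.* 1ℚ)) ℚ.* (y ℚ.* (y ℚ.* 1ℚ)) ≡ y ℚ.* (y ℚ.* (y ℚ.* (y ℚ.* 1ℚ)))
  y²*y²≡y⁴ = solve-∀ ℚ-ring
  y²*[t÷y²]≡t : y ^ 2 ℚ.* x ≡ t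
  y²*[t÷y²]≡t = begin
    y ^ 2 ℚ.* (t ℚ.* ℚ.1/ (y ^ 2))     ≡⟨ rearrange (y ^ 2) t (ℚ.1/ (y ^ 2)) ⟩
    t ℚ.* (y ^ 2 ℚ.* ℚ.1/ (y ^ 2))     ≡⟨ cong (t ℚ.*_) (ℚ.*-inverseʳ (y ^ 2)) ⟩
    t ℚ.* 1ℚ                           ≡⟨ ℚ.*-identityʳ t ⟩
    t                                  ∎
    where
    rearrange : ∀ p q r → p ℚ.* (q ℚ.* r) ≡ q ℚ.* (p ℚ.* r)
    rearrange = solve-∀ ℚ-ring
  dehomogenize : ∀ A B x → 1ℚ ℚ.* 1ℚ ℚ.+ (A ℚ.* (x ℚ.* 1ℚ) ℚ.+ B ℚ.* (x ℚ.* x)) ≡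
    1ℚ ℚ.+ x ℚ.* (A ℚ.+ x ℚ.* (B ℚ.+ x ℚ.* 0ℚ))
  dehomogenize = solve-∀ ℚ-ring

module _ (p : ℚ) .{{_ : ℚ.NonZero p}} where
  private
    i : ℚ
    i = ℚ.1/ p

  p²*[1+1/p]²≡[1+p]² : p ℚ.* p ℚ.* ((1ℚ ℚ.+ i) ℚ.* (1ℚ ℚ.+ i)) ≡ (1ℚ ℚ.+ p) ℚ.* (1ℚ ℚ.+ p)
  p²*[1+1/p]²≡[1+p]² = ≡.trans (factor p i) (cong (λ q → (q ℚ.+ p) ℚ.* (q ℚ.+ p)) (ℚ.*-inverseʳ p))
    where
    factor : ∀ p i → p ℚ.* p ℚ.* ((1ℚ ℚ.+ i) ℚ.* (1ℚ ℚ.+ i)) ≡ (p ℚ.* i ℚ.+ p) ℚ.* (p ℚ.* i ℚ.+ p)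
    factor = solve-∀ ℚ-ring

  p²*1/p≡p : p ℚ.* p ℚ.* i ≡ p
  p²*1/p≡p = ≡.trans (ℚ.*-assoc p p i) (≡.trans (cong (p ℚ.*_) (ℚ.*-inverseʳ p)) (ℚ.*-identityʳ p))

  p²*[1+2/p]²≡[2+p]² : p ℚ.* p ℚ.* (S⁰-poly i ℚ.* S⁰-poly i) ≡ (1ℚ ℚ.+ (1ℚ ℚ.+ p)) ℚ.* (1ℚ ℚ.+ (1ℚ ℚ.+ p))
  p²*[1+2/p]²≡[2+p]² = ≡.trans (factor p i)
    (≡.trans (cong (λ q → (p ℚ.+ (q ℚ.+ q)) ℚ.* (p ℚ.+ (q ℚ.+ q))) (ℚ.*-inverseʳ p)) (reorder p))
    where
    factor : ∀ p i → p ℚ.* p ℚ.* ((1ℚ ℚ.+ (i ℚ.+ i)) ℚ.* (1ℚ ℚ.+ (i ℚ.+ i))) ≡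
      (p ℚ.+ (p ℚ.* i ℚ.+ p ℚ.* i)) ℚ.* (p ℚ.+ (p ℚ.* i ℚ.+ p ℚ.* i))
    factor = solve-∀ ℚ-ring
    reorder : ∀ p → (p ℚ.+ (1ℚ ℚ.+ 1ℚ)) ℚ.* (p ℚ.+ (1ℚ ℚ.+ 1ℚ)) ≡ (1ℚ ℚ.+ (1ℚ ℚ.+ p)) ℚ.* (1ℚ ℚ.+ (1ℚ ℚ.+ p))
    reorder = solve-∀ ℚ-ring

  p²*[1/p+1/p²]≡1+p : p ℚ.* p ℚ.* (i ℚ.+ i ℚ.* i) ≡ 1ℚ ℚ.+ p
  p²*[1/p+1/p²]≡1+p = begin
    p ℚ.* p ℚ.* (i ℚ.+ i ℚ.* i)                        ≡⟨ factor p i ⟩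
    (p ℚ.* i) ℚ.* (p ℚ.* i) ℚ.+ p ℚ.* (p ℚ.* i)        ≡⟨ cong (λ q → q ℚ.* q ℚ.+ p ℚ.* q) (ℚ.*-inverseʳ p) ⟩
    1ℚ ℚ.+ p ℚ.* 1ℚ                                    ≡⟨ cong (1ℚ ℚ.+_) (ℚ.*-identityʳ p) ⟩
    1ℚ ℚ.+ p                                           ∎
    where
    open ≡.≡-Reasoning
    factor : ∀ p i → p ℚ.* p ℚ.* (i ℚ.+ i ℚ.* i) ≡ (p ℚ.* i) ℚ.* (p ℚ.* i) ℚ.+ p ℚ.* (p ℚ.* i)
    factor = solve-∀ ℚ-ring

-- Both sides of the defining equation of h are the value of the homogenized γ at
-- d = (2 + t)² and e = 1 + t.
hPolynomial-f : ∀ {n} (X : SimplicialComplex n) γ₁ γ₂ → (∀ t → fPolynomial X t ≡ fγ γ₁ γ₂ t) →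
                IsHPolynomial X (hPolynomial (+ γ₁) (+ γ₂))
hPolynomial-f X γ₁ γ₂ f≡fγ t = begin
  y ^ 4 ℚ.* evalℚ (hPolynomial (+ γ₁) (+ γ₂)) i
    ≡⟨ cong₂ ℚ._*_ (p^4≡p²*p² y) (evalℚ-hPolynomial (+ γ₁) (+ γ₂) i) ⟩
  (y ℚ.* y) ℚ.* (y ℚ.* y) ℚ.* homogenized A B ((1ℚ ℚ.+ i) ℚ.* (1ℚ ℚ.+ i)) i
    ≡⟨ homogenized-scale A B (y ℚ.* y) ((1ℚ ℚ.+ i) ℚ.* (1ℚ ℚ.+ i)) i ⟨
  homogenized A B (y ℚ.* y ℚ.* ((1ℚ ℚ.+ i) ℚ.* (1ℚ ℚ.+ i))) (y ℚ.* y ℚ.* i)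
    ≡⟨ cong₂ (homogenized A B) (p²*[1+1/p]²≡[1+p]² y) (p²*1/p≡p y) ⟩
  homogenized A B ((1ℚ ℚ.+ y) ℚ.* (1ℚ ℚ.+ y)) y
    ≡⟨ cong₂ (homogenized A B) (p²*[1+2/p]²≡[2+p]² t) (p²*[1/p+1/p²]≡1+p t) ⟨
  homogenized A B (t ℚ.* t ℚ.* (S⁰-poly z ℚ.* S⁰-poly z)) (t ℚ.* t ℚ.* (z ℚ.+ z ℚ.* z))
    ≡⟨ homogenized-scale A B (t ℚ.* t) (S⁰-poly z ℚ.* S⁰-poly z) (z ℚ.+ z ℚ.* z) ⟩
  (t ℚ.* t) ℚ.* (t ℚ.* t) ℚ.* fγ γ₁ γ₂ z
    ≡⟨ cong₂ ℚ._*_ (p^4≡p²*p² t) (f≡fγ z) ⟨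
  t ^ 4 ℚ.* fPolynomial X z ∎
  where
  open ≡.≡-Reasoning
  A B y i z : ℚ
  A = fromℕ γ₁
  B = fromℕ γ₂
  y = 1ℚ ℚ.+ t
  i = ℚ.1/ y
  z = ℚ.1/ t

-- The roots of γ(t) − t

module _ (z : ℂ) (n : ℕ) where
  private
    r s : ℚ
    r = seq (re z) n
    s = seq (im z) n

  evalℂ-linear-re : ∀ b a → seq (re (evalℂ (b ∷ a ∷ []) z)) n ≡ ι b ℚ.+ r ℚ.* ι a
  evalℂ-linear-re b a = identity (ι b) (ι a) r s
    where
    identity : ∀ b a r s → b ℚ.+ (r ℚ.* (a ℚ.+ (r ℚ.* 0ℚ ℚ.+ ℚ.- (s ℚ.* 0ℚ))) ℚ.+
      ℚ.- (s ℚ.* (0ℚ ℚ.+ (r ℚ.* 0ℚ ℚ.+ s ℚ.* 0ℚ)))) ≡ b ℚ.+ r ℚ.* a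
    identity = solve-∀ ℚ-ring

  evalℂ-linear-im : ∀ b a → seq (im (evalℂ (b ∷ a ∷ []) z)) n ≡ s ℚ.* ι a
  evalℂ-linear-im b a = identity (ι a) r s
    where
    identity : ∀ a r s → 0ℚ ℚ.+ (r ℚ.* (0ℚ ℚ.+ (r ℚ.* 0ℚ ℚ.+ s ℚ.* 0ℚ)) ℚ.+
      s ℚ.* (a ℚ.+ (r ℚ.* 0ℚ ℚ.+ ℚ.- (s ℚ.* 0ℚ)))) ≡ s ℚ.* a
    identity = solve-∀ ℚ-ring

  evalℂ-quadratic-re : ∀ c b a →
    seq (re (evalℂ (c ∷ b ∷ a ∷ []) z)) n ≡ ι c ℚ.+ (r ℚ.* (ι b ℚ.+ r ℚ.* ι a) ℚ.+ ℚ.- (s ℚ.* (s ℚ.* ι a)))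
  evalℂ-quadratic-re c b a =
    cong₂ (λ p q → ι c ℚ.+ (r ℚ.* p ℚ.+ ℚ.- (s ℚ.* q))) (evalℂ-linear-re b a) (evalℂ-linear-im b a)

  evalℂ-quadratic-im : ∀ c b a →
    seq (im (evalℂ (c ∷ b ∷ a ∷ []) z)) n ≡ 0ℚ ℚ.+ (r ℚ.* (s ℚ.* ι a) ℚ.+ s ℚ.* (ι b ℚ.+ r ℚ.* ι a))
  evalℂ-quadratic-im c b a =
    cong₂ (λ p q → 0ℚ ℚ.+ (r ℚ.* q ℚ.+ s ℚ.* p)) (evalℂ-linear-re b a) (evalℂ-linear-im b a)

-- 1 + (A − 1) t + B t² = B ((t − b)² − c).
record VertexForm (A B b c : ℚ) : Set where
  field
    A≡1-2Bb   : A ≡ 1ℚ ℚ.- (B ℚ.* b ℚ.+ B ℚ.* b)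
    1≡B[b²-c] : 1ℚ ≡ B ℚ.* (b ℚ.* b ℚ.- c)

vertexForm-exists : ∀ A {B} → B ≢ 0ℚ → ∃₂ λ b c → VertexForm A B b c
vertexForm-exists A {B} B≢0 = b , b ℚ.* b ℚ.- i , record
  { A≡1-2Bb   = begin
      A                                        ≡⟨ expand A ⟩
      1ℚ ℚ.- (1ℚ ℚ.- A) ℚ.* 1ℚ                 ≡⟨ cong (λ p → 1ℚ ℚ.- (1ℚ ℚ.- A) ℚ.* p) (ℚ.*-inverseʳ B) ⟨
      1ℚ ℚ.- (1ℚ ℚ.- A) ℚ.* (B ℚ.* i)          ≡⟨ halve A B i ⟩
      1ℚ ℚ.- (B ℚ.* b ℚ.+ B ℚ.* b)             ∎
  ; 1≡B[b²-c] = begin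
      1ℚ                                       ≡⟨ ℚ.*-inverseʳ B ⟨
      B ℚ.* i                                  ≡⟨ regroup B b i ⟩
      B ℚ.* (b ℚ.* b ℚ.- (b ℚ.* b ℚ.- i))      ∎
  }
  where
  open ≡.≡-Reasoning
  instance
    B-nonZero : ℚ.NonZero B
    B-nonZero = ℚ.≢-nonZero B≢0
  i b : ℚ
  i = ℚ.1/ B
  b = ½ ℚ.* (1ℚ ℚ.- A) ℚ.* i
  expand : ∀ A → A ≡ 1ℚ ℚ.- (1ℚ ℚ.- A) ℚ.* 1ℚ
  expand = solve-∀ ℚ-ring
  halve : ∀ A B i → 1ℚ ℚ.- (1ℚ ℚ.- A) ℚ.* (B ℚ.* i) ≡
    1ℚ ℚ.- (B ℚ.* (½ ℚ.* (1ℚ ℚ.- A) ℚ.* i) ℚ.+ B ℚ.* (½ ℚ.* (1ℚ ℚ.- A) ℚ.* i))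
  halve = solve-∀ ℚ-ring
  regroup : ∀ B b i → B ℚ.* i ≡ B ℚ.* (b ℚ.* b ℚ.- (b ℚ.* b ℚ.- i))
  regroup = solve-∀ ℚ-ring

γ-Bounds : ℚ → ℚ → Set
γ-Bounds A B = 1ℚ ℚ.≤ A × 0ℚ ℚ.≤ B × fromℕ 4 ℚ.* B ℚ.≤ (A ℚ.- 1ℚ) ℚ.* (A ℚ.- 1ℚ)

vertexForm⇒γ-Bounds : ∀ {A B b c} → VertexForm A B b c → 0ℚ ℚ.≤ c → b ℚ.< 0ℚ → c ℚ.< b ℚ.* b → γ-Bounds A B
vertexForm⇒γ-Bounds {A} {B} {b} {c} vertexForm 0≤c b<0 c<b² = ℚ.<⇒≤ 1<A , ℚ.<⇒≤ 0<B , 4B≤[A-1]²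
  where
  open VertexForm vertexForm
  open ≡.≡-Reasoning
  0<b²-c : 0ℚ ℚ.< b ℚ.* b ℚ.- c
  0<b²-c = <-resp-difference c<b² (ℚ.+-identityʳ (b ℚ.* b ℚ.- c))
  0<B : 0ℚ ℚ.< B
  0<B = ℚ.*-cancelʳ-<-nonNeg (b ℚ.* b ℚ.- c) {{ℚ.nonNegative (ℚ.<⇒≤ 0<b²-c)}}
    (subst₂ ℚ._<_ (sym (ℚ.*-zeroˡ (b ℚ.* b ℚ.- c))) 1≡B[b²-c] 0<1)
  0<-b : 0ℚ ℚ.< ℚ.- b
  0<-b = ℚ.neg-antimono-< b<0
  A-1≡B[-2b] : A ℚ.- 1ℚ ≡ B ℚ.* (ℚ.- b ℚ.+ ℚ.- b)
  A-1≡B[-2b] = ≡.trans (cong (ℚ._- 1ℚ) A≡1-2Bb) (regroup B b)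
    where
    regroup : ∀ B b → 1ℚ ℚ.- (B ℚ.* b ℚ.+ B ℚ.* b) ℚ.- 1ℚ ≡ B ℚ.* (ℚ.- b ℚ.+ ℚ.- b)
    regroup = solve-∀ ℚ-ring
  1<A : 1ℚ ℚ.< A
  1<A = <-resp-difference (0<p*q 0<B (ℚ.+-mono-< 0<-b 0<-b)) (≡.trans A-1≡B[-2b] (sym (ℚ.+-identityʳ _)))
  4B≤[A-1]² : fromℕ 4 ℚ.* B ℚ.≤ (A ℚ.- 1ℚ) ℚ.* (A ℚ.- 1ℚ)
  4B≤[A-1]² = ≤-resp-difference (0≤p*q (0≤p*p (B ℚ.+ B)) 0≤c) (begin
    (A ℚ.- 1ℚ) ℚ.* (A ℚ.- 1ℚ) ℚ.- fromℕ 4 ℚ.* B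
      ≡⟨ cong₂ (λ p q → p ℚ.* p ℚ.- fromℕ 4 ℚ.* q) A-1≡B[-2b]
           (≡.trans (sym (ℚ.*-identityʳ B)) (cong (B ℚ.*_) 1≡B[b²-c])) ⟩
    (B ℚ.* (ℚ.- b ℚ.+ ℚ.- b)) ℚ.* (B ℚ.* (ℚ.- b ℚ.+ ℚ.- b)) ℚ.- fromℕ 4 ℚ.* (B ℚ.* (B ℚ.* (b ℚ.* b ℚ.- c)))
      ≡⟨ collect B b c ⟩
    (B ℚ.+ B) ℚ.* (B ℚ.+ B) ℚ.* c ℚ.- 0ℚ ∎)
    where
    collect : ∀ B b c → (B ℚ.* (ℚ.- b ℚ.+ ℚ.- b)) ℚ.* (B ℚ.* (ℚ.- b ℚ.+ ℚ.- b)) ℚ.-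
      fromℕ 4 ℚ.* (B ℚ.* (B ℚ.* (b ℚ.* b ℚ.- c))) ≡ (B ℚ.+ B) ℚ.* (B ℚ.+ B) ℚ.* c ℚ.- 0ℚ
    collect = solve-∀ ℚ-ring

fromℚ*-zero : ∀ q {x} → x ≃ 0ℝ → fromℚ q * x ≃ 0ℝ
fromℚ*-zero q {x} x≃0 = ≃-trans (*-cong {fromℚ q} ≃-refl x≃0) (≗⇒≃ λ _ → ℚ.*-zeroʳ q)

fromℚ-abs : ∀ {q} → 0ℚ ℚ.≤ q → abs (fromℚ q) ≃ fromℚ q
fromℚ-abs 0≤q = ≗⇒≃ λ _ → ℚ.0≤p⇒∣p∣≡p 0≤q

√-fromℚ-square : ∀ {q} → 0ℚ ℚ.≤ q → √ (fromℚ q) * √ (fromℚ q) ≃ fromℚ q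
√-fromℚ-square {q} 0≤q = ≃-trans (√x*√x≃abs (fromℚ q)) (fromℚ-abs 0≤q)

√-fromℚ-nonzero : ∀ {q} → 0ℚ ℚ.< q → ¬ √ (fromℚ q) ≃ 0ℝ
√-fromℚ-nonzero {q} 0<q √q≃0 = ℚ.<-irrefl refl (subst (q ℚ.<_) (ℚ.+-identityˡ q) (below q~0))
  where
  q≃0 : fromℚ q ≃ 0ℝ
  q≃0 = begin
    fromℚ q                   ≈⟨ √-fromℚ-square (ℚ.<⇒≤ 0<q) ⟨
    √ (fromℚ q) * √ (fromℚ q) ≈⟨ *-cong √q≃0 √q≃0 ⟩
    0ℝ * 0ℝ                   ≈⟨ ≗⇒≃ (λ _ → refl) ⟩
    0ℝ                        ∎
    where open ≃-Reasoning
  q~0 : Near q q 0ℚ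
  q~0 = proj₂ (Eventually⇒∃ (close q≃0 0<q))

realRoot complexRoot : ℚ → ℚ → ℂ
realRoot    b c = (fromℚ b + √ (fromℚ c)) +i 0ℝ
complexRoot b c = (fromℚ b + 0ℝ) +i √ (fromℚ (ℚ.- c))

module _ (γ₁ γ₂ : ℤ) where
  private
    γ : Polynomial
    γ = + 1 ∷ γ₁ ∷ γ₂ ∷ []

    A B : ℚ
    A = ι γ₁
    B = ι γ₂

  NegativeRoots : Set
  NegativeRoots = ∀ z → IsRootOf[ γ -t] z → im z ≈ 0ℝ × re z < 0ℝ

  linearRoot-isRoot : B ≡ 0ℚ → ∀ {i} → (1ℚ ℚ.- A) ℚ.* i ≡ 1ℚ → IsRootOf[ γ -t] (fromℚ i +i 0ℝ)
  linearRoot-isRoot B≡0 {i} [1-A]*i≡1 = ≃⇒≈ re≃0 , ≃⇒≈ im≃0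
    where
    open ≡.≡-Reasoning
    z : ℂ
    z = fromℚ i +i 0ℝ
    re≃0 : re (evalℂ γ z) + - fromℚ i ≃ 0ℝ
    re≃0 = ≗⇒≃ λ n → begin
      seq (re (evalℂ γ z)) n ℚ.+ ℚ.- i
        ≡⟨ cong (ℚ._+ ℚ.- i) (evalℂ-quadratic-re z n (+ 1) γ₁ γ₂) ⟩
      1ℚ ℚ.+ (i ℚ.* (A ℚ.+ i ℚ.* B) ℚ.+ ℚ.- (0ℚ ℚ.* (0ℚ ℚ.* B))) ℚ.+ ℚ.- i
        ≡⟨ regroup A B i ⟩
      1ℚ ℚ.- (1ℚ ℚ.- A) ℚ.* i ℚ.+ i ℚ.* i ℚ.* B
        ≡⟨ cong₂ (λ p q → 1ℚ ℚ.- p ℚ.+ i ℚ.* i ℚ.* q) [1-A]*i≡1 B≡0 ⟩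
      0ℚ ℚ.+ i ℚ.* i ℚ.* 0ℚ
        ≡⟨ ≡.trans (ℚ.+-identityˡ _) (ℚ.*-zeroʳ (i ℚ.* i)) ⟩
      0ℚ ∎
      where
      regroup : ∀ A B i → 1ℚ ℚ.+ (i ℚ.* (A ℚ.+ i ℚ.* B) ℚ.+ ℚ.- (0ℚ ℚ.* (0ℚ ℚ.* B))) ℚ.+ ℚ.- i ≡
        1ℚ ℚ.- (1ℚ ℚ.- A) ℚ.* i ℚ.+ i ℚ.* i ℚ.* B
      regroup = solve-∀ ℚ-ring
    im≃0 : im (evalℂ γ z) + - 0ℝ ≃ 0ℝ
    im≃0 = ≗⇒≃ λ n → ≡.trans (cong (ℚ._+ ℚ.- 0ℚ) (evalℂ-quadratic-im z n (+ 1) γ₁ γ₂)) (vanish A B i)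
      where
      vanish : ∀ A B i → 0ℚ ℚ.+ (i ℚ.* (0ℚ ℚ.* B) ℚ.+ 0ℚ ℚ.* (A ℚ.+ i ℚ.* B)) ℚ.+ ℚ.- 0ℚ ≡ 0ℚ
      vanish = solve-∀ ℚ-ring

  module _ {b c : ℚ} (vertexForm : VertexForm A B b c) where
    open VertexForm vertexForm

    private
      module _ (x y : ℝ) where

        re-vertexForm : re (evalℂ γ ((fromℚ b + x) +i y)) + - (fromℚ b + x) ≃
                        fromℚ B * (x * x + - (y * y) + - fromℚ c)
        re-vertexForm = ≗⇒≃ λ n → let r = seq x n ; s = seq y n in begin
          seq (re (evalℂ γ ((fromℚ b + x) +i y))) n ℚ.+ ℚ.- (b ℚ.+ r)
            ≡⟨ cong (ℚ._+ ℚ.- (b ℚ.+ r)) (evalℂ-quadratic-re ((fromℚ b + x) +i y) n (+ 1) γ₁ γ₂) ⟩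
          1ℚ ℚ.+ ((b ℚ.+ r) ℚ.* (A ℚ.+ (b ℚ.+ r) ℚ.* B) ℚ.+ ℚ.- (s ℚ.* (s ℚ.* B))) ℚ.+ ℚ.- (b ℚ.+ r)
            ≡⟨ cong₂ (λ o A → o ℚ.+ ((b ℚ.+ r) ℚ.* (A ℚ.+ (b ℚ.+ r) ℚ.* B) ℚ.+ ℚ.- (s ℚ.* (s ℚ.* B))) ℚ.+
                 ℚ.- (b ℚ.+ r)) 1≡B[b²-c] A≡1-2Bb ⟩
          B ℚ.* (b ℚ.* b ℚ.- c) ℚ.+ ((b ℚ.+ r) ℚ.* (1ℚ ℚ.- (B ℚ.* b ℚ.+ B ℚ.* b) ℚ.+ (b ℚ.+ r) ℚ.* B) ℚ.+
            ℚ.- (s ℚ.* (s ℚ.* B))) ℚ.+ ℚ.- (b ℚ.+ r)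
            ≡⟨ collect b c B r s ⟩
          B ℚ.* (r ℚ.* r ℚ.+ ℚ.- (s ℚ.* s) ℚ.+ ℚ.- c) ∎
          where
          open ≡.≡-Reasoning
          collect : ∀ b c B r s → B ℚ.* (b ℚ.* b ℚ.- c) ℚ.+
            ((b ℚ.+ r) ℚ.* (1ℚ ℚ.- (B ℚ.* b ℚ.+ B ℚ.* b) ℚ.+ (b ℚ.+ r) ℚ.* B) ℚ.+ ℚ.- (s ℚ.* (s ℚ.* B))) ℚ.+
            ℚ.- (b ℚ.+ r) ≡ B ℚ.* (r ℚ.* r ℚ.+ ℚ.- (s ℚ.* s) ℚ.+ ℚ.- c)
          collect = solve-∀ ℚ-ring

        im-vertexForm : im (evalℂ γ ((fromℚ b + x) +i y)) + - y ≃ fromℚ B * (x * y + x * y)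
        im-vertexForm = ≗⇒≃ λ n → let r = seq x n ; s = seq y n in begin
          seq (im (evalℂ γ ((fromℚ b + x) +i y))) n ℚ.+ ℚ.- s
            ≡⟨ cong (ℚ._+ ℚ.- s) (evalℂ-quadratic-im ((fromℚ b + x) +i y) n (+ 1) γ₁ γ₂) ⟩
          0ℚ ℚ.+ ((b ℚ.+ r) ℚ.* (s ℚ.* B) ℚ.+ s ℚ.* (A ℚ.+ (b ℚ.+ r) ℚ.* B)) ℚ.+ ℚ.- s
            ≡⟨ cong (λ A → 0ℚ ℚ.+ ((b ℚ.+ r) ℚ.* (s ℚ.* B) ℚ.+ s ℚ.* (A ℚ.+ (b ℚ.+ r) ℚ.* B)) ℚ.+ ℚ.- s) A≡1-2Bb ⟩
          0ℚ ℚ.+ ((b ℚ.+ r) ℚ.* (s ℚ.* B) ℚ.+ s ℚ.* (1ℚ ℚ.- (B ℚ.* b ℚ.+ B ℚ.* b) ℚ.+ (b ℚ.+ r) ℚ.* B)) ℚ.+ ℚ.- s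
            ≡⟨ collect b B r s ⟩
          B ℚ.* (r ℚ.* s ℚ.+ r ℚ.* s) ∎
          where
          open ≡.≡-Reasoning
          collect : ∀ b B r s →
            0ℚ ℚ.+ ((b ℚ.+ r) ℚ.* (s ℚ.* B) ℚ.+ s ℚ.* (1ℚ ℚ.- (B ℚ.* b ℚ.+ B ℚ.* b) ℚ.+ (b ℚ.+ r) ℚ.* B)) ℚ.+
            ℚ.- s ≡ B ℚ.* (r ℚ.* s ℚ.+ r ℚ.* s)
          collect = solve-∀ ℚ-ring

    quadratic-root : ∀ x y → x * x + - (y * y) ≃ fromℚ c → x * y ≃ 0ℝ → IsRootOf[ γ -t] ((fromℚ b + x) +i y)
    quadratic-root x y x²-y²≃c xy≃0 =
      ≃⇒≈ (≃-trans (re-vertexForm x y) (fromℚ*-zero B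
        (≃-trans (+-cong x²-y²≃c ≃-refl) (≗⇒≃ λ _ → ℚ.+-inverseʳ c)))) ,
      ≃⇒≈ (≃-trans (im-vertexForm x y) (fromℚ*-zero B (≃-trans (+-cong xy≃0 xy≃0) (+-identityˡ 0ℝ))))

    realRoot-isRoot : 0ℚ ℚ.≤ c → IsRootOf[ γ -t] (realRoot b c)
    realRoot-isRoot 0≤c = quadratic-root (√ (fromℚ c)) 0ℝ
      (≃-trans (+-cong (√-fromℚ-square 0≤c) (≗⇒≃ {y = 0ℝ} λ _ → refl)) (+-identityʳ (fromℚ c)))
      (≗⇒≃ λ n → ℚ.*-zeroʳ (seq (√ (fromℚ c)) n))

    complexRoot-isRoot : c ℚ.≤ 0ℚ → IsRootOf[ γ -t] (complexRoot b c)
    complexRoot-isRoot c≤0 = quadratic-root 0ℝ (√ (fromℚ (ℚ.- c)))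
      (≃-trans (+-cong ≃-refl (-‿cong (√-fromℚ-square (ℚ.neg-antimono-≤ c≤0)))) (≗⇒≃ λ _ → 0--c≡c c))
      (≗⇒≃ λ n → ℚ.*-zeroˡ (seq (√ (fromℚ (ℚ.- c))) n))
      where
      0--c≡c : ∀ c → 0ℚ ℚ.* 0ℚ ℚ.+ ℚ.- (ℚ.- c) ≡ c
      0--c≡c = solve-∀ ℚ-ring

fromℚ-cancel-<0 : ∀ q → fromℚ q < 0ℝ → q ℚ.< 0ℚ
fromℚ-cancel-<0 q (e , 0<e , q+e<0) = ℚ.<-trans (p<p+q 0<e) (proj₂ (Eventually⇒∃ q+e<0))

b+√c<0⇒b<0×c<b² : ∀ {b c} → 0ℚ ℚ.≤ c → fromℚ b + √ (fromℚ c) < 0ℝ → b ℚ.< 0ℚ × c ℚ.< b ℚ.* b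
b+√c<0⇒b<0×c<b² {b} {c} 0≤c (e , 0<e , b+√c+e<0) =
  let n , b+σ+e<0 , 1/[1+n]<e = Eventually⇒∃ (Eventually-zip b+√c+e<0 (1/[1+n]-small 0<e))
  in bounds (√-SqrtApprox (fromℚ c) n) (0<1/[1+n] n) b+σ+e<0 1/[1+n]<e
  where
  bounds : ∀ {d σ} → SqrtApprox d ℚ.∣ c ∣ σ → 0ℚ ℚ.< d → b ℚ.+ σ ℚ.+ e ℚ.< 0ℚ → d ℚ.< e →
           b ℚ.< 0ℚ × c ℚ.< b ℚ.* b
  bounds {d} {σ} σ≈√c 0<d b+σ+e<0 d<e = b<0 , (begin-strict
    c                           ≤⟨ p≤∣p∣ c ⟩
    ℚ.∣ c ∣                     <⟨ upper σ≈√c ⟩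
    (σ ℚ.+ d) ℚ.* (σ ℚ.+ d)     <⟨ square-mono-< (ℚ.<⇒≤ 0<σ+d) σ+d<-b ⟩
    ℚ.- b ℚ.* ℚ.- b             ≡⟨ -p*-p≡p*p b ⟩
    b ℚ.* b                     ∎)
    where
    open ℚ.≤-Reasoning
    0<σ+d : 0ℚ ℚ.< σ ℚ.+ d
    0<σ+d = ℚ.+-mono-≤-< (nonNegative σ≈√c) 0<d
    σ+d<-b : σ ℚ.+ d ℚ.< ℚ.- b
    σ+d<-b = <-resp-difference (ℚ.+-mono-< b+σ+e<0 d<e) (identity b σ d e)
      where
      identity : ∀ b σ d e → ℚ.- b ℚ.- (σ ℚ.+ d) ≡ (0ℚ ℚ.+ e) ℚ.- (b ℚ.+ σ ℚ.+ e ℚ.+ d)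
      identity = solve-∀ ℚ-ring
    b<0 : b ℚ.< 0ℚ
    b<0 = <-resp-difference (ℚ.<-trans 0<σ+d σ+d<-b) (identity b)
      where
      identity : ∀ b → 0ℚ ℚ.- b ≡ ℚ.- b ℚ.- 0ℚ
      identity = solve-∀ ℚ-ring

module _ (γ₁ γ₂ : ℤ) (roots : NegativeRoots γ₁ γ₂) where
  private
    A B : ℚ
    A = ι γ₁
    B = ι γ₂

  linear-bounds : B ≡ 0ℚ → γ-Bounds A B
  linear-bounds B≡0 = ℚ.≮⇒≥ A≮1 , ℚ.≤-reflexive (sym B≡0) ,
    subst (λ B → fromℕ 4 ℚ.* B ℚ.≤ (A ℚ.- 1ℚ) ℚ.* (A ℚ.- 1ℚ)) (sym B≡0) (0≤p*p (A ℚ.- 1ℚ))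
    where
    A≮1 : ¬ A ℚ.< 1ℚ
    A≮1 A<1 =
      let i , [1-A]*i≡1 , 0<i = divide 1ℚ 0<1-A
          i<0 = fromℚ-cancel-<0 i (proj₂ (roots (fromℚ i +i 0ℝ) (linearRoot-isRoot γ₁ γ₂ B≡0 {i} [1-A]*i≡1)))
      in ℚ.<-asym (0<i 0<1) i<0
      where
      0<1-A : 0ℚ ℚ.< 1ℚ ℚ.- A
      0<1-A = <-resp-difference A<1 (ℚ.+-identityʳ (1ℚ ℚ.- A))

  quadratic-bounds : B ≢ 0ℚ → γ-Bounds A B
  quadratic-bounds B≢0 =
    let b , c , vertexForm = vertexForm-exists A B≢0
        0≤c = ℚ.≮⇒≥ λ c<0 → √-fromℚ-nonzero (ℚ.neg-antimono-< c<0)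
                (≈⇒≃ (proj₁ (roots (complexRoot b c) (complexRoot-isRoot γ₁ γ₂ vertexForm (ℚ.<⇒≤ c<0)))))
        b<0 , c<b² = b+√c<0⇒b<0×c<b² 0≤c (proj₂ (roots (realRoot b c) (realRoot-isRoot γ₁ γ₂ vertexForm 0≤c)))
    in vertexForm⇒γ-Bounds vertexForm 0≤c b<0 c<b²

  negativeRoots⇒γ-Bounds : γ-Bounds A B
  negativeRoots⇒γ-Bounds with B ℚ.≟ 0ℚ
  ... | yes B≡0 = linear-bounds B≡0
  ... | no  B≢0 = quadratic-bounds B≢0

γ-Bounds⇒ℕ : ∀ γ₁ γ₂ → γ-Bounds (ι γ₁) (ι γ₂) → ∃₂ λ a g → γ₁ ≡ + suc a × γ₂ ≡ + g × 4 ℕ.* g ℕ.≤ a ℕ.* a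
γ-Bounds⇒ℕ γ₁ γ₂ (1≤A , 0≤B , _) with ι-cancel-≤ {+ 1} {γ₁} 1≤A | ι-cancel-≤ {+ 0} {γ₂} 0≤B
γ-Bounds⇒ℕ (+ suc a) (+ g) (_ , _ , 4B≤[A-1]²) | _ | _ = a , g , refl , refl ,
  fromℕ-cancel-≤ (subst₂ ℚ._≤_ (sym (fromℕ-homo-* 4 g)) [A-1]²≡a² 4B≤[A-1]²)
  where
  open ≡.≡-Reasoning
  A-1≡a : fromℕ (suc a) ℚ.- 1ℚ ≡ fromℕ a
  A-1≡a = ≡.trans (cong (ℚ._- 1ℚ) (fromℕ-suc a)) (cancel (fromℕ a))
    where
    cancel : ∀ p → 1ℚ ℚ.+ p ℚ.- 1ℚ ≡ p
    cancel = solve-∀ ℚ-ring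
  [A-1]²≡a² : (fromℕ (suc a) ℚ.- 1ℚ) ℚ.* (fromℕ (suc a) ℚ.- 1ℚ) ≡ fromℕ (a ℕ.* a)
  [A-1]²≡a² = ≡.trans (cong₂ ℚ._*_ A-1≡a A-1≡a) (sym (fromℕ-homo-* a a))
  fromℕ-cancel-≤ : ∀ {m n} → fromℕ m ℚ.≤ fromℕ n → m ℕ.≤ n
  fromℕ-cancel-≤ fm≤fn = ℤ.drop‿+≤+ (ι-cancel-≤ fm≤fn)
γ-Bounds⇒ℕ (+ zero) _        _ | ℤ.+≤+ () | _
γ-Bounds⇒ℕ -[1+ _ ] _        _ | ()       | _
γ-Bounds⇒ℕ _        -[1+ _ ] _ | _        | ()

theorem3p2p1 : (γ₁ γ₂ : ℤ) → let γ = + 1 ∷ γ₁ ∷ γ₂ ∷ [] in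
    (∀ z → IsRootOf[ γ -t] z → im z ≈ 0ℝ × re z < 0ℝ) →
    Σ[ h ∈ Polynomial ] Is[1+t]⁴p[t/[1+t]²] h γ ×
      (Σ[ n ∈ ℕ ] Σ[ X ∈ SimplicialComplex n ] Flag X × TriangulatesS³ X × IsHPolynomial X h)
theorem3p2p1 γ₁ γ₂ roots with γ-Bounds⇒ℕ γ₁ γ₂ (negativeRoots⇒γ-Bounds γ₁ γ₂ roots)
... | a , g , refl , refl , 4g≤a² =
  let _ , _ , sphere = realize a g 4g≤a²
      open MarkedSphere sphere using (size; graph; triangulates; f-poly)
      X = cliqueComplex graph
  in hPolynomial (+ suc a) (+ g) , hPolynomial-γ (+ suc a) (+ g) ,
     size , X , cliqueComplex-flag graph , triangulates ,
     hPolynomial-f X (suc a) g (λ t → ≡.trans (fPolynomial-cliqueComplex graph t) (f-poly t))
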